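{- Let $\mathcal F=\{F_i\}_{i\in[s]}$ and $\mathcal G=\{G_i\}_{i\in[s]}$ be finite conjugate closed sets of constraint functions with disjoint domains $V(\mathcal F)$ and $V(\mathcal G)$, respectively (not necessarily of the same size), where $F_i$ and $G_i$ have the same arity for each $i$. Assume further that there is an index $i$ such that $F_i$ and $G_i$ are both projectively connected (so have arity at least $2$). If there are $\hat x\in V(\mathcal F)$ and $\hat y\in V(\mathcal G)$ in the same orbit of $\mathrm{Qut}(\mathcal F\oplus\mathcal G)$, then $\mathcal F\cong_{qc}\mathcal G$.
   Context: A constraint function of finite domain $V$ and arity $n\ge1$ is a tensor $F\in\mathbb C^{V^n}$, with vectorization $f\in\mathbb C^{V^n}$ (a column vector); a set of constraint functions is conjugate closed if it is closed under entrywise complex conjugation. Quantum permutation matrix: a square matrix $\mathcal U=(u_{ij})$ over a (nonzero) unital $C^*$-algebra with $u_{ij}^2=u_{ij}=u_{ij}^*$ and all row and column sums equal to $\mathbf 1$ (rows and columns may be indexed by different sets of equal cardinality). $(\mathcal U^{\otimes n})_{x_1\ldots x_n,y_1\ldots y_n}=u_{x_1y_1}\cdots u_{x_ny_n}$; scalars $\alpha$ are identified with $\alpha\mathbf 1$. $\mathcal F\cong_{qc}\mathcal G$ means that $|V(\mathcal F)|=|V(\mathcal G)|$ and there is a single quantum permutation matrix $\mathcal U$, with rows indexed by $V(\mathcal G)$ and columns by $V(\mathcal F)$, such that $\mathcal U^{\otimes\operatorname{arity}(F_i)}f_i=g_i$ for every $i$ (this relation is symmetric). For a finite set $\mathcal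 H$ of constraint functions on domain $V$, $\mathrm{Qut}(\mathcal H)$ is given by the universal unital $C^*$-algebra generated by the entries of a $V\times V$ matrix $\mathcal U=(u_{xy})$ subject to: $\mathcal U$ is a quantum permutation matrix, and $\mathcal U^{\otimes\operatorname{arity}(H)}h=h$ for all $H\in\mathcal H$. Its orbits are the classes of the equivalence relation $x\sim y\iff u_{xy}\ne0$ on $V$. Direct sum: for $F\in\mathbb C^{V(F)^n}$, $G\in\mathbb C^{V(G)^n}$ with $n\ge2$, $F\oplus G\in\mathbb C^{(V(F)\sqcup V(G))^n}$ equals $F_{\mathbf x}$ if $\mathbf x\in V(F)^n$, $G_{\mathbf x}$ if $\mathbf x\in V(G)^n$, and $0$ otherwise. For $n=1$, $F\oplus G$ is the binary function on $V(F)\sqcup V(G)$ with $(F\oplus G)_{xy}=F_x$ if $x=y\in V(F)$, $G_x$ if $x=y\in V(G)$, and $0$ otherwise. $\mathcal F\oplus\mathcal G=\{F_i\oplus G_i\mid i\in[s]\}$. A $\mathbb C$-weighted graph is a matrix $X\in\mathbb C^{V\times V}$; it is disconnected if $V$ is the disjoint union of nonempty sets $I,J$ with $X_{uv}=0$ unless $u,v\in I$ or $u,v\in J$, and connected otherwise. For $n\ge2$, an $n$-ary $F$ is projectively connected if the $\mathbb C$-weighted graph $X_{uv}=\sum_{x_1,\ldots,x_{n-2}}F_{x_1\ldots x_{n-2}uv}$ is connected. -}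

module Defs where

open import Level using (Level; 0ℓ; _⊔_) renaming (suc to lsuc)
open import Algebra.Bundles using (CommutativeMonoid; CommutativeRing; Ring)
open import Algebra.Module.Structures using (IsLeftModule)
open import Algebra.Morphism.Structures using (module RingMorphisms)
import Algebra.Properties.CommutativeMonoid.Sum as Sum
open import Data.Bool.Base using (if_then_else_)
open import Data.Empty using (⊥)
open import Data.Fin.Base using (Fin; splitAt)
open import Data.Fin.Properties using (_≟_)
open import Data.Fin.Subset using (Subset; Nonempty; _∈_; _∪_; _∩_) renaming (⊤ to full; ⊥ to empty)
open import Data.Maybe.Base using (maybe′)
open import Data.Maybe.Effectful using (applicative)
open import Data.Nat.Base as ℕ using (ℕ; zero; suc)
import Data.Nat.Properties as ℕ
open import Data.Product.Base using (∃₂; ∃-syntax; Σ-syntax; _×_; _,_)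
open import Data.Rational.Base as ℚ using (ℚ; 0ℚ; 1ℚ; ½)
import Data.Rational.Properties as ℚ
import Data.Rational.Solver as ℚSolver
open import Data.Sum using (_⊎_; inj₁; inj₂; isInj₁; isInj₂)
open import Data.Vec.Base as Vec using (Vec; []; _∷_; _∷ʳ_)
open import Data.Vec.Effectful using (module TraversableA)
open import Function.Base using (_∘_)
open import Relation.Binary.PropositionalEquality as ≡ using (_≡_)
open import Relation.Nullary.Decidable.Core using (does)
open import Relation.Nullary.Negation.Core using (¬_)

-- ℝ is Cauchy sequences of rationals; _≈ʳ_ identifies those differing by a null sequence.
Cauchy : (ℕ → ℚ) → Set
Cauchy x = ∀ ε → 0ℚ ℚ.< ε → ∃[ N ] ∀ m n → N ℕ.≤ m → N ℕ.≤ n → ℚ.∣ x m ℚ.- x n ∣ ℚ.< ε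

record ℝ : Set where
  constructor _,_
  field
    seq    : ℕ → ℚ
    cauchy : Cauchy seq

open ℝ public

infix 4 _≈ʳ_ _≤ʳ_

record _≈ʳ_ (x y : ℝ) : Set where
  constructor mk≈
  field
    approx : ∀ ε → 0ℚ ℚ.< ε → ∃[ N ] ∀ n → N ℕ.≤ n → ℚ.∣ seq x n ℚ.- seq y n ∣ ℚ.< ε

open _≈ʳ_ public

record _≤ʳ_ (x y : ℝ) : Set where
  constructor mk≤
  field
    below : ∀ ε → 0ℚ ℚ.< ε → ∃[ N ] ∀ n → N ℕ.≤ n → seq x n ℚ.< seq y n ℚ.+ ε

open _≤ʳ_ public

½-pos : ∀ {ε} → 0ℚ ℚ.< ε → 0ℚ ℚ.< ½ ℚ.* ε
½-pos {ε} 0<ε = ≡.subst (ℚ._< ½ ℚ.* ε) (ℚ.*-zeroʳ ½) (ℚ.*-monoʳ-<-pos ½ 0<ε)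

½+½ : ∀ ε → ½ ℚ.* ε ℚ.+ ½ ℚ.* ε ≡ ε
½+½ ε = ≡.trans (≡.sym (ℚ.*-distribʳ-+ ε ½ ½)) (ℚ.*-identityˡ ε)

split-< : ∀ {p a b ε} → p ℚ.≤ a ℚ.+ b → a ℚ.< ½ ℚ.* ε → b ℚ.< ½ ℚ.* ε → p ℚ.< ε
split-< {p} {a} {b} {ε} p≤ a< b< =
  ℚ.≤-<-trans p≤ (≡.subst (a ℚ.+ b ℚ.<_) (½+½ ε) (ℚ.+-mono-< a< b<))

∣-∣-refl : ∀ p → ℚ.∣ p ℚ.- p ∣ ≡ 0ℚ
∣-∣-refl p = ≡.cong ℚ.∣_∣ (ℚ.+-inverseʳ p)

∣-∣-neg : ∀ p q → ℚ.∣ ℚ.- p ℚ.- ℚ.- q ∣ ≡ ℚ.∣ p ℚ.- q ∣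
∣-∣-neg p q = ≡.trans (≡.cong ℚ.∣_∣ (≡.sym (ℚ.neg-distrib-+ p (ℚ.- q)))) (ℚ.∣-p∣≡∣p∣ (p ℚ.- q))

∣-∣-sym : ∀ p q → ℚ.∣ p ℚ.- q ∣ ≡ ℚ.∣ q ℚ.- p ∣
∣-∣-sym p q = ≡.trans (≡.cong ℚ.∣_∣ lemma) (ℚ.∣-p∣≡∣p∣ (q ℚ.- p))
  where
  open ℚSolver.+-*-Solver
  lemma : p ℚ.- q ≡ ℚ.- (q ℚ.- p)
  lemma = solve 2 (λ p q → p :- q := :- (q :- p)) ≡.refl p q

∣-∣-triangle : ∀ p q r → ℚ.∣ p ℚ.- r ∣ ℚ.≤ ℚ.∣ p ℚ.- q ∣ ℚ.+ ℚ.∣ q ℚ.- r ∣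
∣-∣-triangle p q r = ≡.subst (ℚ._≤ ℚ.∣ p ℚ.- q ∣ ℚ.+ ℚ.∣ q ℚ.- r ∣) (≡.cong ℚ.∣_∣ lemma) (ℚ.∣p+q∣≤∣p∣+∣q∣ (p ℚ.- q) (q ℚ.- r))
  where
  open ℚSolver.+-*-Solver
  lemma : (p ℚ.- q) ℚ.+ (q ℚ.- r) ≡ p ℚ.- r
  lemma = solve 3 (λ p q r → (p :- q) :+ (q :- r) := p :- r) ≡.refl p q r

∣-∣-+ : ∀ a b c d → ℚ.∣ (a ℚ.+ b) ℚ.- (c ℚ.+ d) ∣ ℚ.≤ ℚ.∣ a ℚ.- c ∣ ℚ.+ ℚ.∣ b ℚ.- d ∣
∣-∣-+ a b c d = ≡.subst (ℚ._≤ ℚ.∣ a ℚ.- c ∣ ℚ.+ ℚ.∣ b ℚ.- d ∣) (≡.cong ℚ.∣_∣ lemma) (ℚ.∣p+q∣≤∣p∣+∣q∣ (a ℚ.- c) (b ℚ.- d))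
  where
  open ℚSolver.+-*-Solver
  lemma : (a ℚ.- c) ℚ.+ (b ℚ.- d) ≡ (a ℚ.+ b) ℚ.- (c ℚ.+ d)
  lemma = solve 4 (λ a b c d → (a :- c) :+ (b :- d) := (a :+ b) :- (c :+ d)) ≡.refl a b c d

∣-∣-* : ∀ a b c d → ℚ.∣ a ℚ.* b ℚ.- c ℚ.* d ∣ ℚ.≤ ℚ.∣ a ∣ ℚ.* ℚ.∣ b ℚ.- d ∣ ℚ.+ ℚ.∣ d ∣ ℚ.* ℚ.∣ a ℚ.- c ∣
∣-∣-* a b c d = ≡.subst₂ ℚ._≤_ (≡.cong ℚ.∣_∣ lemma)
  (≡.cong₂ ℚ._+_ (ℚ.∣p*q∣≡∣p∣*∣q∣ a (b ℚ.- d)) (ℚ.∣p*q∣≡∣p∣*∣q∣ d (a ℚ.- c)))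
  (ℚ.∣p+q∣≤∣p∣+∣q∣ (a ℚ.* (b ℚ.- d)) (d ℚ.* (a ℚ.- c)))
  where
  open ℚSolver.+-*-Solver
  lemma : a ℚ.* (b ℚ.- d) ℚ.+ d ℚ.* (a ℚ.- c) ≡ a ℚ.* b ℚ.- c ℚ.* d
  lemma = solve 4 (λ a b c d → a :* (b :- d) :+ d :* (a :- c) := a :* b :- c :* d) ≡.refl a b c d

divide : ∀ {A ε} → 0ℚ ℚ.< A → 0ℚ ℚ.< ε → ∃[ δ ] 0ℚ ℚ.< δ × A ℚ.* δ ≡ ε
divide {A} {ε} 0<A 0<ε = A⁻¹ ℚ.* ε , pos , eq
  where
  instance
    A-pos : ℚ.Positive A
    A-pos = ℚ.positive 0<A
    A-nonZero : ℚ.NonZero A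
    A-nonZero = ℚ.pos⇒nonZero A
  A⁻¹ : ℚ
  A⁻¹ = ℚ.1/ A
  pos : 0ℚ ℚ.< A⁻¹ ℚ.* ε
  pos = ≡.subst (ℚ._< A⁻¹ ℚ.* ε) (ℚ.*-zeroʳ A⁻¹)
    (ℚ.*-monoʳ-<-pos A⁻¹ {{ℚ.1/pos⇒pos A}} 0<ε)
  eq : A ℚ.* (A⁻¹ ℚ.* ε) ≡ ε
  eq = ≡.trans (≡.sym (ℚ.*-assoc A A⁻¹ ε))
    (≡.trans (≡.cong (ℚ._* ε) (ℚ.*-inverseʳ A)) (ℚ.*-identityˡ ε))

∣*∣-< : ∀ {a d A δ} → 0ℚ ℚ.< A → ℚ.∣ a ∣ ℚ.< A → ℚ.∣ d ∣ ℚ.< δ → ℚ.∣ a ∣ ℚ.* ℚ.∣ d ∣ ℚ.< A ℚ.* δ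
∣*∣-< {a} {d} {A} 0<A a<A d<δ = ℚ.≤-<-trans
  (ℚ.*-monoʳ-≤-nonNeg ℚ.∣ d ∣ {{ℚ.nonNegative (ℚ.0≤∣p∣ d)}} (ℚ.<⇒≤ a<A))
  (ℚ.*-monoʳ-<-pos A {{ℚ.positive 0<A}} d<δ)

bounded : ∀ x → Cauchy x → ∃₂ λ B N → 0ℚ ℚ.< B × ∀ n → N ℕ.≤ n → ℚ.∣ x n ∣ ℚ.< B
bounded x c with c 1ℚ (ℚ.positive⁻¹ 1ℚ)
... | N , close = 1ℚ ℚ.+ ℚ.∣ x N ∣ , N
    , ℚ.+-mono-<-≤ {0ℚ} {1ℚ} {0ℚ} (ℚ.positive⁻¹ 1ℚ) (ℚ.0≤∣p∣ (x N))
    , λ n N≤n → ℚ.≤-<-trans (tri n) (ℚ.+-monoˡ-< ℚ.∣ x N ∣ (close n N N≤n ℕ.≤-refl))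
  where
  open ℚSolver.+-*-Solver
  tri : ∀ n → ℚ.∣ x n ∣ ℚ.≤ ℚ.∣ x n ℚ.- x N ∣ ℚ.+ ℚ.∣ x N ∣
  tri n = ≡.subst (ℚ._≤ ℚ.∣ x n ℚ.- x N ∣ ℚ.+ ℚ.∣ x N ∣)
    (≡.cong ℚ.∣_∣ (solve 2 (λ p q → (p :- q) :+ q := p) ≡.refl (x n) (x N)))
    (ℚ.∣p+q∣≤∣p∣+∣q∣ (x n ℚ.- x N) (x N))

max₂ : ∀ {a b n} → a ℕ.⊔ b ℕ.≤ n → a ℕ.≤ n × b ℕ.≤ n
max₂ {a} {b} p = ℕ.m⊔n≤o⇒m≤o a b p , ℕ.m⊔n≤o⇒n≤o a b p

fromℚ : ℚ → ℝ
fromℚ q = (λ _ → q) , λ ε 0<ε → 0 , λ _ _ _ _ → ≡.subst (ℚ._< ε) (≡.sym (∣-∣-refl q)) 0<ε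

0ʳ 1ʳ : ℝ
0ʳ = fromℚ 0ℚ
1ʳ = fromℚ 1ℚ

abstract
  +-cauchy : ∀ {x y} → Cauchy x → Cauchy y → Cauchy (λ n → x n ℚ.+ y n)
  +-cauchy {x} {y} x-cauchy y-cauchy ε 0<ε =
    let N₁ , c₁ = x-cauchy (½ ℚ.* ε) (½-pos 0<ε)
        N₂ , c₂ = y-cauchy (½ ℚ.* ε) (½-pos 0<ε)
    in N₁ ℕ.⊔ N₂ , λ m n N≤m N≤n →
         let m₁ , m₂ = max₂ {N₁} {N₂} N≤m
             n₁ , n₂ = max₂ {N₁} {N₂} N≤n
         in split-< (∣-∣-+ (x m) (y m) (x n) (y n)) (c₁ m n m₁ n₁) (c₂ m n m₂ n₂)

  neg-cauchy : ∀ {x} → Cauchy x → Cauchy (λ n → ℚ.- x n)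
  neg-cauchy {x} x-cauchy ε 0<ε =
    let N , c = x-cauchy ε 0<ε
    in N , λ m n N≤m N≤n → ≡.subst (ℚ._< ε) (≡.sym (∣-∣-neg (x m) (x n))) (c m n N≤m N≤n)

  *-cauchy : ∀ {x y} → Cauchy x → Cauchy y → Cauchy (λ n → x n ℚ.* y n)
  *-cauchy {x} {y} x-cauchy y-cauchy ε 0<ε =
    let A , K₁ , 0<A , x<A = bounded x x-cauchy
        B , K₂ , 0<B , y<B = bounded y y-cauchy
        δ₁ , 0<δ₁ , Aδ₁ = divide 0<A (½-pos 0<ε)
        δ₂ , 0<δ₂ , Bδ₂ = divide 0<B (½-pos 0<ε)
        N₁ , c₁ = x-cauchy δ₂ 0<δ₂
        N₂ , c₂ = y-cauchy δ₁ 0<δ₁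
    in (K₁ ℕ.⊔ K₂) ℕ.⊔ (N₁ ℕ.⊔ N₂) , λ m n ≤m ≤n →
         let kₘ , lₘ = max₂ {K₁ ℕ.⊔ K₂} {N₁ ℕ.⊔ N₂} ≤m
             kₙ , lₙ = max₂ {K₁ ℕ.⊔ K₂} {N₁ ℕ.⊔ N₂} ≤n
             K₁≤m , _ = max₂ {K₁} {K₂} kₘ
             _ , K₂≤n = max₂ {K₁} {K₂} kₙ
             N₁≤m , N₂≤m = max₂ {N₁} {N₂} lₘ
             N₁≤n , N₂≤n = max₂ {N₁} {N₂} lₙ
         in split-< (∣-∣-* (x m) (y m) (x n) (y n))
              (≡.subst (_ ℚ.<_) Aδ₁ (∣*∣-< {x m} {y m ℚ.- y n} 0<A (x<A m K₁≤m) (c₂ m n N₂≤m N₂≤n)))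
              (≡.subst (_ ℚ.<_) Bδ₂ (∣*∣-< {y n} {x m ℚ.- x n} 0<B (y<B n K₂≤n) (c₁ m n N₁≤m N₁≤n)))

infixl 6 _+ʳ_
infixl 7 _*ʳ_
infix  8 -ʳ_

_+ʳ_ _*ʳ_ : ℝ → ℝ → ℝ
x +ʳ y = (λ n → seq x n ℚ.+ seq y n) , +-cauchy {seq x} {seq y} (cauchy x) (cauchy y)
x *ʳ y = (λ n → seq x n ℚ.* seq y n) , *-cauchy {seq x} {seq y} (cauchy x) (cauchy y)

-ʳ_ : ℝ → ℝ
-ʳ x = (λ n → ℚ.- seq x n) , neg-cauchy {seq x} (cauchy x)

pointwise : ∀ {x y} → (∀ n → seq x n ≡ seq y n) → x ≈ʳ y
pointwise {x} x≡y = mk≈ λ ε 0<ε → 0 , λ n _ → ≡.subst (ℚ._< ε)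
  (≡.trans (≡.sym (∣-∣-refl (seq x n))) (≡.cong (λ q → ℚ.∣ seq x n ℚ.- q ∣) (x≡y n))) 0<ε

≈ʳ-refl : ∀ {x} → x ≈ʳ x
≈ʳ-refl = pointwise λ _ → ≡.refl

≈ʳ-sym : ∀ {x y} → x ≈ʳ y → y ≈ʳ x
≈ʳ-sym {x} {y} (mk≈ x≈y) = mk≈ λ ε 0<ε →
  let N , c = x≈y ε 0<ε
  in N , λ n N≤n → ≡.subst (ℚ._< ε) (∣-∣-sym (seq x n) (seq y n)) (c n N≤n)

≈ʳ-trans : ∀ {x y z} → x ≈ʳ y → y ≈ʳ z → x ≈ʳ z
≈ʳ-trans {x} {y} {z} (mk≈ x≈y) (mk≈ y≈z) = mk≈ λ ε 0<ε →
  let N₁ , c₁ = x≈y (½ ℚ.* ε) (½-pos 0<ε)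
      N₂ , c₂ = y≈z (½ ℚ.* ε) (½-pos 0<ε)
  in N₁ ℕ.⊔ N₂ , λ n N≤n →
       let n₁ , n₂ = max₂ {N₁} {N₂} N≤n
       in split-< (∣-∣-triangle (seq x n) (seq y n) (seq z n)) (c₁ n n₁) (c₂ n n₂)

+ʳ-cong : ∀ {x y u v} → x ≈ʳ y → u ≈ʳ v → x +ʳ u ≈ʳ y +ʳ v
+ʳ-cong {x} {y} {u} {v} (mk≈ x≈y) (mk≈ u≈v) = mk≈ λ ε 0<ε →
  let N₁ , c₁ = x≈y (½ ℚ.* ε) (½-pos 0<ε)
      N₂ , c₂ = u≈v (½ ℚ.* ε) (½-pos 0<ε)
  in N₁ ℕ.⊔ N₂ , λ n N≤n →
       let n₁ , n₂ = max₂ {N₁} {N₂} N≤n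
       in split-< (∣-∣-+ (seq x n) (seq u n) (seq y n) (seq v n)) (c₁ n n₁) (c₂ n n₂)

-ʳ-cong : ∀ {x y} → x ≈ʳ y → -ʳ x ≈ʳ -ʳ y
-ʳ-cong {x} {y} (mk≈ x≈y) = mk≈ λ ε 0<ε →
  let N , c = x≈y ε 0<ε
  in N , λ n N≤n → ≡.subst (ℚ._< ε) (≡.sym (∣-∣-neg (seq x n) (seq y n))) (c n N≤n)

*ʳ-cong : ∀ {x y u v} → x ≈ʳ y → u ≈ʳ v → x *ʳ u ≈ʳ y *ʳ v
*ʳ-cong {x} {y} {u} {v} (mk≈ x≈y) (mk≈ u≈v) = mk≈ λ ε 0<ε →
  let A , K₁ , 0<A , x<A = bounded (seq x) (cauchy x)
      B , K₂ , 0<B , v<B = bounded (seq v) (cauchy v)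
      δ₁ , 0<δ₁ , Aδ₁ = divide 0<A (½-pos 0<ε)
      δ₂ , 0<δ₂ , Bδ₂ = divide 0<B (½-pos 0<ε)
      N₁ , c₁ = x≈y δ₂ 0<δ₂
      N₂ , c₂ = u≈v δ₁ 0<δ₁
  in (K₁ ℕ.⊔ K₂) ℕ.⊔ (N₁ ℕ.⊔ N₂) , λ n ≤n →
       let k , l = max₂ {K₁ ℕ.⊔ K₂} {N₁ ℕ.⊔ N₂} ≤n
           K₁≤n , K₂≤n = max₂ {K₁} {K₂} k
           N₁≤n , N₂≤n = max₂ {N₁} {N₂} l
       in split-< (∣-∣-* (seq x n) (seq u n) (seq y n) (seq v n))
            (≡.subst (_ ℚ.<_) Aδ₁ (∣*∣-< {seq x n} {seq u n ℚ.- seq v n} 0<A (x<A n K₁≤n) (c₂ n N₂≤n)))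
            (≡.subst (_ ℚ.<_) Bδ₂ (∣*∣-< {seq v n} {seq x n ℚ.- seq y n} 0<B (v<B n K₂≤n) (c₁ n N₁≤n)))

ℝ-commutativeRing : CommutativeRing 0ℓ 0ℓ
ℝ-commutativeRing = record
  { Carrier = ℝ ; _≈_ = _≈ʳ_ ; _+_ = _+ʳ_ ; _*_ = _*ʳ_ ; -_ = -ʳ_ ; 0# = 0ʳ ; 1# = 1ʳ
  ; isCommutativeRing = record
    { isRing = record
      { +-isAbelianGroup = record
        { isGroup = record
          { isMonoid = record
            { isSemigroup = record
              { isMagma = record
                { isEquivalence = record { refl = ≈ʳ-refl ; sym = ≈ʳ-sym ; trans = ≈ʳ-trans }
                ; ∙-cong = +ʳ-cong
                }
              ; assoc = λ x y z → pointwise λ n → ℚ.+-assoc (seq x n) (seq y n) (seq z n)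
              }
            ; identity = (λ x → pointwise λ n → ℚ.+-identityˡ (seq x n))
                       , (λ x → pointwise λ n → ℚ.+-identityʳ (seq x n))
            }
          ; inverse = (λ x → pointwise λ n → ℚ.+-inverseˡ (seq x n))
                    , (λ x → pointwise λ n → ℚ.+-inverseʳ (seq x n))
          ; ⁻¹-cong = -ʳ-cong
          }
        ; comm = λ x y → pointwise λ n → ℚ.+-comm (seq x n) (seq y n)
        }
      ; *-cong = *ʳ-cong
      ; *-assoc = λ x y z → pointwise λ n → ℚ.*-assoc (seq x n) (seq y n) (seq z n)
      ; *-identity = (λ x → pointwise λ n → ℚ.*-identityˡ (seq x n))
                   , (λ x → pointwise λ n → ℚ.*-identityʳ (seq x n))
      ; distrib = (λ x y z → pointwise λ n → ℚ.*-distribˡ-+ (seq x n) (seq y n) (seq z n))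
                , (λ x y z → pointwise λ n → ℚ.*-distribʳ-+ (seq x n) (seq y n) (seq z n))
      }
    ; *-comm = λ x y → pointwise λ n → ℚ.*-comm (seq x n) (seq y n)
    }
  }

record ℂ : Set where
  constructor _+i_
  field
    re im : ℝ

open ℂ public

infix 4 _≈ᶜ_

record _≈ᶜ_ (z w : ℂ) : Set where
  constructor _,_
  field
    re≈ : re z ≈ʳ re w
    im≈ : im z ≈ʳ im w

open _≈ᶜ_ public

infixl 6 _+ᶜ_
infixl 7 _*ᶜ_
infix  8 -ᶜ_

0ᶜ 1ᶜ : ℂ
0ᶜ = 0ʳ +i 0ʳ
1ᶜ = 1ʳ +i 0ʳ

_+ᶜ_ _*ᶜ_ : ℂ → ℂ → ℂ
z +ᶜ w = (re z +ʳ re w) +i (im z +ʳ im w)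
z *ᶜ w = (re z *ʳ re w +ʳ -ʳ (im z *ʳ im w)) +i (re z *ʳ im w +ʳ im z *ʳ re w)

-ᶜ_ conj : ℂ → ℂ
-ᶜ z   = (-ʳ re z) +i (-ʳ im z)
conj z = re z +i (-ʳ im z)

∣_∣² : ℂ → ℝ
∣ z ∣² = re z *ʳ re z +ʳ im z *ʳ im z

private
  at : (z : ℂ) (n : ℕ) → ℚ × ℚ
  at z n = seq (re z) n , seq (im z) n

  *ᶜ-assoc : ∀ x y z → (x *ᶜ y) *ᶜ z ≈ᶜ x *ᶜ (y *ᶜ z)
  *ᶜ-assoc x y z =
      (pointwise λ k → let (a , b) = at x k ; (c , d) = at y k ; (e , f) = at z k in
        solve 6 (λ a b c d e f →
          (a :* c :+ :- (b :* d)) :* e :+ :- ((a :* d :+ b :* c) :* f) :=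
          a :* (c :* e :+ :- (d :* f)) :+ :- (b :* (c :* f :+ d :* e))) ≡.refl a b c d e f)
    , (pointwise λ k → let (a , b) = at x k ; (c , d) = at y k ; (e , f) = at z k in
        solve 6 (λ a b c d e f →
          (a :* c :+ :- (b :* d)) :* f :+ (a :* d :+ b :* c) :* e :=
          a :* (c :* f :+ d :* e) :+ b :* (c :* e :+ :- (d :* f))) ≡.refl a b c d e f)
    where open ℚSolver.+-*-Solver

  *ᶜ-comm : ∀ x y → x *ᶜ y ≈ᶜ y *ᶜ x
  *ᶜ-comm x y =
      (pointwise λ k → let (a , b) = at x k ; (c , d) = at y k in
        solve 4 (λ a b c d → a :* c :+ :- (b :* d) := c :* a :+ :- (d :* b)) ≡.refl a b c d)
    , (pointwise λ k → let (a , b) = at x k ; (c , d) = at y k in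
        solve 4 (λ a b c d → a :* d :+ b :* c := c :* b :+ d :* a) ≡.refl a b c d)
    where open ℚSolver.+-*-Solver

  *ᶜ-identityˡ : ∀ x → 1ᶜ *ᶜ x ≈ᶜ x
  *ᶜ-identityˡ x =
      (pointwise λ k → let (a , b) = at x k in
        solve 2 (λ a b → con 1ℚ :* a :+ :- (con 0ℚ :* b) := a) ≡.refl a b)
    , (pointwise λ k → let (a , b) = at x k in
        solve 2 (λ a b → con 1ℚ :* b :+ con 0ℚ :* a := b) ≡.refl a b)
    where open ℚSolver.+-*-Solver

  *ᶜ-distribˡ : ∀ x y z → x *ᶜ (y +ᶜ z) ≈ᶜ x *ᶜ y +ᶜ x *ᶜ z
  *ᶜ-distribˡ x y z =
      (pointwise λ k → let (a , b) = at x k ; (c , d) = at y k ; (e , f) = at z k in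
        solve 6 (λ a b c d e f →
          a :* (c :+ e) :+ :- (b :* (d :+ f)) :=
          (a :* c :+ :- (b :* d)) :+ (a :* e :+ :- (b :* f))) ≡.refl a b c d e f)
    , (pointwise λ k → let (a , b) = at x k ; (c , d) = at y k ; (e , f) = at z k in
        solve 6 (λ a b c d e f →
          a :* (d :+ f) :+ b :* (c :+ e) :=
          (a :* d :+ b :* c) :+ (a :* f :+ b :* e)) ≡.refl a b c d e f)
    where open ℚSolver.+-*-Solver

  ≈ᶜ-trans : ∀ {x y z} → x ≈ᶜ y → y ≈ᶜ z → x ≈ᶜ z
  ≈ᶜ-trans (p , q) (p′ , q′) = ≈ʳ-trans p p′ , ≈ʳ-trans q q′

  +ᶜ-cong : ∀ {x y u v} → x ≈ᶜ y → u ≈ᶜ v → x +ᶜ u ≈ᶜ y +ᶜ v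
  +ᶜ-cong (p , q) (p′ , q′) = +ʳ-cong p p′ , +ʳ-cong q q′

ℂ-commutativeRing : CommutativeRing 0ℓ 0ℓ
ℂ-commutativeRing = record
  { Carrier = ℂ ; _≈_ = _≈ᶜ_ ; _+_ = _+ᶜ_ ; _*_ = _*ᶜ_ ; -_ = -ᶜ_ ; 0# = 0ᶜ ; 1# = 1ᶜ
  ; isCommutativeRing = record
    { isRing = record
      { +-isAbelianGroup = record
        { isGroup = record
          { isMonoid = record
            { isSemigroup = record
              { isMagma = record
                { isEquivalence = record
                  { refl  = ≈ʳ-refl , ≈ʳ-refl
                  ; sym   = λ (p , q) → ≈ʳ-sym p , ≈ʳ-sym q
                  ; trans = ≈ᶜ-trans
                  }
                ; ∙-cong = +ᶜ-cong
                }
              ; assoc = λ x y z → R.+-assoc (re x) (re y) (re z) , R.+-assoc (im x) (im y) (im z)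
              }
            ; identity = (λ x → R.+-identityˡ (re x) , R.+-identityˡ (im x))
                       , (λ x → R.+-identityʳ (re x) , R.+-identityʳ (im x))
            }
          ; inverse = (λ x → R.-‿inverseˡ (re x) , R.-‿inverseˡ (im x))
                    , (λ x → R.-‿inverseʳ (re x) , R.-‿inverseʳ (im x))
          ; ⁻¹-cong = λ (p , q) → -ʳ-cong p , -ʳ-cong q
          }
        ; comm = λ x y → R.+-comm (re x) (re y) , R.+-comm (im x) (im y)
        }
      ; *-cong = λ (p , q) (p′ , q′) →
          +ʳ-cong (*ʳ-cong p p′) (-ʳ-cong (*ʳ-cong q q′)) , +ʳ-cong (*ʳ-cong p q′) (*ʳ-cong q p′)
      ; *-assoc = *ᶜ-assoc
      ; *-identity = *ᶜ-identityˡ , λ x → ≈ᶜ-trans (*ᶜ-comm x 1ᶜ) (*ᶜ-identityˡ x)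
      ; distrib = *ᶜ-distribˡ
                , λ x y z → ≈ᶜ-trans (*ᶜ-comm (y +ᶜ z) x)
                    (≈ᶜ-trans (*ᶜ-distribˡ x y z) (+ᶜ-cong (*ᶜ-comm x y) (*ᶜ-comm x z)))
      }
    ; *-comm = *ᶜ-comm
    }
  }
  where module R = CommutativeRing ℝ-commutativeRing

record C*Algebra (c ℓ : Level) : Set (lsuc (c ⊔ ℓ)) where
  infixr 7 _·_
  infix  9 _⋆

  field
    ring : Ring c ℓ

  open Ring ring public

  field
    _·_          : ℂ → Carrier → Carrier
    isLeftModule : IsLeftModule (CommutativeRing.ring ℂ-commutativeRing) _≈_ _+_ 0# -_ _·_
    ·-*-assoc    : ∀ α a b → (α · a) * b ≈ α · (a * b)
    *-·-comm     : ∀ α a b → a * (α · b) ≈ α · (a * b)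

    _⋆           : Carrier → Carrier
    ⋆-cong       : ∀ {a b} → a ≈ b → a ⋆ ≈ b ⋆
    ⋆-involutive : ∀ a → (a ⋆) ⋆ ≈ a
    ⋆-+-homo     : ∀ a b → (a + b) ⋆ ≈ a ⋆ + b ⋆
    ⋆-·-antilin  : ∀ α a → (α · a) ⋆ ≈ conj α · (a ⋆)
    ⋆-*-anti     : ∀ a b → (a * b) ⋆ ≈ b ⋆ * a ⋆

    ‖_‖          : Carrier → ℝ
    ‖‖-cong      : ∀ {a b} → a ≈ b → ‖ a ‖ ≈ʳ ‖ b ‖
    ‖‖-nonNeg    : ∀ a → 0ʳ ≤ʳ ‖ a ‖
    ‖‖-definite  : ∀ a → ‖ a ‖ ≈ʳ 0ʳ → a ≈ 0#
    ‖‖-triangle  : ∀ a b → ‖ a + b ‖ ≤ʳ ‖ a ‖ +ʳ ‖ b ‖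
    -- ‖αa‖ = |α|‖a‖, squared so that |α| needs no square root
    ‖‖-homog     : ∀ α a → ‖ α · a ‖ *ʳ ‖ α · a ‖ ≈ʳ ∣ α ∣² *ʳ (‖ a ‖ *ʳ ‖ a ‖)
    ‖‖-submult   : ∀ a b → ‖ a * b ‖ ≤ʳ ‖ a ‖ *ʳ ‖ b ‖
    c*-identity  : ∀ a → ‖ a ⋆ * a ‖ ≈ʳ ‖ a ‖ *ʳ ‖ a ‖
    complete     : ∀ (a : ℕ → Carrier) →
      (∀ ε → 0ℚ ℚ.< ε → ∃[ N ] ∀ m n → N ℕ.≤ m → N ℕ.≤ n → ‖ a m - a n ‖ ≤ʳ fromℚ ε) →
      ∃[ l ] ∀ ε → 0ℚ ℚ.< ε → ∃[ N ] ∀ n → N ℕ.≤ n → ‖ a n - l ‖ ≤ʳ fromℚ ε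

record StarHom {c ℓ} (A B : C*Algebra c ℓ) : Set (c ⊔ ℓ) where
  private
    module A = C*Algebra A
    module B = C*Algebra B
  open RingMorphisms A.rawRing B.rawRing using (IsRingHomomorphism)

  field
    ⟦_⟧                : A.Carrier → B.Carrier
    isRingHomomorphism : IsRingHomomorphism ⟦_⟧
    ·-homo             : ∀ α a → ⟦ α A.· a ⟧ B.≈ α B.· ⟦ a ⟧
    ⋆-homo             : ∀ a → ⟦ a A.⋆ ⟧ B.≈ ⟦ a ⟧ B.⋆

-- Every finite domain is taken to be some Fin m.
Constraint : ℕ → ℕ → Set
Constraint m k = Vec (Fin m) k → ℂ

Family : ∀ (m : ℕ) {s} → (Fin s → ℕ) → Set
Family m arity = ∀ i → Constraint m (arity i)

ConjugateClosed : ∀ {m s} {arity : Fin s → ℕ} → Family m arity → Set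
ConjugateClosed {arity = arity} F =
  ∀ i → ∃[ j ] Σ[ eq ∈ arity i ≡ arity j ] ∀ x → F j (Vec.cast eq x) ≈ᶜ conj (F i x)

module _ {c ℓ} (M : CommutativeMonoid c ℓ) where
  open CommutativeMonoid M using (Carrier)

  tupleSum : ∀ {m} k → (Vec (Fin m) k → Carrier) → Carrier
  tupleSum zero    f = f []
  tupleSum (suc k) f = Sum.sum M λ i → tupleSum k (f ∘ (i ∷_))

-- The disjoint union of Fin m and Fin n is Fin (m + n), via splitAt. Arity 0 never
-- occurs in the theorem, which assumes arities ≥ 1.
⊕-arity : ℕ → ℕ
⊕-arity 1 = 2
⊕-arity k = k

blockSum : ∀ {m n k} → Constraint m k → Constraint n k → Constraint (m ℕ.+ n) k
blockSum {m} F G x = maybe′ F (maybe′ G 0ᶜ (mapA (isInj₂ ∘ splitAt m) x)) (mapA (isInj₁ ∘ splitAt m) x)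
  where open TraversableA applicative

diagonal : ∀ {m} → Constraint m 1 → Constraint m 2
diagonal F (x ∷ y ∷ []) = if does (x ≟ y) then F (x ∷ []) else 0ᶜ

infixl 6 _⊕_ _⊕ᶠ_

_⊕_ : ∀ {m n k} → Constraint m k → Constraint n k → Constraint (m ℕ.+ n) (⊕-arity k)
_⊕_ {k = 0}           F G = blockSum F G
_⊕_ {k = 1}           F G = blockSum (diagonal F) (diagonal G)
_⊕_ {k = suc (suc k)} F G = blockSum F G

_⊕ᶠ_ : ∀ {m n s} {arity : Fin s → ℕ} → Family m arity → Family n arity → Family (m ℕ.+ n) (⊕-arity ∘ arity)
(F ⊕ᶠ G) i = F i ⊕ G i

Disconnected : ∀ {m} → (Fin m → Fin m → ℂ) → Set
Disconnected {m} X = ∃₂ λ (I J : Subset m) →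
  Nonempty I × Nonempty J × I ∪ J ≡ full × I ∩ J ≡ empty ×
  (∀ u v → ¬ ((u ∈ I × v ∈ I) ⊎ (u ∈ J × v ∈ J)) → X u v ≈ᶜ 0ᶜ)

Connected : ∀ {m} → (Fin m → Fin m → ℂ) → Set
Connected X = ¬ Disconnected X

ProjectivelyConnected : ∀ {m k} → Constraint m k → Set
ProjectivelyConnected {k = 0}           F = ⊥
ProjectivelyConnected {k = 1}           F = ⊥
ProjectivelyConnected {k = suc (suc k)} F =
  Connected λ u v → tupleSum (CommutativeRing.+-commutativeMonoid ℂ-commutativeRing) k λ x → F (x ∷ʳ u ∷ʳ v)

module _ {c ℓ} (A : C*Algebra c ℓ) where
  open C*Algebra A

  record IsQuantumPermutation {n m} (u : Fin n → Fin m → Carrier) : Set (c ⊔ ℓ) where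
    field
      square      : n ≡ m
      nontrivial  : ¬ (1# ≈ 0#)
      idempotent  : ∀ x y → u x y * u x y ≈ u x y
      selfAdjoint : ∀ x y → u x y ⋆ ≈ u x y
      rowSum      : ∀ x → Sum.sum +-commutativeMonoid (λ y → u x y) ≈ 1#
      columnSum   : ∀ y → Sum.sum +-commutativeMonoid (λ x → u x y) ≈ 1#

  tensorPower : ∀ {n m k} → (Fin n → Fin m → Carrier) → Vec (Fin n) k → Vec (Fin m) k → Carrier
  tensorPower u []       []       = 1#
  tensorPower u (x ∷ xs) (y ∷ ys) = u x y * tensorPower u xs ys

  -- u^{⊗k} f = g, with scalars α read as α · 1#
  Transports : ∀ {n m k} → (Fin n → Fin m → Carrier) → Constraint m k → Constraint n k → Set ℓ
  Transports {k = k} u f g = ∀ x →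
    tupleSum +-commutativeMonoid k (λ y → tensorPower u x y * (f y · 1#)) ≈ g x · 1#

  record QutRelations {m s} {arity : Fin s → ℕ} (H : Family m arity)
                      (u : Fin m → Fin m → Carrier) : Set (c ⊔ ℓ) where
    field
      isQuantumPermutation : IsQuantumPermutation u
      fixes                : ∀ i → Transports u (H i) (H i)

QuantumIsomorphic : ∀ (c ℓ : Level) {m n s} {arity : Fin s → ℕ} →
                    Family m arity → Family n arity → Set (lsuc (c ⊔ ℓ))
QuantumIsomorphic c ℓ {m} {n} F G =
  m ≡ n × ∃₂ λ (A : C*Algebra c ℓ) (u : Fin n → Fin m → C*Algebra.Carrier A) →
    IsQuantumPermutation A u × (∀ i → Transports A u (F i) (G i))

-- The universal C*-algebra of the relations, given by its universal property;
-- uniqueness of the induced map says that the entries generate.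
record Qut (c ℓ : Level) {m s} {arity : Fin s → ℕ} (H : Family m arity) : Set (lsuc (c ⊔ ℓ)) where
  field
    algebra   : C*Algebra c ℓ
  open C*Algebra algebra using (Carrier; _≈_; 0#)
  field
    u         : Fin m → Fin m → Carrier
    relations : QutRelations algebra H u
    universal : ∀ (B : C*Algebra c ℓ) (v : Fin m → Fin m → C*Algebra.Carrier B) →
                QutRelations B H v →
                Σ[ φ ∈ StarHom algebra B ] ∀ x y → C*Algebra._≈_ B (StarHom.⟦_⟧ φ (u x y)) (v x y)
    unique    : ∀ (B : C*Algebra c ℓ) (φ ψ : StarHom algebra B) →
                (∀ x y → C*Algebra._≈_ B (StarHom.⟦_⟧ φ (u x y)) (StarHom.⟦_⟧ ψ (u x y))) →
                ∀ a → C*Algebra._≈_ B (StarHom.⟦_⟧ φ a) (StarHom.⟦_⟧ ψ a)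

  SameOrbit : Fin m → Fin m → Set ℓ
  SameOrbit x y = ¬ (u x y ≈ 0#)

{-# OPTIONS --safe #-}
module Submission where

-- Let u be the fundamental matrix of Qut(F ⊕ G). Its entries in a row or column are
-- mutually orthogonal: if projections sum to 1, the compressions of the others by one
-- of them sum to 0, and 1 is an extreme point of the unit ball. Summing out all but two
-- arguments of a constraint H fixed by u leaves X (u a b * u c d) = Y (u a b * u c d),
-- X = X_{bd} and Y = X_{ac} being entries of the marginal of H. For F ⊕ G this matrix
-- is block diagonal, so connectedness of its blocks forces the row sums and column sums
-- of the two off-diagonal blocks of u to be one and the same projection p. It commutes
-- with all u a b, hence is central, and p ≠ 0 because u x̂ ŷ ≠ 0. The lower left block
-- of u, read in the algebra p A, is the quantum isomorphism.

open import Defs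
open import Level using (0ℓ)
open import Algebra.Bundles using (CommutativeMonoid; CommutativeRing)
open import Algebra.Module.Structures using (IsLeftModule)
import Algebra.Properties.CommutativeMonoid.Sum as Sum
import Algebra.Properties.Ring as RingProperties
import Algebra.Solver.CommutativeMonoid as CMSolver
open import Data.Empty using (⊥-elim)
open import Data.Fin.Base using (Fin; zero; suc; _↑ˡ_; _↑ʳ_; splitAt; punchIn; punchOut)
open import Data.Fin.Properties using (_≟_; ↑ˡ-injective; ↑ʳ-injective; join-splitAt; punchIn-punchOut; sequence; splitAt-↑ˡ; splitAt-↑ʳ)
open import Data.Fin.Subset using (Subset; _∈_; ∁)
open import Data.Fin.Subset.Properties using (_∈?_; p∪∁p≡⊤; x∉p⇒x∈∁p; ∩-inverseʳ)
open import Data.Integer.Base as ℤ using (+_; +[1+_])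
import Data.Integer.Properties as ℤ
open import Data.Maybe.Base using (Maybe; just; nothing; maybe′)
open import Data.Maybe.Effectful using (applicative)
open import Data.Nat.Base as ℕ using (ℕ; zero; suc; _≥_)
import Data.Nat.Properties as ℕ
open import Data.Product.Base using (∃; ∃₂; ∃-syntax; _×_; _,_; proj₁; proj₂)
open import Data.Rational.Base as ℚ using (ℚ; 0ℚ; 1ℚ; ½)
import Data.Rational.Properties as ℚ
import Data.Rational.Solver as ℚSolver
open import Data.Rational.Unnormalised.Base as ℚᵘ using (mkℚᵘ; *≡*; *≤*)
import Data.Rational.Unnormalised.Properties as ℚᵘ
open import Data.Sum using (_⊎_; inj₁; inj₂; isInj₁; isInj₂)
open import Data.Vec.Base as Vec using (Vec; []; _∷_; _∷ʳ_)
open import Data.Vec.Effectful using (module TraversableA)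
open import Data.Vec.Functional using (removeAt)
open import Data.Vec.Properties using ([]=⇒lookup; lookup⇒[]=; lookup∘tabulate; map-id; map-∷ʳ)
open import Data.Vec.Relation.Unary.Any as Any using (Any; here; there)
open import Effect.Monad using (RawMonad)
open import Function.Base using (_∘_)
open import Relation.Binary.PropositionalEquality as ≡ using (_≡_; _≢_)
import Relation.Binary.Reasoning.Setoid as SetoidReasoning
open import Relation.Nullary using (¬_; Dec; yes; no; does)
open import Relation.Nullary.Decidable using (dec-true; dec-false; ¬¬-excluded-middle)
open import Relation.Nullary.Negation using (¬¬-Monad)

-- Orthogonality usually rests on positivity: positive elements sum to 0 only if each of them is 0.
-- Here positivity is replaced by norm inequalities. For a projection q the symmetry 1 - 2q is a
-- contraction, so the compression h of q by e satisfies ‖e - 2h‖ ≤ 1. If finitely many such h sum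
-- to 0, then a positive multiple x of any one of them satisfies both ‖e + x‖ ≤ 1 and ‖e - x‖ ≤ 1.
-- Extremality of e is proved quantitatively: one algebraic identity shows that (3/2) x satisfies
-- the same two inequalities, so ‖x‖ ≤ (2/3)^k for every k. No spectrum and no square root of an
-- element enters. Equality of reals is undecidable and connectedness is a negation, so the level
-- sets that would disconnect a graph are formed only under a double negation. The two domains may
-- differ in size until the end, so row sums and column sums of a block are compared by multiplying
-- them, not by counting. The equality of sizes m = n then comes from m p = n p with p ≠ 0.

module ℂ′ = CommutativeRing ℂ-commutativeRing

-- Rational inequalities and Cauchy sequences

0<1 : 0ℚ ℚ.< 1ℚ
0<1 = ℚ.positive⁻¹ 1ℚ

+-nonNeg-pos : ∀ {p q} → 0ℚ ℚ.≤ p → 0ℚ ℚ.< q → 0ℚ ℚ.< p ℚ.+ q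
+-nonNeg-pos = ℚ.+-mono-≤-< {0ℚ} {_} {0ℚ}

+-nonNeg : ∀ {p q} → 0ℚ ℚ.≤ p → 0ℚ ℚ.≤ q → 0ℚ ℚ.≤ p ℚ.+ q
+-nonNeg = ℚ.+-mono-≤ {0ℚ} {_} {0ℚ}

*-pos : ∀ {p q} → 0ℚ ℚ.< p → 0ℚ ℚ.< q → 0ℚ ℚ.< p ℚ.* q
*-pos {p} {q} 0<p 0<q = ≡.subst (ℚ._< p ℚ.* q) (ℚ.*-zeroʳ p) (ℚ.*-monoʳ-<-pos p {{ℚ.positive 0<p}} 0<q)

*-nonNeg : ∀ {p q} → 0ℚ ℚ.≤ p → 0ℚ ℚ.≤ q → 0ℚ ℚ.≤ p ℚ.* q
*-nonNeg {p} {q} 0≤p 0≤q = ≡.subst (ℚ._≤ p ℚ.* q) (ℚ.*-zeroʳ p) (ℚ.*-monoˡ-≤-nonNeg p {{ℚ.nonNegative 0≤p}} 0≤q)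

*-mono-≤ : ∀ {p q r s} → 0ℚ ℚ.≤ q → 0ℚ ℚ.≤ r → p ℚ.≤ q → r ℚ.≤ s → p ℚ.* r ℚ.≤ q ℚ.* s
*-mono-≤ {q = q} {r} 0≤q 0≤r p≤q r≤s = ℚ.≤-trans
  (ℚ.*-monoʳ-≤-nonNeg r {{ℚ.nonNegative 0≤r}} p≤q) (ℚ.*-monoˡ-≤-nonNeg q {{ℚ.nonNegative 0≤q}} r≤s)

*-cancel-< : ∀ {p q r} → 0ℚ ℚ.≤ r → p ℚ.* r ℚ.< q ℚ.* r → p ℚ.< q
*-cancel-< {r = r} 0≤r = ℚ.*-cancelʳ-<-nonNeg r {{ℚ.nonNegative 0≤r}}

-- Inequalities are proved by exhibiting the gap `r`; what remains is an equation, usually left to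
-- the ring solver.
<-by : ∀ {p q} r → 0ℚ ℚ.< r → p ℚ.+ r ≡ q → p ℚ.< q
<-by {p} r 0<r eq = ≡.subst₂ ℚ._<_ (ℚ.+-identityʳ p) eq (ℚ.+-monoʳ-< p 0<r)

≤-by : ∀ {p q} r → 0ℚ ℚ.≤ r → p ℚ.+ r ≡ q → p ℚ.≤ q
≤-by {p} r 0≤r eq = ≡.subst₂ ℚ._≤_ (ℚ.+-identityʳ p) eq (ℚ.+-monoʳ-≤ p 0≤r)

p≤∣p∣ : ∀ p → p ℚ.≤ ℚ.∣ p ∣
p≤∣p∣ p with ℚ.≤-total 0ℚ p
... | inj₁ 0≤p = ℚ.≤-reflexive (≡.sym (ℚ.0≤p⇒∣p∣≡p 0≤p))
... | inj₂ p≤0 = ℚ.≤-trans p≤0 (ℚ.0≤∣p∣ p)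

∣p∣≤∣p-q∣+∣q∣ : ∀ p q → ℚ.∣ p ∣ ℚ.≤ ℚ.∣ p ℚ.- q ∣ ℚ.+ ℚ.∣ q ∣
∣p∣≤∣p-q∣+∣q∣ p q = ≡.subst₂ (λ a b → ℚ.∣ a ∣ ℚ.≤ ℚ.∣ p ℚ.- q ∣ ℚ.+ ℚ.∣ b ∣)
  (ℚ.+-identityʳ p) (ℚ.+-identityʳ q) (∣-∣-triangle p q 0ℚ)

below-square : ∀ {p q} → 0ℚ ℚ.≤ q → ℚ.∣ p ℚ.* p ∣ ℚ.< q ℚ.* q → ℚ.∣ p ∣ ℚ.< q
below-square {p} {q} 0≤q p²<q² with ℚ.∣ p ∣ ℚ.<? q
... | yes p<q = p<q
... | no  p≮q = ⊥-elim (ℚ.<-irrefl ≡.refl (ℚ.<-≤-trans p²<q²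
  (≡.subst (q ℚ.* q ℚ.≤_) (≡.sym (ℚ.∣p*q∣≡∣p∣*∣q∣ p p)) (*-mono-≤ (ℚ.0≤∣p∣ p) 0≤q q≤p q≤p))))
  where q≤p = ℚ.≮⇒≥ p≮q

-- The inverse of `1½`, the factor gained in one amplification step for flat elements.
⅔ : ℚ
⅔ = + 2 ℚ./ 3

natℚ : ℕ → ℚ
natℚ zero    = 0ℚ
natℚ (suc k) = 1ℚ ℚ.+ natℚ k

natℚ-nonNeg : ∀ k → 0ℚ ℚ.≤ natℚ k
natℚ-nonNeg zero    = ℚ.≤-refl
natℚ-nonNeg (suc k) = +-nonNeg (ℚ.<⇒≤ 0<1) (natℚ-nonNeg k)

natℚ-pos : ∀ k → 0ℚ ℚ.< natℚ (suc k)
natℚ-pos k = ≡.subst (0ℚ ℚ.<_) (ℚ.+-comm (natℚ k) 1ℚ) (+-nonNeg-pos (natℚ-nonNeg k) 0<1)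

toℚᵘ-natℚ : ∀ k → ℚ.toℚᵘ (natℚ k) ℚᵘ.≃ mkℚᵘ (+ k) 0
toℚᵘ-natℚ zero    = ℚᵘ.≃-refl
toℚᵘ-natℚ (suc k) = ℚᵘ.≃-trans (ℚ.toℚᵘ-homo-+ 1ℚ (natℚ k))
  (ℚᵘ.≃-trans (ℚᵘ.+-congʳ ℚᵘ.1ℚᵘ (toℚᵘ-natℚ k))
    (*≡* (≡.cong (λ i → (+ 1 ℤ.+ i) ℤ.* + 1) (ℤ.*-identityʳ (+ k)))))

archimedean : ∀ ε → 0ℚ ℚ.< ε → ∃[ k ] 1ℚ ℚ.≤ natℚ k ℚ.* ε
-- The denominator is a sufficient multiple, because the numerator of a positive rational is at
-- least 1.
archimedean (ℚ.mkℚ +[1+ n ] d c) 0<ε = suc d , ℚ.toℚᵘ-cancel-≤ (ℚᵘ.≤-respʳ-≃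
  (ℚᵘ.≃-sym (ℚᵘ.≃-trans (ℚ.toℚᵘ-homo-* (natℚ (suc d)) (ℚ.mkℚ +[1+ n ] d c))
    (ℚᵘ.*-congʳ (toℚᵘ-natℚ (suc d)))))
  (*≤* (≡.subst₂ ℤ._≤_
    (≡.trans (≡.cong +_ (≡.sym (ℕ.*-identityˡ (suc d)))) (≡.sym (ℤ.*-identityˡ _))) (≡.sym (ℤ.*-identityʳ _))
    (ℤ.+≤+ (ℕ.m≤m*n (suc d) (suc n))))))
archimedean (ℚ.mkℚ (+ 0) d c) 0<ε with ℚ.positive 0<ε
... | ()
archimedean (ℚ.mkℚ ℤ.-[1+ n ] d c) 0<ε with ℚ.positive 0<ε
... | ()

infixr 8 _^_

_^_ : ℚ → ℕ → ℚ
q ^ zero  = 1ℚ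
q ^ suc k = q ℚ.* q ^ k

⅔^-nonNeg : ∀ k → 0ℚ ℚ.≤ ⅔ ^ k
⅔^-nonNeg zero    = ℚ.<⇒≤ 0<1
⅔^-nonNeg (suc k) = *-nonNeg (ℚ.nonNegative⁻¹ ⅔) (⅔^-nonNeg k)

⅔^-small : ∀ ε → 0ℚ ℚ.< ε → ∃[ k ] ⅔ ^ k ℚ.≤ ε
⅔^-small ε 0<ε = go (archimedean (½ ℚ.* ε) (½-pos 0<ε))
  where
  open ℚSolver.+-*-Solver
  -- A Bernoulli-type bound: ⅔ (k + 3) ≤ k + 2 with gap k/3, so the product never exceeds its value
  -- 2 at k = 0.
  growth : ∀ k → ⅔ ^ k ℚ.* natℚ (suc (suc k)) ℚ.≤ natℚ 2
  growth zero    = ℚ.≤-refl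
  growth (suc k) = ℚ.≤-trans
    (≤-by (+ 1 ℚ./ 3 ℚ.* (⅔ ^ k ℚ.* natℚ k)) (*-nonNeg (ℚ.nonNegative⁻¹ (+ 1 ℚ./ 3)) (*-nonNeg (⅔^-nonNeg k) (natℚ-nonNeg k)))
      (solve 2 (λ r ν →
        (con ⅔ :* r) :* (con 1ℚ :+ (con 1ℚ :+ (con 1ℚ :+ ν))) :+ con (+ 1 ℚ./ 3) :* (r :* ν) :=
        r :* (con 1ℚ :+ (con 1ℚ :+ ν))) ≡.refl (⅔ ^ k) (natℚ k)))
    (growth k)
  go : (∃[ k ] 1ℚ ℚ.≤ natℚ k ℚ.* (½ ℚ.* ε)) → ∃[ k ] ⅔ ^ k ℚ.≤ ε
  go (k , 1≤) = k , ℚ.*-cancelʳ-≤-pos (natℚ (suc (suc k))) {{ℚ.positive (natℚ-pos (suc k))}} (begin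
    ⅔ ^ k ℚ.* natℚ (suc (suc k))                            ≤⟨ growth k ⟩
    1ℚ ℚ.+ 1ℚ                                               ≤⟨ ℚ.+-mono-≤ 1≤ 1≤ ⟩
    natℚ k ℚ.* (½ ℚ.* ε) ℚ.+ natℚ k ℚ.* (½ ℚ.* ε)           ≤⟨ ≤-by (ε ℚ.+ ε) (+-nonNeg (ℚ.<⇒≤ 0<ε) (ℚ.<⇒≤ 0<ε))
                                                                 (solve 2 (λ ν ε → ν :* (con ½ :* ε) :+ ν :* (con ½ :* ε) :+ (ε :+ ε) := ε :* (con 1ℚ :+ (con 1ℚ :+ ν))) ≡.refl (natℚ k) ε) ⟩
    ε ℚ.* natℚ (suc (suc k))                                ∎)
    where open ℚ.≤-Reasoning

-- Rational bounds on the absolute value of a real number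

Eventually : (ℕ → Set) → Set
Eventually P = ∃[ N ] ∀ n → N ℕ.≤ n → P n

both : ∀ {P Q : ℕ → Set} → Eventually P → Eventually Q → Eventually λ n → P n × Q n
both (N₁ , p) (N₂ , q) = N₁ ℕ.⊔ N₂ , λ n N≤n →
  let n₁ , n₂ = max₂ {N₁} {N₂} N≤n in p n n₁ , q n n₂

mapE : ∀ {P Q : ℕ → Set} → (∀ n → P n → Q n) → Eventually P → Eventually Q
mapE f (N , p) = N , λ n N≤n → f n (p n N≤n)

-- Expresses |x| ≤ B. The slack `ε` makes the condition invariant under `_≈ʳ_`; the absolute value,
-- unlike the one-sided `_≤ʳ_`, lets bounds be multiplied.
record Bound (x : ℝ) (B : ℚ) : Set where
  constructor mkBound
  field
    within : ∀ ε → 0ℚ ℚ.< ε → Eventually λ n → ℚ.∣ seq x n ∣ ℚ.< B ℚ.+ ε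

open Bound public

Bound-≈ : ∀ {x y B} → x ≈ʳ y → Bound x B → Bound y B
Bound-≈ {x} {y} {B} x≈y x≤B .within ε 0<ε = mapE step
  (both (within x≤B (½ ℚ.* ε) (½-pos 0<ε)) (approx x≈y (½ ℚ.* ε) (½-pos 0<ε)))
  where
  open ℚSolver.+-*-Solver
  step : ∀ n → ℚ.∣ seq x n ∣ ℚ.< B ℚ.+ ½ ℚ.* ε × ℚ.∣ seq x n ℚ.- seq y n ∣ ℚ.< ½ ℚ.* ε →
         ℚ.∣ seq y n ∣ ℚ.< B ℚ.+ ε
  step n (x< , d<) = ℚ.≤-<-trans (∣p∣≤∣p-q∣+∣q∣ (seq y n) (seq x n))
    (≡.subst (_ ℚ.<_) (solve 2 (λ B ε → con ½ :* ε :+ (B :+ con ½ :* ε) := B :+ ε) ≡.refl B ε)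
      (ℚ.+-mono-< (≡.subst (ℚ._< _) (∣-∣-sym (seq x n) (seq y n)) d<) x<))

Bound-≤ : ∀ {x y B} → 0ʳ ≤ʳ x → x ≤ʳ y → Bound y B → Bound x B
Bound-≤ {x} {y} {B} 0≤x x≤y y≤B .within ε 0<ε = mapE step
  (both (both (below 0≤x η 0<η) (below x≤y η 0<η)) (within y≤B η 0<η))
  where
  open ℚSolver.+-*-Solver
  η = ½ ℚ.* ε
  0<η = ½-pos 0<ε
  ε≡ : B ℚ.+ η ℚ.+ η ≡ B ℚ.+ ε
  ε≡ = solve 2 (λ B ε → B :+ con ½ :* ε :+ con ½ :* ε := B :+ ε) ≡.refl B ε
  step : ∀ n → (0ℚ ℚ.< seq x n ℚ.+ η × seq x n ℚ.< seq y n ℚ.+ η) × ℚ.∣ seq y n ∣ ℚ.< B ℚ.+ η →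
         ℚ.∣ seq x n ∣ ℚ.< B ℚ.+ ε
  step n ((0<x+η , x<y+η) , y<) with ℚ.∣p∣≡p∨∣p∣≡-p (seq x n)
  ... | inj₁ eq = ≡.subst₂ ℚ._<_ (≡.sym eq) ε≡
        (ℚ.<-trans x<y+η (ℚ.+-monoˡ-< η (ℚ.≤-<-trans (p≤∣p∣ (seq y n)) y<)))
  ... | inj₂ eq = ≡.subst₂ ℚ._<_ (≡.sym eq) ε≡ (ℚ.<-trans
        (<-by _ 0<x+η (solve 2 (λ x η → :- x :+ (x :+ η) := η) ≡.refl (seq x n) η))
        (<-by _ (ℚ.≤-<-trans (ℚ.0≤∣p∣ (seq y n)) y<) (ℚ.+-comm η (B ℚ.+ η))))

Bound-mono : ∀ {x B C} → B ℚ.≤ C → Bound x B → Bound x C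
Bound-mono B≤C x≤B .within ε 0<ε = mapE (λ _ x< → ℚ.<-≤-trans x< (ℚ.+-monoˡ-≤ ε B≤C)) (within x≤B ε 0<ε)

Bound-fromℚ : ∀ {q} → 0ℚ ℚ.≤ q → Bound (fromℚ q) q
Bound-fromℚ {q} 0≤q .within ε 0<ε = 0 , λ _ _ → <-by ε 0<ε (≡.cong (ℚ._+ ε) (ℚ.0≤p⇒∣p∣≡p 0≤q))

Bound-+ : ∀ {x y B C} → Bound x B → Bound y C → Bound (x +ʳ y) (B ℚ.+ C)
Bound-+ {x} {y} {B} {C} x≤B y≤C .within ε 0<ε = mapE step
  (both (within x≤B (½ ℚ.* ε) (½-pos 0<ε)) (within y≤C (½ ℚ.* ε) (½-pos 0<ε)))
  where
  open ℚSolver.+-*-Solver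
  step : ∀ n → ℚ.∣ seq x n ∣ ℚ.< B ℚ.+ ½ ℚ.* ε × ℚ.∣ seq y n ∣ ℚ.< C ℚ.+ ½ ℚ.* ε →
         ℚ.∣ seq x n ℚ.+ seq y n ∣ ℚ.< B ℚ.+ C ℚ.+ ε
  step n (x< , y<) = ℚ.≤-<-trans (ℚ.∣p+q∣≤∣p∣+∣q∣ (seq x n) (seq y n))
    (≡.subst (_ ℚ.<_) (solve 3 (λ B C ε → (B :+ con ½ :* ε) :+ (C :+ con ½ :* ε) := B :+ C :+ ε) ≡.refl B C ε)
      (ℚ.+-mono-< x< y<))

Bound-* : ∀ {x y B C} → 0ℚ ℚ.≤ B → 0ℚ ℚ.≤ C → Bound x B → Bound y C → Bound (x *ʳ y) (B ℚ.* C)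
Bound-* {x} {y} {B} {C} 0≤B 0≤C x≤B y≤C .within ε 0<ε = mapE step (both (within x≤B δ 0<δ) (within y≤C δ 0<δ))
  where
  open ℚSolver.+-*-Solver
  S = B ℚ.+ C ℚ.+ 1ℚ
  0<S : 0ℚ ℚ.< S
  0<S = +-nonNeg-pos (+-nonNeg 0≤B 0≤C) 0<1
  ε/S = divide 0<S 0<ε
  δ′ = proj₁ ε/S
  -- Capping at 1 tames the quadratic error: (B + C + δ) δ ≤ (B + C + 1) δ′ = ε.
  δ = δ′ ℚ.⊓ 1ℚ
  0<δ : 0ℚ ℚ.< δ
  0<δ with ℚ.⊓-sel δ′ 1ℚ
  ... | inj₁ eq = ≡.subst (0ℚ ℚ.<_) (≡.sym eq) (proj₁ (proj₂ ε/S))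
  ... | inj₂ eq = ≡.subst (0ℚ ℚ.<_) (≡.sym eq) 0<1
  δ-small : (B ℚ.+ δ) ℚ.* (C ℚ.+ δ) ℚ.≤ B ℚ.* C ℚ.+ ε
  δ-small = begin
    (B ℚ.+ δ) ℚ.* (C ℚ.+ δ)             ≡⟨ solve 3 (λ B C δ → (B :+ δ) :* (C :+ δ) := B :* C :+ (B :+ C :+ δ) :* δ) ≡.refl B C δ ⟩
    B ℚ.* C ℚ.+ (B ℚ.+ C ℚ.+ δ) ℚ.* δ   ≤⟨ ℚ.+-monoʳ-≤ (B ℚ.* C) (*-mono-≤ (ℚ.<⇒≤ 0<S) (ℚ.<⇒≤ 0<δ)
                                             (ℚ.+-monoʳ-≤ (B ℚ.+ C) (ℚ.p⊓q≤q δ′ 1ℚ)) (ℚ.p⊓q≤p δ′ 1ℚ)) ⟩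
    B ℚ.* C ℚ.+ S ℚ.* δ′                ≡⟨ ≡.cong (B ℚ.* C ℚ.+_) (proj₂ (proj₂ ε/S)) ⟩
    B ℚ.* C ℚ.+ ε                       ∎
    where open ℚ.≤-Reasoning
  step : ∀ n → ℚ.∣ seq x n ∣ ℚ.< B ℚ.+ δ × ℚ.∣ seq y n ∣ ℚ.< C ℚ.+ δ →
         ℚ.∣ seq x n ℚ.* seq y n ∣ ℚ.< B ℚ.* C ℚ.+ ε
  step n (x< , y<) = ℚ.<-≤-trans
    (≡.subst (ℚ._< (B ℚ.+ δ) ℚ.* (C ℚ.+ δ)) (≡.sym (ℚ.∣p*q∣≡∣p∣*∣q∣ (seq x n) (seq y n)))
      (∣*∣-< {seq x n} {seq y n} (+-nonNeg-pos 0≤B 0<δ) x< y<)) δ-small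

Bound-√ : ∀ {x B} → 0ℚ ℚ.≤ B → Bound (x *ʳ x) (B ℚ.* B) → Bound x B
-- The tolerance ε² suffices, as B² + ε² ≤ (B + ε)².
Bound-√ {x} {B} 0≤B x²≤B² .within ε 0<ε = mapE step (within x²≤B² (ε ℚ.* ε) (*-pos 0<ε 0<ε))
  where
  open ℚSolver.+-*-Solver
  0≤ε = ℚ.<⇒≤ 0<ε
  step : ∀ n → ℚ.∣ seq x n ℚ.* seq x n ∣ ℚ.< B ℚ.* B ℚ.+ ε ℚ.* ε → ℚ.∣ seq x n ∣ ℚ.< B ℚ.+ ε
  step n x²< = below-square {seq x n} (+-nonNeg 0≤B 0≤ε) (ℚ.<-≤-trans x²<
    (≤-by (B ℚ.* ε ℚ.+ B ℚ.* ε) (+-nonNeg (*-nonNeg 0≤B 0≤ε) (*-nonNeg 0≤B 0≤ε))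
      (solve 2 (λ B ε → B :* B :+ ε :* ε :+ (B :* ε :+ B :* ε) := (B :+ ε) :* (B :+ ε)) ≡.refl B ε)))

-- If a = |xₙ| ≥ 1 + ε, then a² ≥ (1 + ε) a ≥ a + ε, which contradicts |xₙ² - xₙ| < ε. It is applied
-- to the norm of a projection.
Bound-idem : ∀ {x} → x *ʳ x ≈ʳ x → Bound x 1ℚ
Bound-idem {x} x²≈x .within ε 0<ε = mapE step (approx x²≈x ε 0<ε)
  where
  open ℚSolver.+-*-Solver
  step : ∀ n → ℚ.∣ seq x n ℚ.* seq x n ℚ.- seq x n ∣ ℚ.< ε → ℚ.∣ seq x n ∣ ℚ.< 1ℚ ℚ.+ ε
  step n d< with ℚ.∣ seq x n ∣ ℚ.<? 1ℚ ℚ.+ ε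
  ... | yes x< = x<
  ... | no  x≮ = ⊥-elim (ℚ.<-irrefl ≡.refl (ℚ.<-≤-trans x²<
          (ℚ.≤-trans (≤-by (ε ℚ.* (a ℚ.- 1ℚ)) (*-nonNeg (ℚ.<⇒≤ 0<ε) (ℚ.≤-trans (ℚ.<⇒≤ 0<ε) ε≤a-1))
            (solve 2 (λ a ε → (ε :+ a) :+ ε :* (a :- con 1ℚ) := (con 1ℚ :+ ε) :* a) ≡.refl a ε))
            (*-mono-≤ (ℚ.0≤∣p∣ (seq x n)) (ℚ.0≤∣p∣ (seq x n)) ≤a (ℚ.≤-refl {a})))))
    where
    a = ℚ.∣ seq x n ∣
    ≤a : 1ℚ ℚ.+ ε ℚ.≤ a
    ≤a = ℚ.≮⇒≥ x≮
    ε≤a-1 : ε ℚ.≤ a ℚ.- 1ℚ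
    ε≤a-1 = ≡.subst (ℚ._≤ a ℚ.- 1ℚ) (solve 1 (λ ε → con 1ℚ :+ ε :- con 1ℚ := ε) ≡.refl ε)
      (ℚ.+-monoˡ-≤ (ℚ.- 1ℚ) ≤a)
    x²< : a ℚ.* a ℚ.< ε ℚ.+ a
    x²< = ℚ.≤-<-trans (≡.subst (ℚ._≤ ℚ.∣ seq x n ℚ.* seq x n ℚ.- seq x n ∣ ℚ.+ a) (ℚ.∣p*q∣≡∣p∣*∣q∣ (seq x n) (seq x n))
      (∣p∣≤∣p-q∣+∣q∣ (seq x n ℚ.* seq x n) (seq x n))) (ℚ.+-monoˡ-< a d<)

Bound⇒≤ʳ : ∀ {x B} → Bound x B → x ≤ʳ fromℚ B
Bound⇒≤ʳ {x} x≤B = mk≤ λ ε 0<ε → mapE (λ n → ℚ.≤-<-trans (p≤∣p∣ (seq x n))) (within x≤B ε 0<ε)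

Bound⇒≈0 : ∀ {x} → (∀ ε → 0ℚ ℚ.< ε → Bound x ε) → x ≈ʳ 0ʳ
Bound⇒≈0 {x} x≤ = mk≈ λ ε 0<ε → mapE
  (λ n → ≡.subst₂ ℚ._<_ (≡.cong ℚ.∣_∣ (≡.sym (ℚ.+-identityʳ (seq x n)))) (½+½ ε))
  (within (x≤ (½ ℚ.* ε) (½-pos 0<ε)) (½ ℚ.* ε) (½-pos 0<ε))

≈0⇒Bound : ∀ {x} → x ≈ʳ 0ʳ → Bound x 0ℚ
≈0⇒Bound {x} x≈0 .within ε 0<ε = mapE
  (λ n → ≡.subst₂ ℚ._<_ (≡.cong ℚ.∣_∣ (ℚ.+-identityʳ (seq x n))) (≡.sym (ℚ.+-identityˡ ε)))
  (approx x≈0 ε 0<ε)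

square≈0 : ∀ {x} → x *ʳ x ≈ʳ 0ʳ → x ≈ʳ 0ʳ
square≈0 x²≈0 = Bound⇒≈0 λ ε 0<ε →
  Bound-mono (ℚ.<⇒≤ 0<ε) (Bound-√ ℚ.≤-refl (≈0⇒Bound x²≈0))

-- Apartness from 0 and stability of equality

Apart : ℝ → Set
Apart x = ∃[ δ ] 0ℚ ℚ.< δ × Eventually λ n → δ ℚ.< ℚ.∣ seq x n ∣

-- A single rational decides the alternative: beyond `N` the sequence varies by less than ε/4, so
-- testing `seq x N` against ε/2 leaves room on both sides.
small-or-apart : ∀ x ε → 0ℚ ℚ.< ε →
  (Eventually λ n → ℚ.∣ seq x n ∣ ℚ.< ε) ⊎ Apart x
small-or-apart x ε 0<ε = go (cauchy x η 0<η)
  where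
  η = ½ ℚ.* (½ ℚ.* ε)
  0<η = ½-pos (½-pos 0<ε)
  go : (∃[ N ] ∀ m n → N ℕ.≤ m → N ℕ.≤ n → ℚ.∣ seq x m ℚ.- seq x n ∣ ℚ.< η) → _
  go (N , c) with ℚ.∣ seq x N ∣ ℚ.<? ½ ℚ.* ε
  ... | yes small = inj₁ (N , λ n N≤n → ℚ.≤-<-trans (∣p∣≤∣p-q∣+∣q∣ (seq x n) (seq x N))
          (≡.subst (_ ℚ.<_) (½+½ ε) (ℚ.+-mono-< (ℚ.<-trans (c n N N≤n ℕ.≤-refl)
            (<-by η 0<η (½+½ (½ ℚ.* ε)))) small)))
  ... | no large = inj₂ (η , 0<η , N , λ n N≤n → ℚ.≰⇒> λ xₙ≤η → ℚ.<-irrefl ≡.refl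
          (ℚ.<-≤-trans (ℚ.≤-<-trans (∣p∣≤∣p-q∣+∣q∣ (seq x N) (seq x n))
            (≡.subst (_ ℚ.<_) (½+½ (½ ℚ.* ε)) (ℚ.+-mono-<-≤ (c N n ℕ.≤-refl N≤n) xₙ≤η)))
            (ℚ.≮⇒≥ large)))

-- Tightness of apartness: since `small-or-apart` is decided for each `ε`, refuting apartness leaves
-- smallness every time, without excluded middle.
¬apart⇒≈0 : ∀ {x} → ¬ Apart x → x ≈ʳ 0ʳ
¬apart⇒≈0 {x} ¬apart = mk≈ λ ε 0<ε → small ε (small-or-apart x ε 0<ε)
  where
  small : ∀ ε → (Eventually λ n → ℚ.∣ seq x n ∣ ℚ.< ε) ⊎ Apart x → Eventually λ n → ℚ.∣ seq x n ℚ.- 0ℚ ∣ ℚ.< ε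
  small ε (inj₁ small) = mapE (λ n → ≡.subst (λ a → ℚ.∣ a ∣ ℚ.< ε) (≡.sym (ℚ.+-identityʳ (seq x n)))) small
  small ε (inj₂ apart) = ⊥-elim (¬apart apart)

apart-cancel : ∀ {x y} → x *ʳ y ≈ʳ 0ʳ → Apart y → x ≈ʳ 0ʳ
apart-cancel {x} {y} xy≈0 (δ , 0<δ , δ<y) = mk≈ λ ε 0<ε →
  mapE (step ε 0<ε) (both (approx xy≈0 (ε ℚ.* δ) (*-pos 0<ε 0<δ)) δ<y)
  where
  step : ∀ ε → 0ℚ ℚ.< ε → ∀ n →
         ℚ.∣ seq x n ℚ.* seq y n ℚ.- 0ℚ ∣ ℚ.< ε ℚ.* δ × δ ℚ.< ℚ.∣ seq y n ∣ → ℚ.∣ seq x n ℚ.- 0ℚ ∣ ℚ.< ε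
  step ε 0<ε n (xy< , δ<) = ≡.subst (λ a → ℚ.∣ a ∣ ℚ.< ε) (≡.sym (ℚ.+-identityʳ (seq x n)))
    (*-cancel-< {r = δ} (ℚ.<⇒≤ 0<δ) (ℚ.≤-<-trans
      (ℚ.*-monoˡ-≤-nonNeg ℚ.∣ seq x n ∣ {{ℚ.∣-∣-nonNeg (seq x n)}} (ℚ.<⇒≤ δ<))
      (≡.subst (ℚ._< ε ℚ.* δ) (≡.trans (≡.cong ℚ.∣_∣ (ℚ.+-identityʳ _)) (ℚ.∣p*q∣≡∣p∣*∣q∣ (seq x n) (seq y n))) xy<)))

≈0-cancel : ∀ {x y} → ¬ x ≈ʳ 0ʳ → x *ʳ y ≈ʳ 0ʳ → y ≈ʳ 0ʳ
≈0-cancel x≉0 xy≈0 = ¬apart⇒≈0 λ apart → x≉0 (apart-cancel xy≈0 apart)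

-- Equality in ℝ, ℂ and C*-algebras is ¬¬-stable, so equations may be proved by
-- classical case distinctions.
≈0-stable : ∀ {x} → ¬ ¬ x ≈ʳ 0ʳ → x ≈ʳ 0ʳ
≈0-stable {x} ¬¬x≈0 = ¬apart⇒≈0 λ apart → ¬¬x≈0 λ x≈0 →
  1≉0 (apart-cancel {1ʳ} {x} (≈ʳ-trans (pointwise λ n → ℚ.*-identityˡ (seq x n)) x≈0) apart)
  where
  1≉0 : ¬ 1ʳ ≈ʳ 0ʳ
  1≉0 1≈0 = let N , 1<½ = approx 1≈0 ½ (ℚ.positive⁻¹ ½) in
    ℚ.<-irrefl ≡.refl (ℚ.<-trans (1<½ N ℕ.≤-refl) (<-by ½ (ℚ.positive⁻¹ ½) ≡.refl))

≤ʳ-respˡ : ∀ {x y z} → x ≈ʳ y → x ≤ʳ z → y ≤ʳ z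
≤ʳ-respˡ {x} {y} {z} x≈y x≤z = mk≤ λ ε 0<ε → mapE (step ε)
  (both (below x≤z (½ ℚ.* ε) (½-pos 0<ε)) (approx x≈y (½ ℚ.* ε) (½-pos 0<ε)))
  where
  open ℚSolver.+-*-Solver
  step : ∀ ε n → seq x n ℚ.< seq z n ℚ.+ ½ ℚ.* ε × ℚ.∣ seq x n ℚ.- seq y n ∣ ℚ.< ½ ℚ.* ε → seq y n ℚ.< seq z n ℚ.+ ε
  step ε n (x< , d<) = ≡.subst₂ ℚ._<_
    (solve 2 (λ x y → (y :- x) :+ x := y) ≡.refl (seq x n) (seq y n))
    (solve 2 (λ z ε → con ½ :* ε :+ (z :+ con ½ :* ε) := z :+ ε) ≡.refl (seq z n) ε)
    (ℚ.+-mono-< (ℚ.≤-<-trans (p≤∣p∣ (seq y n ℚ.- seq x n))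
      (≡.subst (ℚ._< ½ ℚ.* ε) (∣-∣-sym (seq x n) (seq y n)) d<)) x<)

-- Rational scalars and the imaginary unit

ι : ℚ → ℂ
ι q = fromℚ q +i 0ʳ

iᶜ : ℂ
iᶜ = 0ʳ +i 1ʳ

∣ι∣² : ∀ q → ∣ ι q ∣² ≈ʳ fromℚ (q ℚ.* q)
∣ι∣² q = pointwise λ _ → ≡.trans (≡.cong (q ℚ.* q ℚ.+_) (ℚ.*-zeroˡ 0ℚ)) (ℚ.+-identityʳ _)

ι-+ : ∀ p q → ι p +ᶜ ι q ≈ᶜ ι (p ℚ.+ q)
ι-+ p q = (pointwise λ _ → ≡.refl) , (pointwise λ _ → ≡.refl)

ι-* : ∀ p q → ι p *ᶜ ι q ≈ᶜ ι (p ℚ.* q)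
ι-* p q = (pointwise λ _ → solve 2 (λ p q → p :* q :- con 0ℚ :* con 0ℚ := p :* q) ≡.refl p q)
        , (pointwise λ _ → solve 2 (λ p q → p :* con 0ℚ :+ con 0ℚ :* q := con 0ℚ) ≡.refl p q)
  where open ℚSolver.+-*-Solver

conj-ι : ∀ q → conj (ι q) ≈ᶜ ι q
conj-ι q = ≈ʳ-refl , pointwise λ _ → ≡.refl

iᶜ*iᶜ : iᶜ *ᶜ iᶜ ≈ᶜ -ᶜ 1ᶜ
iᶜ*iᶜ = (pointwise λ _ → ≡.refl) , (pointwise λ _ → ≡.refl)

conj-iᶜ : conj iᶜ ≈ᶜ -ᶜ iᶜ
conj-iᶜ = (pointwise λ _ → ≡.refl) , ≈ʳ-refl

∣-1∣² : ∣ -ᶜ 1ᶜ ∣² ≈ʳ fromℚ (1ℚ ℚ.* 1ℚ)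
∣-1∣² = pointwise λ _ → ≡.refl

∣∣²≈0 : ∀ z → ∣ z ∣² ≈ʳ 0ʳ → z ≈ᶜ 0ᶜ
∣∣²≈0 (a +i b) a²+b²≈0 = part a b a²+b²≈0
  , part b a (≈ʳ-trans (pointwise λ n → ℚ.+-comm (seq b n ℚ.* seq b n) _) a²+b²≈0)
  where
  0≤square : ∀ p → 0ℚ ℚ.≤ p ℚ.* p
  0≤square p with ℚ.≤-total 0ℚ p
  ... | inj₁ 0≤p = *-nonNeg 0≤p 0≤p
  ... | inj₂ p≤0 = ≡.subst (0ℚ ℚ.≤_) (solve 1 (λ p → :- p :* :- p := p :* p) ≡.refl p) (*-nonNeg 0≤-p 0≤-p)
    where
    open ℚSolver.+-*-Solver
    0≤-p = ℚ.neg-antimono-≤ p≤0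
  part : ∀ x y → x *ʳ x +ʳ y *ʳ y ≈ʳ 0ʳ → x ≈ʳ 0ʳ
  part x y sum≈0 = square≈0 (Bound⇒≈0 λ ε 0<ε → Bound-mono (ℚ.<⇒≤ 0<ε)
    (Bound-≤ 
      (mk≤ λ ε 0<ε → 0 , λ n _ → +-nonNeg-pos (0≤square (seq x n)) 0<ε)
      (mk≤ λ ε 0<ε → 0 , λ n _ → ≡.subst (seq x n ℚ.* seq x n ℚ.<_) (≡.sym (ℚ.+-assoc (seq x n ℚ.* seq x n) (seq y n ℚ.* seq y n) ε))
        (<-by _ (+-nonNeg-pos (0≤square (seq y n)) 0<ε) ≡.refl))
      (≈0⇒Bound sum≈0)))

≈ᶜ0-stable : ∀ {z} → ¬ ¬ z ≈ᶜ 0ᶜ → z ≈ᶜ 0ᶜ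
≈ᶜ0-stable ¬¬z≈0 = ≈0-stable (λ ¬re → ¬¬z≈0 λ z≈0 → ¬re (re≈ z≈0))
                 , ≈0-stable (λ ¬im → ¬¬z≈0 λ z≈0 → ¬im (im≈ z≈0))

-- Norm estimates in C*-algebras and orthogonality of projections

module CStar {c ℓ} (A : C*Algebra c ℓ) where
  open C*Algebra A hiding (zero)
  open IsLeftModule isLeftModule using (*ₗ-cong; *ₗ-congˡ; *ₗ-congʳ; *ₗ-zeroˡ; *ₗ-zeroʳ; *ₗ-distribˡ; *ₗ-distribʳ; *ₗ-identityˡ; *ₗ-assoc)
  open RingProperties ring
  open SetoidReasoning setoid
  open import Algebra.Properties.Monoid.Mult +-monoid using () renaming (_×_ to _⨉_)
  open import Algebra.Properties.Semiring.Sum semiring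
  private module S = CMSolver +-commutativeMonoid

  -·ˡ : ∀ α a → (-ᶜ α) · a ≈ - (α · a)
  -·ˡ α a = +-inverseˡ-unique _ _ (begin
    (-ᶜ α) · a + α · a  ≈⟨ *ₗ-distribʳ a (-ᶜ α) α ⟨
    (-ᶜ α +ᶜ α) · a     ≈⟨ *ₗ-congʳ (ℂ′.-‿inverseˡ α) ⟩
    0ᶜ · a              ≈⟨ *ₗ-zeroˡ a ⟩
    0#                  ∎)

  -‿· : ∀ a → (-ᶜ 1ᶜ) · a ≈ - a
  -‿· a = trans (-·ˡ 1ᶜ a) (-‿cong (*ₗ-identityˡ a))

  ι-·-+ : ∀ p q a → ι p · a + ι q · a ≈ ι (p ℚ.+ q) · a
  ι-·-+ p q a = trans (sym (*ₗ-distribʳ a (ι p) (ι q))) (*ₗ-congʳ (ι-+ p q))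

  ι-·-* : ∀ p q a → ι p · (ι q · a) ≈ ι (p ℚ.* q) · a
  ι-·-* p q a = trans (sym (*ₗ-assoc (ι p) (ι q) a)) (*ₗ-congʳ (ι-* p q))

  halve : ∀ a → a ≈ ι ½ · (a + a)
  halve a = begin
    a                    ≈⟨ *ₗ-identityˡ a ⟨
    ι 1ℚ · a             ≡⟨ ≡.cong (λ q → ι q · a) {½ ℚ.+ ½} ≡.refl ⟨
    ι (½ ℚ.+ ½) · a      ≈⟨ ι-·-+ ½ ½ a ⟨
    ι ½ · a + ι ½ · a    ≈⟨ *ₗ-distribˡ (ι ½) a a ⟨
    ι ½ · (a + a)        ∎

  ⨉≈natℚ· : ∀ k a → k ⨉ a ≈ ι (natℚ k) · a
  ⨉≈natℚ· zero    a = sym (*ₗ-zeroˡ a)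
  ⨉≈natℚ· (suc k) a = begin
    a + k ⨉ a                    ≈⟨ +-cong (sym (*ₗ-identityˡ a)) (⨉≈natℚ· k a) ⟩
    ι 1ℚ · a + ι (natℚ k) · a    ≈⟨ ι-·-+ 1ℚ (natℚ k) a ⟩
    ι (1ℚ ℚ.+ natℚ k) · a        ∎

  reciprocal : ∀ k → ∃[ r ] (0ℚ ℚ.≤ r × r ℚ.* natℚ (suc k) ≡ 1ℚ)
  reciprocal k = let r , 0<r , kr≡1 = divide (natℚ-pos k) 0<1 in
    r , ℚ.<⇒≤ 0<r , ≡.trans (ℚ.*-comm r (natℚ (suc k))) kr≡1

  ⨉-divide : ∀ k {r} → r ℚ.* natℚ (suc k) ≡ 1ℚ → ∀ a → ι r · (suc k ⨉ a) ≈ a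
  ⨉-divide k {r} rk≡1 a = begin
    ι r · (suc k ⨉ a)                  ≈⟨ *ₗ-congˡ (⨉≈natℚ· (suc k) a) ⟩
    ι r · (ι (natℚ (suc k)) · a)       ≈⟨ ι-·-* r (natℚ (suc k)) a ⟩
    ι (r ℚ.* natℚ (suc k)) · a         ≡⟨ ≡.cong (λ q → ι q · a) rk≡1 ⟩
    1ᶜ · a                             ≈⟨ *ₗ-identityˡ a ⟩
    a                                  ∎

  ⨉≈0⇒≈0 : ∀ k a → suc k ⨉ a ≈ 0# → a ≈ 0#
  ⨉≈0⇒≈0 k a ka≈0 = trans (sym (⨉-divide k {r} (proj₂ (proj₂ (reciprocal k))) a))
    (trans (*ₗ-congˡ ka≈0) (*ₗ-zeroʳ (ι r)))
    where r = proj₁ (reciprocal k)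

  infix 4 _≤ⁿ_

  record _≤ⁿ_ (a : Carrier) (B : ℚ) : Set where
    constructor [_]
    field
      bound : Bound ‖ a ‖ B

  open _≤ⁿ_ public

  ≤ⁿ-cong : ∀ {a b B} → a ≈ b → a ≤ⁿ B → b ≤ⁿ B
  ≤ⁿ-cong {a} {b} a≈b [ a≤B ] = [ Bound-≈ (‖‖-cong a≈b) a≤B ]

  ≤ⁿ-mono : ∀ {a B C} → B ℚ.≤ C → a ≤ⁿ B → a ≤ⁿ C
  ≤ⁿ-mono {a} B≤C [ a≤B ] = [ Bound-mono B≤C a≤B ]

  ≤ⁿ-+ : ∀ {a b B C} → a ≤ⁿ B → b ≤ⁿ C → a + b ≤ⁿ B ℚ.+ C
  ≤ⁿ-+ {a} {b} [ a≤B ] [ b≤C ] = [ Bound-≤ (‖‖-nonNeg (a + b)) (‖‖-triangle a b)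
    (Bound-+ a≤B b≤C) ]

  ≤ⁿ-* : ∀ {a b B C} → 0ℚ ℚ.≤ B → 0ℚ ℚ.≤ C → a ≤ⁿ B → b ≤ⁿ C → a * b ≤ⁿ B ℚ.* C
  ≤ⁿ-* {a} {b} 0≤B 0≤C [ a≤B ] [ b≤C ] = [ Bound-≤ (‖‖-nonNeg (a * b)) (‖‖-submult a b)
    (Bound-* 0≤B 0≤C a≤B b≤C) ]

  ≤ⁿ-⋆ : ∀ {a B} → 0ℚ ℚ.≤ B → a ⋆ * a ≤ⁿ B ℚ.* B → a ≤ⁿ B
  ≤ⁿ-⋆ {a} 0≤B [ a⋆a≤ ] = [ Bound-√ 0≤B (Bound-≈ (c*-identity a) a⋆a≤) ]

  -- The modulus of `α` enters as a rational `q` with |α|² = q², because homogeneity of the norm is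
  -- stated for squares.
  ≤ⁿ-· : ∀ {α q a B} → ∣ α ∣² ≈ʳ fromℚ (q ℚ.* q) → 0ℚ ℚ.≤ q → 0ℚ ℚ.≤ B → a ≤ⁿ B → α · a ≤ⁿ q ℚ.* B
  ≤ⁿ-· {α} {q} {a} {B} ∣α∣²≈q² 0≤q 0≤B [ a≤B ] = [ Bound-√ (*-nonNeg 0≤q 0≤B)
    (≡.subst (Bound (‖ α · a ‖ *ʳ ‖ α · a ‖))
      (solve 2 (λ q B → (q :* q) :* (B :* B) := (q :* B) :* (q :* B)) ≡.refl q B)
      (Bound-≈ (≈ʳ-sym (‖‖-homog α a))
        (Bound-* (*-nonNeg 0≤q 0≤q) (*-nonNeg 0≤B 0≤B)
          (Bound-≈ (≈ʳ-sym ∣α∣²≈q²) (Bound-fromℚ (*-nonNeg 0≤q 0≤q)))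
          (Bound-* 0≤B 0≤B a≤B a≤B)))) ]
    where open ℚSolver.+-*-Solver

  ≤ⁿ-ι· : ∀ {q a B} → 0ℚ ℚ.≤ q → 0ℚ ℚ.≤ B → a ≤ⁿ B → ι q · a ≤ⁿ q ℚ.* B
  ≤ⁿ-ι· {q} = ≤ⁿ-· (∣ι∣² q)

  ≤ⁿ-neg : ∀ {a B} → 0ℚ ℚ.≤ B → a ≤ⁿ B → - a ≤ⁿ B
  ≤ⁿ-neg {a} {B} 0≤B a≤B = ≤ⁿ-cong (-‿· a) (≡.subst ((-ᶜ 1ᶜ) · a ≤ⁿ_) (ℚ.*-identityˡ B)
    (≤ⁿ-· ∣-1∣² (ℚ.<⇒≤ 0<1) 0≤B a≤B))

  ≤ⁿ-halve : ∀ {a B} → 0ℚ ℚ.≤ B → a + a ≤ⁿ B ℚ.+ B → a ≤ⁿ B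
  ≤ⁿ-halve {a} {B} 0≤B 2a≤2B = ≤ⁿ-cong (sym (halve a)) (≡.subst (ι ½ · (a + a) ≤ⁿ_)
    (solve 1 (λ B → con ½ :* (B :+ B) := B) ≡.refl B)
    (≤ⁿ-ι· (ℚ.nonNegative⁻¹ ½) (+-nonNeg 0≤B 0≤B) 2a≤2B))
    where open ℚSolver.+-*-Solver

  ≤ⁿ⇒≈0 : ∀ {a} → (∀ ε → 0ℚ ℚ.< ε → a ≤ⁿ ε) → a ≈ 0#
  ≤ⁿ⇒≈0 {a} a≤ = ‖‖-definite a (Bound⇒≈0 λ ε 0<ε → bound (a≤ ε 0<ε))

  ‖‖-square≈0 : ∀ {a} → ‖ a ‖ *ʳ ‖ a ‖ ≈ʳ 0ʳ → a ≈ 0#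
  ‖‖-square≈0 {a} eq = ‖‖-definite a (square≈0 eq)

  ‖0‖ : ‖ 0# ‖ ≈ʳ 0ʳ
  ‖0‖ = square≈0 (≈ʳ-trans (*ʳ-cong ‖0·0‖ ‖0·0‖) (≈ʳ-trans (‖‖-homog 0ᶜ 0#)
    (≈ʳ-trans (*ʳ-cong (∣ι∣² 0ℚ) ≈ʳ-refl) (pointwise λ n → ℚ.*-zeroˡ (seq (‖ 0# ‖) n ℚ.* seq (‖ 0# ‖) n)))))
    where
    ‖0·0‖ : ‖ 0# ‖ ≈ʳ ‖ 0ᶜ · 0# ‖
    ‖0·0‖ = ‖‖-cong (sym (*ₗ-zeroˡ 0#))

  ⋆*≈0⇒≈0 : ∀ {a} → a ⋆ * a ≈ 0# → a ≈ 0#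
  ⋆*≈0⇒≈0 {a} a⋆a≈0 = ‖‖-square≈0 (≈ʳ-trans (≈ʳ-sym (c*-identity a)) (≈ʳ-trans (‖‖-cong a⋆a≈0) ‖0‖))

  ≈-stable : ∀ {a b} → ¬ ¬ a ≈ b → a ≈ b
  ≈-stable {a} {b} ¬¬a≈b = x∙y⁻¹≈ε⇒x≈y a b (‖‖-definite (a - b) (≈0-stable λ ¬norm≈0 →
    ¬¬a≈b λ a≈b → ¬norm≈0 (≈ʳ-trans (‖‖-cong (x≈y⇒x∙y⁻¹≈ε a≈b)) ‖0‖)))

  -- From `¬ α ≈ᶜ 0ᶜ` no inverse of `α` can be computed, so the cancellation happens in |α|² ‖a‖² =
  -- 0, where tightness of apartness suffices.
  ·-cancel : ∀ {α a} → ¬ α ≈ᶜ 0ᶜ → α · a ≈ 0# → a ≈ 0#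
  ·-cancel {α} {a} α≉0 αa≈0 = ‖‖-square≈0 (≈0-cancel (λ eq → α≉0 (∣∣²≈0 α eq))
    (≈ʳ-trans (≈ʳ-sym (‖‖-homog α a)) (≈ʳ-trans (*ʳ-cong ‖αa‖ ‖αa‖) (pointwise λ _ → ℚ.*-zeroˡ 0ℚ))))
    where
    ‖αa‖ : ‖ α · a ‖ ≈ʳ 0ʳ
    ‖αa‖ = ≈ʳ-trans (‖‖-cong αa≈0) ‖0‖

  1⋆≈1 : 1# ⋆ ≈ 1#
  1⋆≈1 = begin
    1# ⋆              ≈⟨ *-identityʳ (1# ⋆) ⟨
    1# ⋆ * 1#         ≈⟨ *-congˡ (⋆-involutive 1#) ⟨
    1# ⋆ * (1# ⋆) ⋆   ≈⟨ ⋆-*-anti (1# ⋆) 1# ⟨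
    (1# ⋆ * 1#) ⋆     ≈⟨ ⋆-cong (*-identityʳ (1# ⋆)) ⟩
    (1# ⋆) ⋆          ≈⟨ ⋆-involutive 1# ⟩
    1#                ∎

  -‿⋆ : ∀ a → (- a) ⋆ ≈ - (a ⋆)
  -‿⋆ a = begin
    (- a) ⋆              ≈⟨ ⋆-cong (-‿· a) ⟨
    ((-ᶜ 1ᶜ) · a) ⋆      ≈⟨ ⋆-·-antilin (-ᶜ 1ᶜ) a ⟩
    conj (-ᶜ 1ᶜ) · a ⋆   ≈⟨ *ₗ-congʳ (≈ʳ-refl , pointwise λ _ → ≡.refl) ⟩
    (-ᶜ 1ᶜ) · a ⋆        ≈⟨ -‿· (a ⋆) ⟩
    - (a ⋆)              ∎

  record IsProjection (p : Carrier) : Set ℓ where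
    constructor _,_
    field
      idem : p * p ≈ p
      self : p ⋆ ≈ p

  -- The C*-identity turns p⋆p = p into ‖p‖² = ‖p‖.
  projection-≤ⁿ1 : ∀ {p} → IsProjection p → p ≤ⁿ 1ℚ
  projection-≤ⁿ1 {p} (idem , self) = [ Bound-idem (≈ʳ-trans (≈ʳ-sym (c*-identity p))
    (‖‖-cong (trans (*-congʳ self) idem))) ]

  1-projection : IsProjection 1#
  1-projection = *-identityˡ 1# , 1⋆≈1

  -- The selfadjoint unitary 1 - 2p serves twice: as a contraction it bounds compressions, and
  -- conjugation by it tests commutation with `p`.
  projection-symmetry : ∀ {p} → IsProjection p → (1# - (p + p)) ⋆ ≈ 1# - (p + p) ×
                        (1# - (p + p)) * (1# - (p + p)) ≈ 1#
  projection-symmetry {p} (idem , self) =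
      trans (⋆-+-homo 1# (- (p + p))) (+-cong 1⋆≈1 (trans (-‿⋆ (p + p)) (-‿cong (trans (⋆-+-homo p p) (+-cong self self)))))
    , (begin
      s * s                            ≈⟨ distribʳ s 1# (- (p + p)) ⟩
      1# * s + - (p + p) * s           ≈⟨ +-cong (*-identityˡ s) (sym (-‿distribˡ-* (p + p) s)) ⟩
      s - (p + p) * s                  ≈⟨ +-congˡ (-‿cong (trans (distribʳ s p p) (+-cong ps≈-p ps≈-p))) ⟩
      s - (- p + - p)                  ≈⟨ +-congˡ (trans (-‿cong (-‿+-comm p p)) (-‿involutive (p + p))) ⟩
      (1# - (p + p)) + (p + p)         ≈⟨ +-assoc _ _ _ ⟩
      1# + (- (p + p) + (p + p))       ≈⟨ +-congˡ (-‿inverseˡ (p + p)) ⟩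
      1# + 0#                          ≈⟨ +-identityʳ 1# ⟩
      1#                               ∎)
    where
    s = 1# - (p + p)
    ps≈-p : p * s ≈ - p
    ps≈-p = begin
      p * s                            ≈⟨ distribˡ p 1# (- (p + p)) ⟩
      p * 1# + p * - (p + p)           ≈⟨ +-cong (*-identityʳ p) (trans (sym (-‿distribʳ-* p (p + p)))
                                            (-‿cong (trans (distribˡ p p p) (+-cong idem idem)))) ⟩
      p - (p + p)                      ≈⟨ +-congˡ (-‿+-comm p p) ⟨
      p + (- p + - p)                  ≈⟨ +-assoc _ _ _ ⟨
      (p - p) + - p                    ≈⟨ +-congʳ (-‿inverseʳ p) ⟩
      0# + - p                         ≈⟨ +-identityˡ (- p) ⟩
      - p                              ∎

  symmetry-≤ⁿ1 : ∀ {p} → IsProjection p → 1# - (p + p) ≤ⁿ 1ℚ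
  symmetry-≤ⁿ1 p-proj = let s⋆ , ss = projection-symmetry p-proj in
    ≤ⁿ-⋆ (ℚ.<⇒≤ 0<1) (≤ⁿ-cong (sym (trans (*-congʳ s⋆) ss)) (projection-≤ⁿ1 1-projection))

  0≤ⁿ0 : 0# ≤ⁿ 0ℚ
  0≤ⁿ0 = [ ≈0⇒Bound ‖0‖ ]

  -- Selfadjoint elements of the corner eAe and extremality of its unit e

  record InCorner (e x : Carrier) : Set ℓ where
    constructor inCorner
    field
      ex≈x : e * x ≈ x
      xe≈x : x * e ≈ x
      x⋆≈x : x ⋆ ≈ x

  corner-· : ∀ {e x α} → conj α ≈ᶜ α → InCorner e x → InCorner e (α · x)
  corner-· {e} {x} {α} α̅≈α (inCorner ex xe x⋆) = inCorner
    (trans (*-·-comm α e x) (*ₗ-congˡ ex))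
    (trans (·-*-assoc α x e) (*ₗ-congˡ xe))
    (trans (⋆-·-antilin α x) (*ₗ-cong α̅≈α x⋆))

  corner-+ : ∀ {e x y} → InCorner e x → InCorner e y → InCorner e (x + y)
  corner-+ {e} {x} {y} (inCorner ex xe x⋆) (inCorner ey ye y⋆) = inCorner
    (trans (distribˡ e x y) (+-cong ex ey))
    (trans (distribʳ e x y) (+-cong xe ye))
    (trans (⋆-+-homo x y) (+-cong x⋆ y⋆))

  corner-neg : ∀ {e x} → InCorner e x → InCorner e (- x)
  corner-neg {e} {x} (inCorner ex xe x⋆) = inCorner
    (trans (sym (-‿distribʳ-* e x)) (-‿cong ex))
    (trans (sym (-‿distribˡ-* x e)) (-‿cong xe))
    (trans (-‿⋆ x) (-‿cong x⋆))

  module Corner {e} (projection : IsProjection e) where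
    open IsProjection projection renaming (idem to ee≈e; self to e⋆≈e)

    square : ∀ {z} → e * z ≈ z → z * e ≈ z → (e + z) * (e + z) ≈ (e + z) + (z + z * z)
    square {z} ez ze = begin
      (e + z) * (e + z)            ≈⟨ distribʳ (e + z) e z ⟩
      e * (e + z) + z * (e + z)    ≈⟨ +-cong (distribˡ e e z) (distribˡ z e z) ⟩
      (e * e + e * z) + (z * e + z * z) ≈⟨ +-cong (+-cong ee≈e ez) (+-congʳ ze) ⟩
      (e + z) + (z + z * z)        ∎

    cube : ∀ {z} → e * z ≈ z → z * e ≈ z →
           (e + z) * ((e + z) * (e + z)) ≈ ((e + z) + (z + z * z)) + ((z + z * z) + (z * z + z * (z * z)))
    cube {z} ez ze = begin
      (e + z) * ((e + z) * (e + z))                        ≈⟨ *-congˡ (square ez ze) ⟩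
      (e + z) * ((e + z) + (z + z * z))                    ≈⟨ distribʳ _ e z ⟩
      e * ((e + z) + (z + z * z)) + z * ((e + z) + (z + z * z)) ≈⟨ +-cong
        (trans (distribˡ _ _ _) (+-cong (trans (distribˡ _ _ _) (+-cong ee≈e ez)) (trans (distribˡ _ _ _) (+-cong ez ezz))))
        (trans (distribˡ _ _ _) (+-cong (trans (distribˡ _ _ _) (+-congʳ ze)) (distribˡ _ _ _))) ⟩
      ((e + z) + (z + z * z)) + ((z + z * z) + (z * z + z * (z * z))) ∎
      where
      ezz : e * (z * z) ≈ z * z
      ezz = trans (sym (*-assoc e z z)) (*-congʳ ez)

    -- With v = e + ix and x = 2d, the identity 6 (e + x)² + v³ + (v⋆)³ = 8 (e + 3d)
    -- exhibits e + 3d as a convex combination of contractions.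
    amplify : ∀ {d} → InCorner e d → e + (d + d) ≤ⁿ 1ℚ → e - (d + d) ≤ⁿ 1ℚ → e + (d + d + d) ≤ⁿ 1ℚ
    -- Six squares and two cubes are eight contractions with sum 8 (e + 3d); the three halvings
    -- divide by 8.
    amplify {d} d∈ e+x≤1 e-x≤1 = ≤ⁿ-halve 0≤1 (≤ⁿ-halve 0≤2 (≤ⁿ-halve 0≤4 (≤ⁿ-cong identity
      (≤ⁿ-+ (≤ⁿ-+ (≤ⁿ-+ sq≤1 sq≤1) (≤ⁿ-+ (≤ⁿ-+ sq≤1 sq≤1) (≤ⁿ-+ sq≤1 sq≤1)))
        (≤ⁿ-+ (≤ⁿ-* 0≤1 0≤1 v≤1 (≤ⁿ-* 0≤1 0≤1 v≤1 v≤1)) (≤ⁿ-* 0≤1 0≤1 v⋆≤1 (≤ⁿ-* 0≤1 0≤1 v⋆≤1 v⋆≤1)))))))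
      where
      0≤1 : 0ℚ ℚ.≤ 1ℚ
      0≤1 = ℚ.<⇒≤ 0<1
      0≤2 : 0ℚ ℚ.≤ 1ℚ ℚ.+ 1ℚ
      0≤2 = +-nonNeg 0≤1 0≤1
      0≤4 : 0ℚ ℚ.≤ (1ℚ ℚ.+ 1ℚ) ℚ.+ (1ℚ ℚ.+ 1ℚ)
      0≤4 = +-nonNeg 0≤2 0≤2
      x = d + d
      w = x * x
      y = iᶜ · x
      open InCorner (corner-+ d∈ d∈)
      ey : e * y ≈ y
      ey = trans (*-·-comm iᶜ e x) (*ₗ-congˡ ex≈x)
      ye : y * e ≈ y
      ye = trans (·-*-assoc iᶜ x e) (*ₗ-congˡ xe≈x)
      e-y : e * - y ≈ - y
      e-y = trans (sym (-‿distribʳ-* e y)) (-‿cong ey)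
      -ye : - y * e ≈ - y
      -ye = trans (sym (-‿distribˡ-* y e)) (-‿cong ye)
      neg-sq : ∀ a → - a * - a ≈ a * a
      neg-sq a = trans (sym (-‿distribˡ-* a (- a))) (trans (-‿cong (sym (-‿distribʳ-* a a))) (-‿involutive (a * a)))
      yy : y * y ≈ - w
      yy = begin
        y * y                  ≈⟨ ·-*-assoc iᶜ x y ⟩
        iᶜ · (x * y)           ≈⟨ *ₗ-congˡ (*-·-comm iᶜ x x) ⟩
        iᶜ · (iᶜ · w)          ≈⟨ *ₗ-assoc iᶜ iᶜ w ⟨
        (iᶜ *ᶜ iᶜ) · w         ≈⟨ *ₗ-congʳ iᶜ*iᶜ ⟩
        (-ᶜ 1ᶜ) · w            ≈⟨ -‿· w ⟩
        - w                    ∎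
      y⋆ : y ⋆ ≈ - y
      y⋆ = begin
        y ⋆                    ≈⟨ ⋆-·-antilin iᶜ x ⟩
        conj iᶜ · x ⋆          ≈⟨ *ₗ-cong conj-iᶜ x⋆≈x ⟩
        (-ᶜ iᶜ) · x            ≈⟨ -·ˡ iᶜ x ⟩
        - y                    ∎
      sq≤1 : (e + x) * (e + x) ≤ⁿ 1ℚ
      sq≤1 = ≤ⁿ-* 0≤1 0≤1 e+x≤1 e+x≤1
      -- e + x² is the mean of (e + x)² and (e - x)², where the terms linear in x cancel.
      e+w≤1 : e + w ≤ⁿ 1ℚ
      e+w≤1 = ≤ⁿ-halve 0≤1 (≤ⁿ-cong (begin
        (e + x) * (e + x) + (e - x) * (e - x)                   ≈⟨ +-cong (square ex≈x xe≈x) (square e-x -xe) ⟩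
        ((e + x) + (x + w)) + ((e + - x) + (- x + - x * - x))   ≈⟨ +-congˡ (+-congˡ (+-congˡ (neg-sq x))) ⟩
        ((e + x) + (x + w)) + ((e + - x) + (- x + w))           ≈⟨ S.solve 4 (λ e x w x′ →
            ((e S.⊕ x) S.⊕ (x S.⊕ w)) S.⊕ ((e S.⊕ x′) S.⊕ (x′ S.⊕ w)) S.⊜
            ((e S.⊕ w) S.⊕ (e S.⊕ w)) S.⊕ ((x S.⊕ x′) S.⊕ (x S.⊕ x′))) refl e x w (- x) ⟩
        ((e + w) + (e + w)) + ((x - x) + (x - x))               ≈⟨ +-congˡ (trans (+-cong (-‿inverseʳ x) (-‿inverseʳ x)) (+-identityʳ 0#)) ⟩
        ((e + w) + (e + w)) + 0#                                ≈⟨ +-identityʳ _ ⟩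
        (e + w) + (e + w)                                       ∎)
        (≤ⁿ-+ sq≤1 (≤ⁿ-* 0≤1 0≤1 e-x≤1 e-x≤1)))
        where
        e-x : e * - x ≈ - x
        e-x = trans (sym (-‿distribʳ-* e x)) (-‿cong ex≈x)
        -xe : - x * e ≈ - x
        -xe = trans (sym (-‿distribˡ-* x e)) (-‿cong xe≈x)
      -- Treats e + ix and e - ix alike: for z = ix or z = -ix, with z′ = z⋆ = -z, the product (e +
      -- z)⋆ (e + z) is e + x², which is already bounded.
      v≤1-from : ∀ {z z′} → e * z ≈ z → z′ * e ≈ z′ → z ⋆ ≈ z′ → z + z′ ≈ 0# → z′ * z ≈ w → e + z ≤ⁿ 1ℚ
      v≤1-from {z} {z′} ez z′e z⋆ z+z′ z′z = ≤ⁿ-⋆ 0≤1 (≤ⁿ-cong (sym (begin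
        (e + z) ⋆ * (e + z)               ≈⟨ *-congʳ (trans (⋆-+-homo e z) (+-cong e⋆≈e z⋆)) ⟩
        (e + z′) * (e + z)                ≈⟨ distribʳ (e + z) e z′ ⟩
        e * (e + z) + z′ * (e + z)        ≈⟨ +-cong (distribˡ e e z) (distribˡ z′ e z) ⟩
        (e * e + e * z) + (z′ * e + z′ * z) ≈⟨ +-cong (+-cong ee≈e ez) (+-cong z′e z′z) ⟩
        (e + z) + (z′ + w)                ≈⟨ S.solve 4 (λ e z z′ w → (e S.⊕ z) S.⊕ (z′ S.⊕ w) S.⊜ (e S.⊕ w) S.⊕ (z S.⊕ z′)) refl e z z′ w ⟩
        (e + w) + (z + z′)                ≈⟨ +-congˡ z+z′ ⟩
        (e + w) + 0#                      ≈⟨ +-identityʳ _ ⟩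
        e + w                             ∎)) e+w≤1)
      v≤1 : e + y ≤ⁿ 1ℚ
      v≤1 = v≤1-from ey -ye y⋆ (-‿inverseʳ y)
        (trans (sym (-‿distribˡ-* y y)) (trans (-‿cong yy) (-‿involutive w)))
      v⋆≤1 : e - y ≤ⁿ 1ℚ
      v⋆≤1 = v≤1-from e-y ye (trans (-‿⋆ y) (trans (-‿cong y⋆) (-‿involutive y))) (-‿inverseˡ y)
        (trans (sym (-‿distribʳ-* y y)) (trans (-‿cong yy) (-‿involutive w)))
      w⁻ = - w
      k k′ : Carrier
      k  = y * (- w)
      k′ = - y * (- w)
      P Q Q′ t : Carrier
      P  = (e + x) * (e + x)
      Q  = (e + y) * ((e + y) * (e + y))
      Q′ = (e - y) * ((e - y) * (e - y))
      t  = e + (d + d + d)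
      cancel : ((w + w⁻) + (w + w⁻) + (w + w⁻) + (w + w⁻) + (w + w⁻) + (w + w⁻)) +
               ((y - y) + (y - y) + (y - y) + (k + k′)) ≈ 0#
      cancel = zeros₂ (zeros₆ (-‿inverseʳ w)) (zeros₂ (zeros₂ (zeros₂ (-‿inverseʳ y) (-‿inverseʳ y)) (-‿inverseʳ y))
        (trans (sym (distribʳ w⁻ y (- y))) (trans (*-congʳ (-‿inverseʳ y)) (zeroˡ w⁻))))
        where
        zeros₂ : ∀ {a b} → a ≈ 0# → b ≈ 0# → a + b ≈ 0#
        zeros₂ p q = trans (+-cong p q) (+-identityʳ 0#)
        zeros₆ : ∀ {a} → a ≈ 0# → a + a + a + a + a + a ≈ 0#
        zeros₆ p = zeros₂ (zeros₂ (zeros₂ (zeros₂ (zeros₂ p p) p) p) p) p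
      PP : P ≈ (e + x) + (x + w)
      PP = square ex≈x xe≈x
      QQ : Q ≈ ((e + y) + (y + w⁻)) + ((y + w⁻) + (w⁻ + k))
      QQ = trans (cube ey ye) (+-cong (+-congˡ (+-congˡ yy)) (+-cong (+-congˡ yy) (+-cong yy (*-congˡ yy))))
      QQ′ : Q′ ≈ ((e - y) + (- y + w⁻)) + ((- y + w⁻) + (w⁻ + k′))
      QQ′ = trans (cube e-y -ye) (+-cong (+-congˡ (+-congˡ s)) (+-cong (+-congˡ s) (+-cong s (*-congˡ s))))
        where
        s : - y * - y ≈ w⁻
        s = trans (neg-sq y) yy
      identity : ((P + P) + ((P + P) + (P + P))) + (Q + Q′) ≈ ((t + t) + (t + t)) + ((t + t) + (t + t))
      identity = begin
        ((P + P) + ((P + P) + (P + P))) + (Q + Q′)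
          ≈⟨ +-cong (+-cong (+-cong PP PP) (+-cong (+-cong PP PP) (+-cong PP PP))) (+-cong QQ QQ′) ⟩
        _ ≈⟨ S.solve 8 (λ e d w w⁻ y y′ k k′ →
               let x = d S.⊕ d
                   P = (e S.⊕ x) S.⊕ (x S.⊕ w)
                   Q = ((e S.⊕ y) S.⊕ (y S.⊕ w⁻)) S.⊕ ((y S.⊕ w⁻) S.⊕ (w⁻ S.⊕ k))
                   Q′ = ((e S.⊕ y′) S.⊕ (y′ S.⊕ w⁻)) S.⊕ ((y′ S.⊕ w⁻) S.⊕ (w⁻ S.⊕ k′))
                   t = e S.⊕ ((d S.⊕ d) S.⊕ d)
                   W = w S.⊕ w⁻
                   Y = y S.⊕ y′
               in ((P S.⊕ P) S.⊕ ((P S.⊕ P) S.⊕ (P S.⊕ P))) S.⊕ (Q S.⊕ Q′) S.⊜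
                  (((t S.⊕ t) S.⊕ (t S.⊕ t)) S.⊕ ((t S.⊕ t) S.⊕ (t S.⊕ t))) S.⊕
                  ((((((W S.⊕ W) S.⊕ W) S.⊕ W) S.⊕ W) S.⊕ W) S.⊕ (((Y S.⊕ Y) S.⊕ Y) S.⊕ (k S.⊕ k′))))
             refl e d w w⁻ y (- y) k k′ ⟩
        (((t + t) + (t + t)) + ((t + t) + (t + t))) + _  ≈⟨ +-congˡ cancel ⟩
        (((t + t) + (t + t)) + ((t + t) + (t + t))) + 0# ≈⟨ +-identityʳ _ ⟩
        ((t + t) + (t + t)) + ((t + t) + (t + t)) ∎

    -- A direction `x` in which `e` is the midpoint of two contractions of the corner; extremality
    -- of `e` says that only 0 is flat.
    record Flat (x : Carrier) : Set ℓ where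
      constructor flat
      field
        inside : InCorner e x
        plus   : e + x ≤ⁿ 1ℚ
        minus  : e - x ≤ⁿ 1ℚ

    -- The ratio of 3d to x = 2d in `amplify`. Written as a sum of halves, it matches `d + d + d`
    -- with d = ½ x.
    1½ : ℚ
    1½ = ½ ℚ.+ ½ ℚ.+ ½

    Flat-amplify : ∀ {x} → Flat x → Flat (ι 1½ · x)
    Flat-amplify {x} (flat x∈ plus minus) = flat (corner-· (conj-ι 1½) x∈)
      (≤ⁿ-cong (+-congˡ 3d≈) (amplify d∈ (≤ⁿ-cong (+-congˡ x≈2d) plus) (≤ⁿ-cong (+-congˡ (-‿cong x≈2d)) minus)))
      (≤ⁿ-cong (+-congˡ (trans -3d (-‿cong 3d≈))) (amplify (corner-neg d∈)
        (≤ⁿ-cong (+-congˡ (trans (-‿cong x≈2d) (sym (-‿+-comm d d)))) minus)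
        (≤ⁿ-cong (+-congˡ (trans x≈2d (sym (trans (-‿cong (-‿+-comm d d)) (-‿involutive (d + d)))))) plus)))
      where
      d = ι ½ · x
      d∈ : InCorner e d
      d∈ = corner-· (conj-ι ½) x∈
      x≈2d : x ≈ d + d
      x≈2d = trans (halve x) (*ₗ-distribˡ (ι ½) x x)
      3d≈ : d + d + d ≈ ι 1½ · x
      3d≈ = trans (+-congʳ (ι-·-+ ½ ½ x)) (ι-·-+ (½ ℚ.+ ½) ½ x)
      -3d : - d + - d + - d ≈ - (d + d + d)
      -3d = trans (+-congʳ (-‿+-comm d d)) (-‿+-comm (d + d) d)

    -- (3/2)^k x is still flat, and a flat element has norm at most 1 because 2x = (e + x) - (e -
    -- x).
    Flat-bound : ∀ k {x} → Flat x → x ≤ⁿ ⅔ ^ k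
    Flat-bound zero {x} (flat x∈ plus minus) = ≤ⁿ-halve (ℚ.<⇒≤ 0<1) (≤ⁿ-cong (begin
      (e + x) + - (e - x)       ≈⟨ +-congˡ (trans (sym (-‿+-comm e (- x))) (+-congˡ (-‿involutive x))) ⟩
      (e + x) + (- e + x)       ≈⟨ S.solve 3 (λ e x e′ → (e S.⊕ x) S.⊕ (e′ S.⊕ x) S.⊜ (x S.⊕ x) S.⊕ (e S.⊕ e′)) refl e x (- e) ⟩
      (x + x) + (e - e)         ≈⟨ +-congˡ (-‿inverseʳ e) ⟩
      (x + x) + 0#              ≈⟨ +-identityʳ _ ⟩
      x + x                     ∎)
      (≤ⁿ-+ plus (≤ⁿ-neg (ℚ.<⇒≤ 0<1) minus)))
    Flat-bound (suc k) {x} x-flat = ≤ⁿ-cong {B = ⅔ ^ suc k} (begin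
      ι ⅔ · (ι 1½ · x)      ≈⟨ ι-·-* ⅔ 1½ x ⟩
      ι (⅔ ℚ.* 1½) · x      ≡⟨ ≡.cong (λ q → ι q · x) {⅔ ℚ.* 1½} {1ℚ} ≡.refl ⟩
      ι 1ℚ · x              ≈⟨ *ₗ-identityˡ x ⟩
      x                     ∎)
      (≤ⁿ-ι· (ℚ.nonNegative⁻¹ ⅔) (⅔^-nonNeg k) (Flat-bound k (Flat-amplify x-flat)))

    Flat⇒≈0 : ∀ {x} → Flat x → x ≈ 0#
    Flat⇒≈0 x-flat = ≤ⁿ⇒≈0 λ ε 0<ε → let k , ⅔^k≤ε = ⅔^-small ε 0<ε in ≤ⁿ-mono ⅔^k≤ε (Flat-bound k x-flat)

    -- The norm condition is a spectrum-free substitute for 0 ≤ h ≤ e.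
    record Effect (h : Carrier) : Set ℓ where
      constructor effect
      field
        inside : InCorner e h
        bounds : e - (h + h) ≤ⁿ 1ℚ

    sum-Effect : ∀ n (h : Fin n → Carrier) → (∀ i → Effect (h i)) →
                 n ⨉ e - (sum h + sum h) ≤ⁿ natℚ n
    sum-Effect zero h effects = ≤ⁿ-cong (sym (trans (+-congˡ (-‿cong (+-identityʳ 0#))) (-‿inverseʳ 0#))) 0≤ⁿ0
    sum-Effect (suc n) h effects = ≤ⁿ-cong (begin
      (e - (h₀ + h₀)) + (n ⨉ e - (s + s))   ≈⟨ S.solve 4 (λ e h n s → (e S.⊕ h) S.⊕ (n S.⊕ s) S.⊜ (e S.⊕ n) S.⊕ (h S.⊕ s)) refl e (- (h₀ + h₀)) (n ⨉ e) (- (s + s)) ⟩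
      (e + n ⨉ e) + (- (h₀ + h₀) - (s + s)) ≈⟨ +-congˡ (-‿+-comm (h₀ + h₀) (s + s)) ⟩
      (e + n ⨉ e) - ((h₀ + h₀) + (s + s))   ≈⟨ +-congˡ (-‿cong (S.solve 2 (λ h s → (h S.⊕ h) S.⊕ (s S.⊕ s) S.⊜ (h S.⊕ s) S.⊕ (h S.⊕ s)) refl h₀ s)) ⟩
      (e + n ⨉ e) - ((h₀ + s) + (h₀ + s))   ∎)
      (≤ⁿ-+ (Effect.bounds (effects zero)) (sum-Effect n _ λ i → effects (suc i)))
      where
      h₀ = h zero
      s = sum λ i → h (suc i)

    -- Let s be the sum of the other effects, so that h₀ = -s. Then (n + 1) e - 2h₀ = n e + (e -
    -- 2h₀) and (n + 1) e + 2h₀ = e + (n e - 2s) both have norm at most n + 1. Hence 2h₀ / (n + 1)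
    -- is flat, so it is 0.
    Effect-sum≈0 : ∀ n {h₀} (h : Fin n → Carrier) → Effect h₀ → (∀ i → Effect (h i)) →
                   h₀ + sum h ≈ 0# → h₀ ≈ 0#
    Effect-sum≈0 n {h₀} h (effect h₀∈ e-2h₀≤1) effects h₀+s≈0 = begin
      h₀                          ≈⟨ halve h₀ ⟩
      ι ½ · (h₀ + h₀)             ≈⟨ *ₗ-congˡ 2h₀≈ ⟩
      ι ½ · (ι (natℚ (suc n)) · x) ≈⟨ *ₗ-congˡ (*ₗ-congˡ (Flat⇒≈0 x-flat)) ⟩
      ι ½ · (ι (natℚ (suc n)) · 0#) ≈⟨ *ₗ-congˡ (*ₗ-zeroʳ _) ⟩
      ι ½ · 0#                    ≈⟨ *ₗ-zeroʳ (ι ½) ⟩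
      0#                          ∎
      where
      r = proj₁ (reciprocal n)
      0≤r = proj₁ (proj₂ (reciprocal n))
      rn≡1 = proj₂ (proj₂ (reciprocal n))
      x = ι r · (h₀ + h₀)
      2h₀≈ : h₀ + h₀ ≈ ι (natℚ (suc n)) · x
      2h₀≈ = begin
        h₀ + h₀                              ≈⟨ *ₗ-identityˡ _ ⟨
        ι 1ℚ · (h₀ + h₀)                     ≡⟨ ≡.cong (λ q → ι q · (h₀ + h₀)) (≡.trans (ℚ.*-comm (natℚ (suc n)) r) rn≡1) ⟨
        ι (natℚ (suc n) ℚ.* r) · (h₀ + h₀)   ≈⟨ ι-·-* (natℚ (suc n)) r (h₀ + h₀) ⟨
        ι (natℚ (suc n)) · x                 ∎
      scaled : ∀ {y z} → ι r · y ≈ z → suc n ⨉ e + y ≤ⁿ natℚ (suc n) → e + z ≤ⁿ 1ℚ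
      scaled {y} {z} ry≈z le = ≤ⁿ-cong (begin
        ι r · (suc n ⨉ e + y)            ≈⟨ *ₗ-distribˡ (ι r) _ y ⟩
        ι r · (suc n ⨉ e) + ι r · y      ≈⟨ +-cong (⨉-divide n {r} rn≡1 e) ry≈z ⟩
        e + z                            ∎)
        (≡.subst (ι r · (suc n ⨉ e + y) ≤ⁿ_) rn≡1 (≤ⁿ-ι· 0≤r (natℚ-nonNeg (suc n)) le))
      n⨉e≤n : ∀ n → n ⨉ e ≤ⁿ natℚ n
      n⨉e≤n zero    = 0≤ⁿ0
      n⨉e≤n (suc n) = ≤ⁿ-+ (projection-≤ⁿ1 projection) (n⨉e≤n n)
      sum≈ : - (sum h + sum h) ≈ h₀ + h₀
      sum≈ = trans (sym (-‿+-comm (sum h) (sum h))) (+-cong -s≈h₀ -s≈h₀)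
        where -s≈h₀ = sym (+-inverseˡ-unique h₀ (sum h) h₀+s≈0)
      x-flat : Flat x
      x-flat = flat (corner-· (conj-ι r) (corner-+ h₀∈ h₀∈))
        (scaled refl (≤ⁿ-cong (begin
          e + (n ⨉ e - (sum h + sum h))  ≈⟨ +-assoc _ _ _ ⟨
          (e + n ⨉ e) - (sum h + sum h)  ≈⟨ +-congˡ sum≈ ⟩
          (e + n ⨉ e) + (h₀ + h₀)        ∎)
          (≤ⁿ-+ (projection-≤ⁿ1 projection) (sum-Effect n h effects))))
        (scaled (r·neg (h₀ + h₀)) (≤ⁿ-cong (S.solve 3 (λ e n h → (e S.⊕ h) S.⊕ n S.⊜ (e S.⊕ n) S.⊕ h) refl e (n ⨉ e) (- (h₀ + h₀)))
          (≤ⁿ-+ e-2h₀≤1 (n⨉e≤n n))))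
        where
        r·neg : ∀ a → ι r · (- a) ≈ - (ι r · a)
        r·neg a = +-inverseˡ-unique _ _ (trans (sym (*ₗ-distribˡ (ι r) (- a) a))
          (trans (*ₗ-congˡ (-‿inverseˡ a)) (*ₗ-zeroʳ (ι r))))

  orthogonal : ∀ {n} (q : Fin n → Carrier) → (∀ i → IsProjection (q i)) → sum q ≈ 1# →
               ∀ {i j} → i ≢ j → q i * q j ≈ 0#
  orthogonal {suc zero} q q-proj Σq≈1 {zero} {zero} i≢j = ⊥-elim (i≢j ≡.refl)
  -- The compression is by the second factor `e = q i`. Since e qⱼ e = (qⱼ e)⋆ (qⱼ e), a vanishing
  -- compression already gives qⱼ e = 0.
  orthogonal {suc (suc n)} q q-proj Σq≈1 {j} {i} j≢i = ⋆*≈0⇒≈0 (begin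
    (q j * e) ⋆ * (q j * e)       ≈⟨ *-congʳ (trans (⋆-*-anti _ _) (*-cong (IsProjection.self (q-proj i)) (IsProjection.self (q-proj j)))) ⟩
    (e * q j) * (q j * e)         ≈⟨ *-assoc _ _ _ ⟩
    e * (q j * (q j * e))         ≈⟨ *-congˡ (trans (sym (*-assoc _ _ _)) (*-congʳ (IsProjection.idem (q-proj j)))) ⟩
    h j                           ≡⟨ ≡.cong h (punchIn-punchOut i≢j) ⟨
    h (punchIn i j′)              ≈⟨ Effect-sum≈0 n (removeAt hᵢ j′) (effects j′) (λ k → effects _) Σ≈0 ⟩
    0#                            ∎)
    where
    e = q i
    i≢j : i ≢ j
    i≢j eq = j≢i (≡.sym eq)
    j′ = punchOut i≢j
    h : Fin (suc (suc n)) → Carrier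
    h k = e * (q k * e)
    hᵢ = removeAt h i
    open Corner (q-proj i)
    ee≈e = IsProjection.idem (q-proj i)
    e⋆≈e = IsProjection.self (q-proj i)
    effects : ∀ k → Effect (hᵢ k)
    effects k = effect (inCorner
      (trans (sym (*-assoc _ _ _)) (*-congʳ ee≈e))
      (trans (*-assoc _ _ _) (*-congˡ (trans (*-assoc _ _ _) (*-congˡ ee≈e))))
      (trans (⋆-*-anti _ _) (trans (*-cong (trans (⋆-*-anti _ _) (*-cong e⋆≈e (IsProjection.self (q-proj k′)))) e⋆≈e) (*-assoc _ _ _))))
      -- Compressing the symmetry 1 - 2p by `e` yields e - 2 epe, so this is a product of three
      -- contractions.
      (≤ⁿ-cong (begin
        e * ((1# - (p + p)) * e)         ≈⟨ *-congˡ (trans (distribʳ _ _ _) (+-cong (*-identityˡ e) (sym (-‿distribˡ-* _ _)))) ⟩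
        e * (e - (p + p) * e)            ≈⟨ trans (distribˡ _ _ _) (+-cong ee≈e (sym (-‿distribʳ-* _ _))) ⟩
        e - e * ((p + p) * e)            ≈⟨ +-congˡ (-‿cong (trans (*-congˡ (distribʳ _ _ _)) (distribˡ _ _ _))) ⟩
        e - (h k′ + h k′)                ∎)
        (≤ⁿ-* 0≤1 0≤1 e≤1 (≤ⁿ-* 0≤1 0≤1 s≤1 e≤1)))
      where
      k′ = punchIn i k
      p = q k′
      0≤1 = ℚ.<⇒≤ 0<1
      e≤1 = projection-≤ⁿ1 (q-proj i)
      s≤1 : 1# - (p + p) ≤ⁿ 1ℚ
      s≤1 = symmetry-≤ⁿ1 (q-proj k′)
    Σ≈0 : hᵢ j′ + sum (removeAt hᵢ j′) ≈ 0#
    Σ≈0 = trans (sym (sum-remove {i = j′} hᵢ)) (+-identityʳ-unique e (sum hᵢ) (begin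
      e + sum hᵢ          ≈⟨ +-congʳ (trans (*-congˡ ee≈e) ee≈e) ⟨
      h i + sum hᵢ        ≈⟨ sum-remove {i = i} h ⟨
      sum h               ≈⟨ *-distribˡ-sum e (λ k → q k * e) ⟨
      e * sum (λ k → q k * e) ≈⟨ *-congˡ (*-distribʳ-sum e q) ⟨
      e * (sum q * e)     ≈⟨ *-congˡ (trans (*-congʳ Σq≈1) (*-identityˡ e)) ⟩
      e * e               ≈⟨ ee≈e ⟩
      e                   ∎))

-- Central projections

module Quotient {c ℓ} (A : C*Algebra c ℓ) {p : C*Algebra.Carrier A} (p-proj : CStar.IsProjection A p)
  (central : ∀ a → C*Algebra._≈_ A (C*Algebra._*_ A p a) (C*Algebra._*_ A a p)) where
  open C*Algebra A
  open CStar A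
  open IsLeftModule isLeftModule using (*ₗ-cong; *ₗ-congˡ; *ₗ-congʳ; *ₗ-zeroˡ; *ₗ-zeroʳ; *ₗ-distribˡ; *ₗ-distribʳ; *ₗ-identityˡ; *ₗ-assoc)
  open RingProperties ring
  open SetoidReasoning setoid
  open IsProjection p-proj renaming (idem to pp≈p; self to p⋆≈p)

  infix 4 _~_

  _~_ : Carrier → Carrier → Set ℓ
  a ~ b = p * a ≈ p * b

  ≈⇒~ : ∀ {a b} → a ≈ b → a ~ b
  ≈⇒~ = *-congˡ

  -- Centrality makes multiplication by `p` a ⋆-homomorphism onto p A; the axioms of the new algebra
  -- that involve products are pulled back along it.
  p*-hom : ∀ a b → p * (a * b) ≈ (p * a) * (p * b)
  p*-hom a b = begin
    p * (a * b)          ≈⟨ *-congʳ pp≈p ⟨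
    (p * p) * (a * b)    ≈⟨ *-assoc p p _ ⟩
    p * (p * (a * b))    ≈⟨ *-congˡ (*-assoc p a b) ⟨
    p * ((p * a) * b)    ≈⟨ *-congˡ (*-congʳ (central a)) ⟩
    p * ((a * p) * b)    ≈⟨ *-congˡ (*-assoc a p b) ⟩
    p * (a * (p * b))    ≈⟨ *-assoc p a _ ⟨
    (p * a) * (p * b)    ∎

  p*-⋆ : ∀ a → p * a ⋆ ≈ (p * a) ⋆
  p*-⋆ a = begin
    p * a ⋆              ≈⟨ *-congʳ p⋆≈p ⟨
    p ⋆ * a ⋆            ≈⟨ ⋆-*-anti a p ⟨
    (a * p) ⋆            ≈⟨ ⋆-cong (central a) ⟨
    (p * a) ⋆            ∎

  p*-neg : ∀ a → p * - a ≈ - (p * a)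
  p*-neg a = sym (-‿distribʳ-* p a)

  p*p* : ∀ a → p * (p * a) ≈ p * a
  p*p* a = trans (sym (*-assoc p p a)) (*-congʳ pp≈p)

  p*-sub : ∀ a b → p * (a - b) ≈ p * a - p * b
  p*-sub a b = x[y-z]≈xy-xz p a b

  ~-+ : ∀ {a b c d} → a ~ b → c ~ d → a + c ~ b + d
  ~-+ {a} {b} {c} {d} a~b c~d = trans (distribˡ p a c) (trans (+-cong a~b c~d) (sym (distribˡ p b d)))

  ~-* : ∀ {a b c d} → a ~ b → c ~ d → a * c ~ b * d
  ~-* {a} {b} {c} {d} a~b c~d = trans (p*-hom a c) (trans (*-cong a~b c~d) (sym (p*-hom b d)))

  ~-neg : ∀ {a b} → a ~ b → - a ~ - b
  ~-neg {a} {b} a~b = trans (p*-neg a) (trans (-‿cong a~b) (sym (p*-neg b)))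

  ~-· : ∀ {α β a b} → α ≈ᶜ β → a ~ b → α · a ~ β · b
  ~-· {α} {β} {a} {b} α≈β a~b = trans (*-·-comm α p a) (trans (*ₗ-cong α≈β a~b) (sym (*-·-comm β p b)))

  ≤ʳ⇒≤ⁿ : ∀ {a B} → 0ℚ ℚ.≤ B → ‖ a ‖ ≤ʳ fromℚ B → a ≤ⁿ B
  ≤ʳ⇒≤ⁿ 0≤B a≤B = [ Bound-≤ (‖‖-nonNeg _) a≤B (Bound-fromℚ 0≤B) ]

  -- The limit l of p aₙ in A also serves here: p (aₙ - l) = p (p aₙ - l), and multiplication by `p`
  -- does not increase norms.
  ~-complete : ∀ (a : ℕ → Carrier) →
    (∀ ε → 0ℚ ℚ.< ε → ∃[ N ] ∀ m n → N ℕ.≤ m → N ℕ.≤ n → ‖ p * (a m - a n) ‖ ≤ʳ fromℚ ε) →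
    ∃[ l ] ∀ ε → 0ℚ ℚ.< ε → ∃[ N ] ∀ n → N ℕ.≤ n → ‖ p * (a n - l) ‖ ≤ʳ fromℚ ε
  ~-complete a a-cauchy =
    let l , pa→l = complete (λ n → p * a n) λ ε 0<ε →
          let N , close = a-cauchy ε 0<ε
          in N , λ m n N≤m N≤n → Bound⇒≤ʳ (bound (≤ⁿ-cong (p*-sub (a m) (a n))
               (≤ʳ⇒≤ⁿ (ℚ.<⇒≤ 0<ε) (close m n N≤m N≤n))))
    in l , λ ε 0<ε →
      let N , close = pa→l ε 0<ε
      in N , λ n N≤n → Bound⇒≤ʳ (bound (≡.subst (p * (a n - l) ≤ⁿ_) (ℚ.*-identityˡ ε)
           (≤ⁿ-cong (begin
             p * (p * a n - l)         ≈⟨ p*-sub (p * a n) l ⟩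
             p * (p * a n) - p * l     ≈⟨ +-congʳ (p*p* (a n)) ⟩
             p * a n - p * l           ≈⟨ p*-sub (a n) l ⟨
             p * (a n - l)             ∎)
             (≤ⁿ-* (ℚ.<⇒≤ 0<1) (ℚ.<⇒≤ 0<ε) (projection-≤ⁿ1 p-proj) (≤ʳ⇒≤ⁿ (ℚ.<⇒≤ 0<ε) (close n N≤n))))))

  -- The ideal p A, presented as the quotient of A by (1 - p) A so that the carrier and
  -- the operations stay the same.
  quotient : C*Algebra c ℓ
  quotient = record
    { ring = record
      { Carrier = Carrier ; _≈_ = _~_ ; _+_ = _+_ ; _*_ = _*_ ; -_ = -_ ; 0# = 0# ; 1# = 1#
      ; isRing = record
        { +-isAbelianGroup = record
          { isGroup = record
            { isMonoid = record
              { isSemigroup = record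
                { isMagma = record
                  { isEquivalence = record { refl = refl ; sym = sym ; trans = trans }
                  ; ∙-cong = ~-+
                  }
                ; assoc = λ a b c → ≈⇒~ (+-assoc a b c)
                }
              ; identity = (λ a → ≈⇒~ (+-identityˡ a)) , (λ a → ≈⇒~ (+-identityʳ a))
              }
            ; inverse = (λ a → ≈⇒~ (-‿inverseˡ a)) , (λ a → ≈⇒~ (-‿inverseʳ a))
            ; ⁻¹-cong = ~-neg
            }
          ; comm = λ a b → ≈⇒~ (+-comm a b)
          }
        ; *-cong = ~-*
        ; *-assoc = λ a b c → ≈⇒~ (*-assoc a b c)
        ; *-identity = (λ a → ≈⇒~ (*-identityˡ a)) , (λ a → ≈⇒~ (*-identityʳ a))
        ; distrib = (λ a b c → ≈⇒~ (distribˡ a b c)) , (λ a b c → ≈⇒~ (distribʳ a b c))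
        }
      }
    ; _·_ = _·_
    ; isLeftModule = record
      { isLeftSemimodule = record
        { +ᴹ-isCommutativeMonoid = record
          { isMonoid = record
            { isSemigroup = record
              { isMagma = record
                { isEquivalence = record { refl = refl ; sym = sym ; trans = trans }
                ; ∙-cong = ~-+
                }
              ; assoc = λ a b c → ≈⇒~ (+-assoc a b c)
              }
            ; identity = (λ a → ≈⇒~ (+-identityˡ a)) , (λ a → ≈⇒~ (+-identityʳ a))
            }
          ; comm = λ a b → ≈⇒~ (+-comm a b)
          }
        ; isPreleftSemimodule = record
          { *ₗ-cong = ~-·
          ; *ₗ-zeroˡ = λ a → ≈⇒~ (*ₗ-zeroˡ a)
          ; *ₗ-distribʳ = λ a α β → ≈⇒~ (*ₗ-distribʳ a α β)
          ; *ₗ-identityˡ = λ a → ≈⇒~ (*ₗ-identityˡ a)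
          ; *ₗ-assoc = λ α β a → ≈⇒~ (*ₗ-assoc α β a)
          ; *ₗ-zeroʳ = λ α → ≈⇒~ (*ₗ-zeroʳ α)
          ; *ₗ-distribˡ = λ α a b → ≈⇒~ (*ₗ-distribˡ α a b)
          }
        }
      ; -ᴹ‿cong = ~-neg
      ; -ᴹ‿inverse = (λ a → ≈⇒~ (-‿inverseˡ a)) , (λ a → ≈⇒~ (-‿inverseʳ a))
      }
    ; ·-*-assoc = λ α a b → ≈⇒~ (·-*-assoc α a b)
    ; *-·-comm = λ α a b → ≈⇒~ (*-·-comm α a b)
    ; _⋆ = _⋆
    ; ⋆-cong = λ {a} {b} a~b → trans (p*-⋆ a) (trans (⋆-cong a~b) (sym (p*-⋆ b)))
    ; ⋆-involutive = λ a → ≈⇒~ (⋆-involutive a)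
    ; ⋆-+-homo = λ a b → ≈⇒~ (⋆-+-homo a b)
    ; ⋆-·-antilin = λ α a → ≈⇒~ (⋆-·-antilin α a)
    ; ⋆-*-anti = λ a b → ≈⇒~ (⋆-*-anti a b)
    ; ‖_‖ = λ a → ‖ p * a ‖
    ; ‖‖-cong = ‖‖-cong
    ; ‖‖-nonNeg = λ a → ‖‖-nonNeg (p * a)
    ; ‖‖-definite = λ a ‖pa‖≈0 → trans (‖‖-definite (p * a) ‖pa‖≈0) (sym (zeroʳ p))
    ; ‖‖-triangle = λ a b → ≤ʳ-respˡ (‖‖-cong (sym (distribˡ p a b))) (‖‖-triangle (p * a) (p * b))
    ; ‖‖-homog = λ α a → ≈ʳ-trans (*ʳ-cong (‖‖-cong (*-·-comm α p a)) (‖‖-cong (*-·-comm α p a))) (‖‖-homog α (p * a))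
    ; ‖‖-submult = λ a b → ≤ʳ-respˡ (‖‖-cong (sym (p*-hom a b))) (‖‖-submult (p * a) (p * b))
    ; c*-identity = λ a → ≈ʳ-trans (‖‖-cong (trans (p*-hom (a ⋆) a) (*-congʳ (p*-⋆ a)))) (c*-identity (p * a))
    ; complete = ~-complete
    }

-- Inner automorphisms and central elements of the universal algebra

module Automorphism {c ℓ} (A : C*Algebra c ℓ) where
  open C*Algebra A hiding (zero)
  open CStar A
  open IsLeftModule isLeftModule using (*ₗ-congˡ; *ₗ-distribˡ)
  open RingProperties ring
  open SetoidReasoning setoid

  idHom : StarHom A A
  idHom = record
    { ⟦_⟧ = λ a → a
    ; isRingHomomorphism = record
      { isSemiringHomomorphism = record
        { isNearSemiringHomomorphism = record
          { +-isMonoidHomomorphism = record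
            { isMagmaHomomorphism = record
              { isRelHomomorphism = record { cong = λ a≈b → a≈b }
              ; homo = λ _ _ → refl
              }
            ; ε-homo = refl
            }
          ; *-homo = λ _ _ → refl
          }
        ; 1#-homo = refl
        }
      ; -‿homo = λ _ → refl
      }
    ; ·-homo = λ _ _ → refl
    ; ⋆-homo = λ _ → refl
    }

  conjugation : ∀ s → s ⋆ ≈ s → s * s ≈ 1# → StarHom A A
  conjugation s s⋆≈s ss≈1 = record
    { ⟦_⟧ = λ a → s * (a * s)
    ; isRingHomomorphism = record
      { isSemiringHomomorphism = record
        { isNearSemiringHomomorphism = record
          { +-isMonoidHomomorphism = record
            { isMagmaHomomorphism = record
              { isRelHomomorphism = record { cong = λ a≈b → *-congˡ (*-congʳ a≈b) }
              ; homo = λ a b → trans (*-congˡ (distribʳ s a b)) (distribˡ s (a * s) (b * s))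
              }
            ; ε-homo = trans (*-congˡ (zeroˡ s)) (zeroʳ s)
            }
          ; *-homo = λ a b → begin
              s * ((a * b) * s)                ≈⟨ *-congˡ (*-assoc a b s) ⟩
              s * (a * (b * s))                ≈⟨ *-congˡ (*-congˡ (trans (*-congʳ ss≈1) (*-identityˡ (b * s)))) ⟨
              s * (a * ((s * s) * (b * s)))    ≈⟨ *-congˡ (*-congˡ (*-assoc s s (b * s))) ⟩
              s * (a * (s * (s * (b * s))))    ≈⟨ *-congˡ (*-assoc a s _) ⟨
              s * ((a * s) * (s * (b * s)))    ≈⟨ *-assoc s (a * s) _ ⟨
              (s * (a * s)) * (s * (b * s))    ∎
          }
        ; 1#-homo = trans (*-congˡ (*-identityˡ s)) ss≈1
        }
      ; -‿homo = λ a → trans (*-congˡ (sym (-‿distribˡ-* a s))) (sym (-‿distribʳ-* s (a * s)))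
      }
    ; ·-homo = λ α a → trans (*-congˡ (·-*-assoc α a s)) (*-·-comm α s (a * s))
    ; ⋆-homo = λ a → begin
        s * (a ⋆ * s)                ≈⟨ *-assoc s (a ⋆) s ⟨
        (s * a ⋆) * s                ≈⟨ *-cong (*-congʳ s⋆≈s) s⋆≈s ⟨
        (s ⋆ * a ⋆) * s ⋆            ≈⟨ *-congʳ (⋆-*-anti a s) ⟨
        (a * s) ⋆ * s ⋆              ≈⟨ ⋆-*-anti s (a * s) ⟨
        (s * (a * s)) ⋆              ∎
    }

module _ {c ℓ m n} {arity : Fin n → ℕ} {H : Family m arity} (Q : Qut c ℓ H) where
  open Qut Q using (algebra; u; unique)
  open C*Algebra algebra
  open CStar algebra
  open Automorphism algebra
  open IsLeftModule isLeftModule using (*ₗ-congˡ)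
  open RingProperties ring
  open SetoidReasoning setoid

  -- Conjugation by the symmetry 1 - 2p fixes the generators, hence everything.
  commutes-with-generators⇒central : ∀ {p} → IsProjection p →
    (∀ x y → p * u x y ≈ u x y * p) → ∀ a → p * a ≈ a * p
  commutes-with-generators⇒central {p} p-proj comm a = begin
    p * a                          ≈⟨ halve (p * a) ⟩
    -- Commutation of a with 1 - 2p only gives 2pa = 2ap, and the scalar ½ removes the factor.
    ι ½ · (p * a + p * a)          ≈⟨ *ₗ-congˡ (-‿injective (+-cancelˡ a _ _ cancelled)) ⟩
    ι ½ · (a * p + a * p)          ≈⟨ halve (a * p) ⟨
    a * p                          ∎
    where
    s = 1# - (p + p)
    s⋆ = proj₁ (projection-symmetry p-proj)
    ss = proj₂ (projection-symmetry p-proj)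
    left : ∀ b → s * b ≈ b - (p * b + p * b)
    left b = trans (distribʳ b 1# _) (+-cong (*-identityˡ b) (trans (sym (-‿distribˡ-* (p + p) b)) (-‿cong (distribʳ b p p))))
    right : ∀ b → b * s ≈ b - (b * p + b * p)
    right b = trans (distribˡ b 1# _) (+-cong (*-identityʳ b) (trans (sym (-‿distribʳ-* b (p + p))) (-‿cong (distribˡ b p p))))
    fixed : ∀ {b} → b * s ≈ s * b → s * (b * s) ≈ b
    fixed {b} bs≈sb = trans (*-congˡ bs≈sb) (trans (sym (*-assoc s s b)) (trans (*-congʳ ss) (*-identityˡ b)))
    conjugated : s * (a * s) ≈ a
    conjugated = unique algebra (conjugation s s⋆ ss) idHom (λ x y → fixed (trans (right (u x y))
      (trans (+-congˡ (-‿cong (sym (+-cong (comm x y) (comm x y))))) (sym (left (u x y)))))) a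
    cancelled : a - (p * a + p * a) ≈ a - (a * p + a * p)
    cancelled = begin
      a - (p * a + p * a)          ≈⟨ left a ⟨
      s * a                        ≈⟨ *-congˡ conjugated ⟨
      s * (s * (a * s))            ≈⟨ *-assoc s s _ ⟨
      (s * s) * (a * s)            ≈⟨ trans (*-congʳ ss) (*-identityˡ _) ⟩
      a * s                        ≈⟨ right a ⟩
      a - (a * p + a * p)          ∎

-- Sums over tuples and direct sums of constraints

module TupleSum {c ℓ} (M : CommutativeMonoid c ℓ) where
  open CommutativeMonoid M using (Carrier; _≈_; _∙_; ε; refl; sym; trans; setoid; ∙-congˡ; ∙-congʳ; assoc; identityˡ; identityʳ)
  open Sum M
  open SetoidReasoning setoid

  sum-0 : ∀ {n} {f : Fin n → Carrier} → (∀ i → f i ≈ ε) → sum f ≈ ε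
  sum-0 {n} f≈0 = trans (sum-cong-≋ f≈0) (sum-replicate-zero n)

  sum-++ : ∀ m {n} (f : Fin (m ℕ.+ n) → Carrier) → sum f ≈ sum (λ i → f (i ↑ˡ n)) ∙ sum (λ j → f (m ↑ʳ j))
  sum-++ zero    f = sym (identityˡ _)
  sum-++ (suc m) f = trans (∙-congˡ (sum-++ m (f ∘ suc))) (sym (assoc _ _ _))

  sum-only : ∀ {n} {f : Fin n → Carrier} i → (∀ {j} → i ≢ j → f j ≈ ε) → sum f ≈ f i
  sum-only {f = f} zero    f≈0 = trans (∙-congˡ (sum-0 {f = f ∘ suc} λ j → f≈0 λ ())) (identityʳ (f zero))
  sum-only {f = f} (suc i) f≈0 = trans (trans (∙-congʳ (f≈0 λ ())) (identityˡ _)) (sum-only {f = f ∘ suc} i λ i≢j → f≈0 λ { ≡.refl → i≢j ≡.refl })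

  tupleSum-cong : ∀ {m} k {f g : Vec (Fin m) k → Carrier} → (∀ x → f x ≈ g x) → tupleSum M k f ≈ tupleSum M k g
  tupleSum-cong zero    f≈g = f≈g []
  tupleSum-cong (suc k) f≈g = sum-cong-≋ λ i → tupleSum-cong k λ x → f≈g (i ∷ x)

  tupleSum-0 : ∀ {m} k {f : Vec (Fin m) k → Carrier} → (∀ x → f x ≈ ε) → tupleSum M k f ≈ ε
  tupleSum-0 zero    f≈0 = f≈0 []
  tupleSum-0 (suc k) f≈0 = sum-0 λ i → tupleSum-0 k λ x → f≈0 (i ∷ x)

  tupleSum-sum-comm : ∀ {m n} k (f : Fin n → Vec (Fin m) k → Carrier) →
    tupleSum M k (λ x → sum λ i → f i x) ≈ sum λ i → tupleSum M k (f i)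
  tupleSum-sum-comm zero    f = refl
  tupleSum-sum-comm (suc k) f = trans (sum-cong-≋ λ j → tupleSum-sum-comm k λ i x → f i (j ∷ x)) (∑-comm (λ j i → tupleSum M k λ x → f i (j ∷ x)))

  -- `Outside` stands for the complement of the image of `e`. Keeping both abstract lets the two
  -- halves of `Fin (m + n)` share one induction.
  tupleSum-embed : ∀ {m N} (e : Fin m → Fin N) (Outside : Fin N → Set) →
    (∀ (f : Fin N → Carrier) → (∀ {i} → Outside i → f i ≈ ε) → sum f ≈ sum (f ∘ e)) →
    ∀ k (f : Vec (Fin N) k → Carrier) → (∀ {x} → Any Outside x → f x ≈ ε) →
    tupleSum M k f ≈ tupleSum M k (f ∘ Vec.map e)
  tupleSum-embed e Outside sum-embed zero    f f≈0 = refl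
  tupleSum-embed e Outside sum-embed (suc k) f f≈0 = trans
    (sum-embed (λ i → tupleSum M k λ x → f (i ∷ x)) λ out → tupleSum-0 k λ x → f≈0 (here out))
    (sum-cong-≋ λ i → tupleSum-embed e Outside sum-embed k (λ x → f (e i ∷ x)) (f≈0 ∘ there))

Left Right : ∀ m n → Fin (m ℕ.+ n) → Set
Left  m n v = ∃ λ x → v ≡ x ↑ˡ n
Right m n v = ∃ λ y → v ≡ m ↑ʳ y

module _ {c ℓ} (M : CommutativeMonoid c ℓ) where
  open CommutativeMonoid M using (Carrier; _≈_; ε; trans; ∙-congˡ; ∙-congʳ; identityˡ; identityʳ)
  open Sum M
  open TupleSum M

  tupleSum-left : ∀ {m n} k (f : Vec (Fin (m ℕ.+ n)) k → Carrier) → (∀ {x} → Any (Right m n) x → f x ≈ ε) →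
    tupleSum M k f ≈ tupleSum M k (f ∘ Vec.map (_↑ˡ n))
  tupleSum-left {m} {n} = tupleSum-embed (_↑ˡ n) (Right m n) λ f f≈0 →
    trans (sum-++ m f) (trans (∙-congˡ (sum-0 λ y → f≈0 (y , ≡.refl))) (identityʳ _))

  tupleSum-right : ∀ {m n} k (f : Vec (Fin (m ℕ.+ n)) k → Carrier) → (∀ {x} → Any (Left m n) x → f x ≈ ε) →
    tupleSum M k f ≈ tupleSum M k (f ∘ Vec.map (m ↑ʳ_))
  tupleSum-right {m} {n} = tupleSum-embed (m ↑ʳ_) (Left m n) λ f f≈0 →
    trans (sum-++ m f) (trans (∙-congʳ (sum-0 λ x → f≈0 (x , ≡.refl))) (identityˡ _))

any-last : ∀ {A : Set} {P : A → Set} {k} (xs : Vec A k) {x} → P x → Any P (xs ∷ʳ x)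
any-last []       px = here px
any-last (_ ∷ xs) px = there (any-last xs px)

any-init : ∀ {A : Set} {P : A → Set} {k} {xs : Vec A k} {x} → Any P xs → Any P (xs ∷ʳ x)
any-init (here px)   = here px
any-init (there pxs) = there (any-init pxs)

map-∷ʳ² : ∀ {A B : Set} (f : A → B) {k} (xs : Vec A k) x y → Vec.map f (xs ∷ʳ x ∷ʳ y) ≡ Vec.map f xs ∷ʳ f x ∷ʳ f y
map-∷ʳ² f xs x y = ≡.trans (map-∷ʳ f y (xs ∷ʳ x)) (≡.cong (_∷ʳ f y) (map-∷ʳ f x xs))

open TraversableA (applicative {0ℓ}) using (mapA)

mapA-just : ∀ {A B C : Set} {f : A → Maybe B} {e : C → A} {g : C → B} → (∀ z → f (e z) ≡ just (g z)) →
            ∀ {k} (xs : Vec C k) → mapA f (Vec.map e xs) ≡ just (Vec.map g xs)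
mapA-just f∘e []       = ≡.refl
mapA-just {f = f} {e} {g} f∘e (x ∷ xs) rewrite f∘e x | mapA-just {f = f} {e} {g} f∘e xs = ≡.refl

mapA-nothing : ∀ {A B : Set} {f : A → Maybe B} {k} {xs : Vec A k} → Any (λ x → f x ≡ nothing) xs → mapA f xs ≡ nothing
mapA-nothing (here fx) rewrite fx = ≡.refl
mapA-nothing {f = f} {xs = x ∷ xs} (there fxs) rewrite mapA-nothing {f = f} fxs with f x
... | just _  = ≡.refl
... | nothing = ≡.refl

module _ {m n k} (F : Constraint m k) (G : Constraint n k) where

  toLeft : Vec (Fin (m ℕ.+ n)) k → Maybe (Vec (Fin m) k)
  toLeft = mapA (isInj₁ ∘ splitAt m)

  toRight : Vec (Fin (m ℕ.+ n)) k → Maybe (Vec (Fin n) k)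
  toRight = mapA (isInj₂ ∘ splitAt m)

  toLeft-right : ∀ {x} → Any (Right m n) x → toLeft x ≡ nothing
  toLeft-right any = mapA-nothing (Any.map (λ { (y , ≡.refl) → ≡.cong isInj₁ (splitAt-↑ʳ m n y) }) any)

  toRight-left : ∀ {x} → Any (Left m n) x → toRight x ≡ nothing
  toRight-left any = mapA-nothing (Any.map (λ { (y , ≡.refl) → ≡.cong isInj₂ (splitAt-↑ˡ m y n) }) any)

  blockSum-left : ∀ x → blockSum F G (Vec.map (_↑ˡ n) x) ≡ F x
  blockSum-left x = ≡.trans
    (≡.cong (maybe′ F (maybe′ G 0ᶜ (toRight (Vec.map (_↑ˡ n) x)))) (mapA-just (λ z → ≡.cong isInj₁ (splitAt-↑ˡ m z n)) x))
    (≡.cong F (map-id x))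

  -- The hypothesis excludes the empty tuple, which lies in both halves and is read by `blockSum` as
  -- a left one.
  blockSum-right : ∀ {x} → Any (Right m n) (Vec.map (m ↑ʳ_) x) → blockSum F G (Vec.map (m ↑ʳ_) x) ≡ G x
  blockSum-right {x} any = ≡.trans
    (≡.cong₂ (λ l r → maybe′ F (maybe′ G 0ᶜ r) l) (toLeft-right any) (mapA-just (λ z → ≡.cong isInj₂ (splitAt-↑ʳ m n z)) x))
    (≡.cong G (map-id x))

  blockSum-mixed : ∀ {x} → Any (Left m n) x → Any (Right m n) x → blockSum F G x ≡ 0ᶜ
  blockSum-mixed l r = ≡.cong₂ (λ l r → maybe′ F (maybe′ G 0ᶜ r) l) (toLeft-right r) (toRight-left l)

-- Definitionally the matrix inside `ProjectivelyConnected`, so that the connectedness hypotheses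
-- apply to it directly.
marginal : ∀ {m k} → Constraint m (suc (suc k)) → Fin m → Fin m → ℂ
marginal {k = k} F u v = tupleSum ℂ′.+-commutativeMonoid k λ x → F (x ∷ʳ u ∷ʳ v)

module _ {m n k} (F : Constraint m (suc (suc k))) (G : Constraint n (suc (suc k))) where
  open ℂ′ using (+-commutativeMonoid; reflexive; trans)
  open TupleSum +-commutativeMonoid

  marginal-left : ∀ u v → marginal (blockSum F G) (u ↑ˡ n) (v ↑ˡ n) ≈ᶜ marginal F u v
  marginal-left u v = trans
    (tupleSum-left +-commutativeMonoid k _ λ {x} out → reflexive
      (blockSum-mixed F G (any-last (x ∷ʳ (u ↑ˡ n)) (v , ≡.refl)) (any-init (any-init out))))
    (tupleSum-cong k λ x → reflexive (≡.trans (≡.cong (blockSum F G) (≡.sym (map-∷ʳ² (_↑ˡ n) x u v)))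
      (blockSum-left F G (x ∷ʳ u ∷ʳ v))))

  marginal-right : ∀ u v → marginal (blockSum F G) (m ↑ʳ u) (m ↑ʳ v) ≈ᶜ marginal G u v
  marginal-right u v = trans
    (tupleSum-right +-commutativeMonoid k _ λ {x} out → reflexive
      (blockSum-mixed F G (any-init (any-init out)) (any-last (x ∷ʳ (m ↑ʳ u)) (v , ≡.refl))))
    (tupleSum-cong k λ x → reflexive (≡.trans (≡.cong (blockSum F G) (≡.sym (map-∷ʳ² (m ↑ʳ_) x u v)))
      (blockSum-right F G {x ∷ʳ u ∷ʳ v}
        (≡.subst (Any (Right m n)) (≡.sym (map-∷ʳ² (m ↑ʳ_) x u v)) (any-last (Vec.map (m ↑ʳ_) x ∷ʳ (m ↑ʳ u)) (v , ≡.refl))))))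

  marginal-mixed : ∀ u v → marginal (blockSum F G) (u ↑ˡ n) (m ↑ʳ v) ≈ᶜ 0ᶜ
  marginal-mixed u v = tupleSum-0 k λ x → reflexive (blockSum-mixed F G
    (any-init (any-last x (u , ≡.refl))) (any-last (x ∷ʳ (u ↑ˡ n)) (v , ≡.refl)))

  marginal-mixed′ : ∀ u v → marginal (blockSum F G) (m ↑ʳ u) (v ↑ˡ n) ≈ᶜ 0ᶜ
  marginal-mixed′ u v = tupleSum-0 k λ x → reflexive (blockSum-mixed F G
    (any-last (x ∷ʳ (m ↑ʳ u)) (v , ≡.refl)) (any-init (any-last x (u , ≡.refl))))

-- Quantum permutations fixing a direct sum

-- Allows finitely many undecidable case distinctions to be made at once, under one double negation.
¬¬-sequence : ∀ {ℓ n} {P : Fin n → Set ℓ} → (∀ i → ¬ ¬ P i) → ¬ ¬ (∀ i → P i)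
¬¬-sequence = sequence (RawMonad.rawApplicative ¬¬-Monad)

module Intertwiner {c ℓ} (A : C*Algebra c ℓ) where
  open C*Algebra A hiding (zero)
  open CStar A
  open IsLeftModule isLeftModule using (*ₗ-cong; *ₗ-congˡ; *ₗ-congʳ; *ₗ-zeroˡ; *ₗ-zeroʳ; *ₗ-distribʳ)
  open RingProperties ring
  open SetoidReasoning setoid
  open import Algebra.Properties.Semiring.Sum semiring
  open TupleSum +-commutativeMonoid

  private
    ⨁ : ∀ {m} k → (Vec (Fin m) k → Carrier) → Carrier
    ⨁ = tupleSum +-commutativeMonoid

  *-scalar : ∀ a α → a * (α · 1#) ≈ α · a
  *-scalar a α = trans (*-·-comm α a 1#) (*ₗ-congˡ (*-identityʳ a))

  *-distribˡ-tupleSum : ∀ {m} k a (f : Vec (Fin m) k → Carrier) →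
    a * ⨁ k f ≈ ⨁ k (λ x → a * f x)
  *-distribˡ-tupleSum zero    a f = refl
  *-distribˡ-tupleSum (suc k) a f = trans (*-distribˡ-sum a λ i → ⨁ k λ x → f (i ∷ x)) (sum-cong-≋ λ i → *-distribˡ-tupleSum k a λ x → f (i ∷ x))

  sum-scalar : ∀ {n} (f : Fin n → ℂ) → sum (λ i → f i · 1#) ≈ Sum.sum ℂ′.+-commutativeMonoid f · 1#
  sum-scalar {zero}  f = sym (*ₗ-zeroˡ 1#)
  sum-scalar {suc n} f = trans (+-congˡ (sum-scalar (f ∘ suc))) (sym (*ₗ-distribʳ 1# _ _))

  tupleSum-scalar : ∀ {m} k (f : Vec (Fin m) k → ℂ) →
    ⨁ k (λ x → f x · 1#) ≈ tupleSum ℂ′.+-commutativeMonoid k f · 1#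
  tupleSum-scalar zero    f = refl
  tupleSum-scalar (suc k) f = trans (sum-cong-≋ λ i → tupleSum-scalar k λ x → f (i ∷ x)) (sum-scalar λ i → tupleSum ℂ′.+-commutativeMonoid k λ x → f (i ∷ x))

  -- Summing the first row index over its whole range replaces the first tensor factor by a column
  -- sum, which is 1. The constraint with its first argument fixed to `y₀` then goes to the
  -- induction hypothesis, and only the last two factors survive.
  contract : ∀ {n m} {u : Fin n → Fin m → Carrier} → (∀ y → sum (λ x → u x y) ≈ 1#) →
    ∀ k (φ : Vec (Fin m) (suc (suc k)) → Carrier) a c →
    ⨁ k (λ x → ⨁ (suc (suc k)) λ y → tensorPower A u (x ∷ʳ a ∷ʳ c) y * φ y) ≈
    sum λ b → sum λ d → (u a b * u c d) * ⨁ k λ x → φ (x ∷ʳ b ∷ʳ d)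
  contract {u = u} colSum zero φ a c = sum-cong-≋ λ b → sum-cong-≋ λ d → *-cong (*-cong (refl {u a b}) (*-identityʳ (u c d))) (refl {φ (b ∷ d ∷ [])})
  contract {u = u} colSum (suc k) φ a c = begin
    (sum λ x₀ → ⨁ k λ x → sum λ y₀ → ⨁ (suc (suc k)) λ y →
      (u x₀ y₀ * tensorPower A u (x ∷ʳ a ∷ʳ c) y) * φ (y₀ ∷ y))
      ≈⟨ sum-cong-≋ (λ x₀ → tupleSum-sum-comm k λ y₀ x → ⨁ (suc (suc k)) λ y →
           (u x₀ y₀ * tensorPower A u (x ∷ʳ a ∷ʳ c) y) * φ (y₀ ∷ y)) ⟩
    (sum λ x₀ → sum λ y₀ → ⨁ k λ x → ⨁ (suc (suc k)) λ y →
      (u x₀ y₀ * tensorPower A u (x ∷ʳ a ∷ʳ c) y) * φ (y₀ ∷ y))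
      ≈⟨ sum-cong-≋ (λ x₀ → sum-cong-≋ λ y₀ → factor (u x₀ y₀) y₀) ⟩
    (sum λ x₀ → sum λ y₀ → u x₀ y₀ * T y₀)
      ≈⟨ ∑-comm (λ x₀ y₀ → u x₀ y₀ * T y₀) ⟩
    (sum λ y₀ → sum λ x₀ → u x₀ y₀ * T y₀)
      ≈⟨ sum-cong-≋ (λ y₀ → *-distribʳ-sum (T y₀) (λ x₀ → u x₀ y₀)) ⟨
    (sum λ y₀ → sum (λ x₀ → u x₀ y₀) * T y₀)
      ≈⟨ sum-cong-≋ (λ y₀ → trans (*-congʳ (colSum y₀)) (*-identityˡ (T y₀))) ⟩
    (sum λ y₀ → T y₀)
      ≈⟨ sum-cong-≋ (λ y₀ → contract colSum k (λ y → φ (y₀ ∷ y)) a c) ⟩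
    (sum λ y₀ → sum λ b → sum λ d → (u a b * u c d) * Φ y₀ b d)
      ≈⟨ ∑-comm (λ y₀ b → sum λ d → (u a b * u c d) * Φ y₀ b d) ⟩
    (sum λ b → sum λ y₀ → sum λ d → (u a b * u c d) * Φ y₀ b d)
      ≈⟨ sum-cong-≋ (λ b → ∑-comm (λ y₀ d → (u a b * u c d) * Φ y₀ b d)) ⟩
    (sum λ b → sum λ d → sum λ y₀ → (u a b * u c d) * Φ y₀ b d)
      ≈⟨ sum-cong-≋ (λ b → sum-cong-≋ λ d → *-distribˡ-sum (u a b * u c d) (λ y₀ → Φ y₀ b d)) ⟨
    (sum λ b → sum λ d → (u a b * u c d) * sum λ y₀ → Φ y₀ b d) ∎
    where
    Φ = λ y₀ b d → ⨁ k λ x → φ (y₀ ∷ (x ∷ʳ b ∷ʳ d))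
    T = λ y₀ → ⨁ k λ x → ⨁ (suc (suc k)) λ y →
      tensorPower A u (x ∷ʳ a ∷ʳ c) y * φ (y₀ ∷ y)
    factor : ∀ v y₀ → ⨁ k (λ x → ⨁ (suc (suc k)) λ y →
      (v * tensorPower A u (x ∷ʳ a ∷ʳ c) y) * φ (y₀ ∷ y)) ≈ v * T y₀
    factor v y₀ = trans
      (tupleSum-cong k λ x → trans (tupleSum-cong (suc (suc k)) λ y → *-assoc v (tensorPower A u (x ∷ʳ a ∷ʳ c) y) (φ (y₀ ∷ y)))
        (sym (*-distribˡ-tupleSum (suc (suc k)) v λ y → tensorPower A u (x ∷ʳ a ∷ʳ c) y * φ (y₀ ∷ y))))
      (sym (*-distribˡ-tupleSum k v λ x → ⨁ (suc (suc k)) λ y → tensorPower A u (x ∷ʳ a ∷ʳ c) y * φ (y₀ ∷ y)))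

  module Magic {n m} {u : Fin n → Fin m → Carrier} (u-magic : IsQuantumPermutation A u) where
    open IsQuantumPermutation u-magic

    projection : ∀ x y → IsProjection (u x y)
    projection x y = idempotent x y , selfAdjoint x y

    row-orthogonal : ∀ x {y y′} → y ≢ y′ → u x y * u x y′ ≈ 0#
    row-orthogonal x = orthogonal (u x) (projection x) (rowSum x)

    column-orthogonal : ∀ y {x x′} → x ≢ x′ → u x y * u x′ y ≈ 0#
    column-orthogonal y = orthogonal (λ x → u x y) (λ x → projection x y) (columnSum y)

    row-commute : ∀ x y y′ → u x y * u x y′ ≈ u x y′ * u x y
    row-commute x y y′ with y ≟ y′
    ... | yes ≡.refl = refl
    ... | no  y≢y′   = trans (row-orthogonal x y≢y′) (sym (row-orthogonal x λ eq → y≢y′ (≡.sym eq)))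

    -- Summing the first k arguments out of u^{⊗(k+2)} f = g leaves u X uᵀ = Y for the
    -- marginals X and Y; sandwiching between u a b and u c d isolates one entry.
    marginal-intertwines : ∀ {k} (f : Constraint m (suc (suc k))) (g : Constraint n (suc (suc k))) → Transports A u f g →
      ∀ a b c d → marginal f b d · (u a b * u c d) ≈ marginal g a c · (u a b * u c d)
    marginal-intertwines {k} f g fg a b c d = begin
      X b d · (u a b * u c d)
        ≈⟨ *ₗ-congˡ (*-cong (idempotent a b) (idempotent c d)) ⟨
      h b d
        ≈⟨ sum-only {f = h b} d (λ d≢ → trans (*ₗ-congˡ (trans (*-congˡ (row-orthogonal c λ eq → d≢ (≡.sym eq))) (zeroʳ _))) (*ₗ-zeroʳ _)) ⟨
      sum (h b)
        ≈⟨ sum-only {f = λ b′ → sum (h b′)} b (λ {b′} b≢ → sum-0 {f = h b′} λ d′ → trans (*ₗ-congˡ (trans (*-congʳ (row-orthogonal a b≢)) (zeroˡ _))) (*ₗ-zeroʳ _)) ⟨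
      (sum λ b′ → sum λ d′ → h b′ d′)
        ≈⟨ sum-cong-≋ (λ b′ → sum-cong-≋ λ d′ → sandwich b′ d′) ⟨
      (sum λ b′ → sum λ d′ → u a b * (((u a b′ * u c d′) * Φ b′ d′) * u c d))
        ≈⟨ sum-cong-≋ (λ b′ → trans (sym (*-distribˡ-sum (u a b) λ d′ → ((u a b′ * u c d′) * Φ b′ d′) * u c d))
             (*-congˡ (sym (*-distribʳ-sum (u c d) λ d′ → (u a b′ * u c d′) * Φ b′ d′)))) ⟩
      (sum λ b′ → u a b * (sum (λ d′ → (u a b′ * u c d′) * Φ b′ d′) * u c d))
        ≈⟨ trans (sym (*-distribˡ-sum (u a b) λ b′ → sum (λ d′ → (u a b′ * u c d′) * Φ b′ d′) * u c d))
             (*-congˡ (sym (*-distribʳ-sum (u c d) λ b′ → sum λ d′ → (u a b′ * u c d′) * Φ b′ d′))) ⟩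
      u a b * ((sum λ b′ → sum λ d′ → (u a b′ * u c d′) * Φ b′ d′) * u c d)
        ≈⟨ *-congˡ (*-congʳ (contract columnSum k (λ y → f y · 1#) a c)) ⟨
      u a b * (⨁ k (λ x → ⨁ (suc (suc k)) λ y → tensorPower A u (x ∷ʳ a ∷ʳ c) y * (f y · 1#)) * u c d)
        ≈⟨ *-congˡ (*-congʳ (trans (tupleSum-cong k λ x → fg (x ∷ʳ a ∷ʳ c)) (tupleSum-scalar k λ x → g (x ∷ʳ a ∷ʳ c)))) ⟩
      u a b * ((marginal g a c · 1#) * u c d)
        ≈⟨ *-congˡ (trans (·-*-assoc _ 1# (u c d)) (*ₗ-congˡ (*-identityˡ (u c d)))) ⟩
      u a b * (marginal g a c · u c d)
        ≈⟨ *-·-comm _ (u a b) (u c d) ⟩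
      marginal g a c · (u a b * u c d) ∎
      where
      X = marginal f
      Φ = λ b′ d′ → ⨁ k λ x → f (x ∷ʳ b′ ∷ʳ d′) · 1#
      h : Fin m → Fin m → Carrier
      h b′ d′ = X b′ d′ · ((u a b * u a b′) * (u c d′ * u c d))
      sandwich : ∀ b′ d′ → u a b * (((u a b′ * u c d′) * Φ b′ d′) * u c d) ≈ h b′ d′
      sandwich b′ d′ = begin
        u a b * (((u a b′ * u c d′) * Φ b′ d′) * u c d)
          ≈⟨ *-congˡ (*-congʳ (trans (*-congˡ (tupleSum-scalar k λ x → f (x ∷ʳ b′ ∷ʳ d′))) (*-scalar _ _))) ⟩
        u a b * ((X b′ d′ · (u a b′ * u c d′)) * u c d)
          ≈⟨ trans (*-congˡ (·-*-assoc _ _ _)) (*-·-comm _ _ _) ⟩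
        X b′ d′ · (u a b * ((u a b′ * u c d′) * u c d))
          ≈⟨ *ₗ-congˡ (trans (*-congˡ (*-assoc _ _ _)) (sym (*-assoc _ _ _))) ⟩
        h b′ d′ ∎

    -- With one of the two marginal entries zero, the intertwining equation says that a nonzero
    -- scalar times the product vanishes.
    marginal-separatesˡ : ∀ {k} (f : Constraint m (suc (suc k))) (g : Constraint n (suc (suc k))) → Transports A u f g →
      ∀ {a b c d} → ¬ marginal f b d ≈ᶜ 0ᶜ → marginal g a c ≈ᶜ 0ᶜ → u a b * u c d ≈ 0#
    marginal-separatesˡ f g fg {a} {b} {c} {d} X≉0 Y≈0 = ·-cancel X≉0
      (trans (marginal-intertwines f g fg a b c d) (trans (*ₗ-congʳ Y≈0) (*ₗ-zeroˡ _)))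

    marginal-separatesʳ : ∀ {k} (f : Constraint m (suc (suc k))) (g : Constraint n (suc (suc k))) → Transports A u f g →
      ∀ {a b c d} → marginal f b d ≈ᶜ 0ᶜ → ¬ marginal g a c ≈ᶜ 0ᶜ → u a b * u c d ≈ 0#
    marginal-separatesʳ f g fg {a} {b} {c} {d} X≈0 Y≉0 = ·-cancel Y≉0
      (trans (sym (marginal-intertwines f g fg a b c d)) (trans (*ₗ-congʳ X≈0) (*ₗ-zeroˡ _)))

  -- If `P x` and `P x′` differed, the level set of `P` through `x` and its complement would
  -- disconnect `X`. To be a `Subset`, the level set needs equality of values decided, which
  -- stability of the goal permits.
  connected⇒constant : ∀ {m} {X : Fin m → Fin m → ℂ} → Connected X → (P : Fin m → Carrier) →
    (∀ {x x′} → ¬ X x x′ ≈ᶜ 0ᶜ → P x ≈ P x′) → ∀ x x′ → P x ≈ P x′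
  connected⇒constant {m} {X} connected P edge x x′ = ≈-stable λ Px≉Px′ →
    ¬¬-sequence (λ y → ¬¬-excluded-middle {A = P x ≈ P y}) λ dec → connected (disconnection dec Px≉Px′)
    where
    disconnection : (∀ y → Dec (P x ≈ P y)) → ¬ P x ≈ P x′ → Disconnected X
    disconnection dec Px≉Px′ = I , ∁ I , (x , in-I refl) , (x′ , x∉p⇒x∈∁p (Px≉Px′ ∘ from-I)) , p∪∁p≡⊤ I , ∩-inverseʳ I , separated
      where
      I : Subset m
      I = Vec.tabulate (does ∘ dec)
      in-I : ∀ {y} → P x ≈ P y → y ∈ I
      in-I {y} eq = lookup⇒[]= y I (≡.trans (lookup∘tabulate (does ∘ dec) y) (dec-true (dec y) eq))
      from-I : ∀ {y} → y ∈ I → P x ≈ P y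
      from-I {y} y∈I with dec y | ≡.trans (≡.sym (lookup∘tabulate (does ∘ dec) y)) ([]=⇒lookup y∈I)
      ... | yes eq | _ = eq
      ... | no  _  | ()
      separated : ∀ v w → ¬ ((v ∈ I × w ∈ I) ⊎ (v ∈ ∁ I × w ∈ ∁ I)) → X v w ≈ᶜ 0ᶜ
      separated v w apart = ≈ᶜ0-stable λ Xvw≉0 → apart (same (edge Xvw≉0) (v ∈? I))
        where
        same : P v ≈ P w → Dec (v ∈ I) → _
        same Pv≈Pw (yes v∈I) = inj₁ (v∈I , in-I (trans (from-I v∈I) Pv≈Pw))
        same Pv≈Pw (no  v∉I) = inj₂ (x∉p⇒x∈∁p v∉I , x∉p⇒x∈∁p λ w∈I → v∉I (in-I (trans (from-I w∈I) (sym Pv≈Pw))))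

  -- Write P and P′ for the sums of the two parts of a row. On an edge the mixed products vanish, so
  -- P x = P x (P x′ + P′ x′) = P x P x′ = (P x + P′ x) P x′ = P x′. With `w` transposed, the same
  -- lemma handles columns.
  blockSums-constant : ∀ {m a b} {X : Fin m → Fin m → ℂ} → Connected X →
    (w : Fin m → Fin a → Carrier) (w′ : Fin m → Fin b → Carrier) → (∀ x → sum (w x) + sum (w′ x) ≈ 1#) →
    (∀ {x x′} → ¬ X x x′ ≈ᶜ 0ᶜ → ∀ y y′ → w x y * w′ x′ y′ ≈ 0#) →
    (∀ {x x′} → ¬ X x x′ ≈ᶜ 0ᶜ → ∀ y y′ → w′ x y′ * w x′ y ≈ 0#) →
    ∀ x x′ → sum (w x) ≈ sum (w x′)
  blockSums-constant {X = X} connected w w′ total ww′≈0 w′w≈0 = connected⇒constant connected P edge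
    where
    P = λ x → sum (w x)
    P′ = λ x → sum (w′ x)
    product≈0 : ∀ {a b} (f : Fin a → Carrier) (g : Fin b → Carrier) → (∀ i j → f i * g j ≈ 0#) → sum f * sum g ≈ 0#
    product≈0 f g fg≈0 = trans (*-distribʳ-sum (sum g) f) (sum-0 {f = λ i → f i * sum g} λ i → trans (*-distribˡ-sum (f i) g) (sum-0 {f = λ j → f i * g j} (fg≈0 i)))
    edge : ∀ {x x′} → ¬ X x x′ ≈ᶜ 0ᶜ → P x ≈ P x′
    edge {x} {x′} X≉0 = begin
      P x                            ≈⟨ *-identityʳ (P x) ⟨
      P x * 1#                       ≈⟨ *-congˡ (total x′) ⟨
      P x * (P x′ + P′ x′)           ≈⟨ distribˡ _ _ _ ⟩
      P x * P x′ + P x * P′ x′       ≈⟨ +-congˡ (trans (product≈0 (w x) (w′ x′) (ww′≈0 X≉0))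
                                          (sym (product≈0 (w′ x) (w x′) λ y′ y → w′w≈0 X≉0 y y′))) ⟩
      P x * P x′ + P′ x * P x′       ≈⟨ distribʳ _ _ _ ⟨
      (P x + P′ x) * P x′            ≈⟨ *-congʳ (total x) ⟩
      1# * P x′                      ≈⟨ *-identityˡ (P x′) ⟩
      P x′                           ∎

  -- By constancy, the row sum p can be taken in the row of any entry and the column sum t in its
  -- column. Orthogonality then makes p a left unit and t a right unit for all entries, hence p = p
  -- t = t, for rectangular blocks too.
  rowSum≈columnSum : ∀ {a b} (w : Fin a → Fin b → Carrier) → (∀ x y → w x y * w x y ≈ w x y) →
    (∀ x {y y′} → y ≢ y′ → w x y * w x y′ ≈ 0#) → (∀ y {x x′} → x ≢ x′ → w x y * w x′ y ≈ 0#) →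
    (∀ x x′ → sum (w x) ≈ sum (w x′)) → (∀ y y′ → sum (λ x → w x y) ≈ sum (λ x → w x y′)) →
    ∀ x y → sum (w x) ≈ sum (λ z → w z y)
  rowSum≈columnSum w idem row col rows columns x y = begin
    p                              ≈⟨ sum-cong-≋ (λ y′ → trans (*-congˡ (columns y y′)) (trans (*-distribˡ-sum (w x y′) λ z → w z y′)
                                        (trans (sum-only {f = λ z → w x y′ * w z y′} x λ x≢ → col y′ x≢) (idem x y′)))) ⟨
    sum (λ y′ → w x y′ * t)        ≈⟨ *-distribʳ-sum t (w x) ⟨
    p * t                          ≈⟨ *-distribˡ-sum p (λ z → w z y) ⟩
    sum (λ z → p * w z y)          ≈⟨ sum-cong-≋ (λ z → trans (*-congʳ (rows x z)) (trans (*-distribʳ-sum (w z y) (w z))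
                                        (trans (sum-only {f = λ y′ → w z y′ * w z y} y λ y≢ → row z λ eq → y≢ (≡.sym eq)) (idem z y)))) ⟩
    t                              ∎
    where
    p = sum (w x)
    t = sum λ z → w z y

-- The four blocks of the fundamental matrix and their common projection

module Blocks {c ℓ} (A : C*Algebra c ℓ) {m n} {u : Fin (m ℕ.+ n) → Fin (m ℕ.+ n) → C*Algebra.Carrier A}
  (u-magic : IsQuantumPermutation A u) where
  open C*Algebra A hiding (zero)
  open CStar A
  open Intertwiner A
  open Magic u-magic
  open IsQuantumPermutation u-magic
  open RingProperties ring
  open SetoidReasoning setoid
  open import Algebra.Properties.Monoid.Mult +-monoid using () renaming (_×_ to _⨉_)
  open import Algebra.Properties.Semiring.Sum semiring
  open TupleSum +-commutativeMonoid

  uFF : Fin m → Fin m → Carrier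
  uFF x x′ = u (x ↑ˡ n) (x′ ↑ˡ n)
  uFG : Fin m → Fin n → Carrier
  uFG x y = u (x ↑ˡ n) (m ↑ʳ y)
  uGF : Fin n → Fin m → Carrier
  uGF y x = u (m ↑ʳ y) (x ↑ˡ n)
  uGG : Fin n → Fin n → Carrier
  uGG y y′ = u (m ↑ʳ y) (m ↑ʳ y′)

  left≢right : ∀ {x y} → x ↑ˡ n ≢ m ↑ʳ y
  left≢right {x} {y} eq with ≡.trans (≡.sym (splitAt-↑ˡ m x n)) (≡.trans (≡.cong (splitAt m) eq) (splitAt-↑ʳ m n y))
  ... | ()

  record UniformBlocks (p : Carrier) : Set ℓ where
    field
      rowFG    : ∀ x → sum (uFG x) ≈ p
      columnFG : ∀ y → sum (λ x → uFG x y) ≈ p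
      rowGF    : ∀ y → sum (uGF y) ≈ p
      columnGF : ∀ x → sum (λ y → uGF y x) ≈ p

  uniformBlocks : ∀ {k} {F : Constraint m k} {G : Constraint n k} → ProjectivelyConnected F → ProjectivelyConnected G →
    Transports A u (F ⊕ G) (F ⊕ G) → Fin m → Fin n → ∃ UniformBlocks
  uniformBlocks {suc (suc k)} {F} {G} F-conn G-conn fix x̂ ŷ = sum (uFG x̂) , record
    { rowFG    = λ x → FG-rows x x̂
    ; columnFG = λ y → trans (FG-columns y ŷ) (sym FG)
    ; rowGF    = λ y → trans (GF-rows y ŷ) (trans GF (sym FF))
    ; columnGF = λ x → trans (GF-columns x x̂) (sym FF)
    }
    where
    H = blockSum F G
    X≉0⇒left : ∀ {x x′} → ¬ marginal F x x′ ≈ᶜ 0ᶜ → ¬ marginal H (x ↑ˡ n) (x′ ↑ˡ n) ≈ᶜ 0ᶜ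
    X≉0⇒left X≉0 eq = X≉0 (ℂ′.trans (ℂ′.sym (marginal-left F G _ _)) eq)
    Y≉0⇒right : ∀ {y y′} → ¬ marginal G y y′ ≈ᶜ 0ᶜ → ¬ marginal H (m ↑ʳ y) (m ↑ʳ y′) ≈ᶜ 0ᶜ
    Y≉0⇒right Y≉0 eq = Y≉0 (ℂ′.trans (ℂ′.sym (marginal-right F G _ _)) eq)
    mixed : ∀ x y → marginal H (x ↑ˡ n) (m ↑ʳ y) ≈ᶜ 0ᶜ
    mixed = marginal-mixed F G
    mixed′ : ∀ y x → marginal H (m ↑ʳ y) (x ↑ˡ n) ≈ᶜ 0ᶜ
    mixed′ = marginal-mixed′ F G
    bySource : ∀ {a b c d} → ¬ marginal H b d ≈ᶜ 0ᶜ → marginal H a c ≈ᶜ 0ᶜ → u a b * u c d ≈ 0#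
    bySource = marginal-separatesˡ H H fix
    byTarget : ∀ {a b c d} → marginal H b d ≈ᶜ 0ᶜ → ¬ marginal H a c ≈ᶜ 0ᶜ → u a b * u c d ≈ 0#
    byTarget = marginal-separatesʳ H H fix
    rowTotal : ∀ a → sum (λ x → u a (x ↑ˡ n)) + sum (λ y → u a (m ↑ʳ y)) ≈ 1#
    rowTotal a = trans (sym (sum-++ m (u a))) (rowSum a)
    columnTotal : ∀ b → sum (λ x → u (x ↑ˡ n) b) + sum (λ y → u (m ↑ʳ y) b) ≈ 1#
    columnTotal b = trans (sym (sum-++ m λ a → u a b)) (columnSum b)
    -- Row sums compare rows joined by an edge, with columns in different halves, so they use
    -- `byTarget`. Column sums exchange the roles and use `bySource`.
    FG-rows : ∀ x x′ → sum (uFG x) ≈ sum (uFG x′)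
    FG-rows = blockSums-constant F-conn uFG uFF (λ x → trans (+-comm _ _) (rowTotal (x ↑ˡ n)))
      (λ X≉0 y x → byTarget (mixed′ y x) (X≉0⇒left X≉0)) (λ X≉0 y x → byTarget (mixed x y) (X≉0⇒left X≉0))
    FF-rows : ∀ x x′ → sum (uFF x) ≈ sum (uFF x′)
    FF-rows = blockSums-constant F-conn uFF uFG (λ x → rowTotal (x ↑ˡ n))
      (λ X≉0 x y → byTarget (mixed x y) (X≉0⇒left X≉0)) (λ X≉0 x y → byTarget (mixed′ y x) (X≉0⇒left X≉0))
    GF-rows : ∀ y y′ → sum (uGF y) ≈ sum (uGF y′)
    GF-rows = blockSums-constant G-conn uGF uGG (λ y → rowTotal (m ↑ʳ y))
      (λ Y≉0 x y → byTarget (mixed x y) (Y≉0⇒right Y≉0)) (λ Y≉0 x y → byTarget (mixed′ y x) (Y≉0⇒right Y≉0))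
    FG-columns : ∀ y y′ → sum (λ x → uFG x y) ≈ sum (λ x → uFG x y′)
    FG-columns = blockSums-constant G-conn (λ y x → uFG x y) (λ y y′ → uGG y′ y) (λ y → columnTotal (m ↑ʳ y))
      (λ Y≉0 x y → bySource (Y≉0⇒right Y≉0) (mixed x y)) (λ Y≉0 x y → bySource (Y≉0⇒right Y≉0) (mixed′ y x))
    FF-columns : ∀ x x′ → sum (λ z → uFF z x) ≈ sum (λ z → uFF z x′)
    FF-columns = blockSums-constant F-conn (λ x z → uFF z x) (λ x y → uGF y x) (λ x → columnTotal (x ↑ˡ n))
      (λ X≉0 x y → bySource (X≉0⇒left X≉0) (mixed x y)) (λ X≉0 x y → bySource (X≉0⇒left X≉0) (mixed′ y x))
    GF-columns : ∀ x x′ → sum (λ y → uGF y x) ≈ sum (λ y → uGF y x′)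
    GF-columns = blockSums-constant F-conn (λ x y → uGF y x) (λ x z → uFF z x) (λ x → trans (+-comm _ _) (columnTotal (x ↑ˡ n)))
      (λ X≉0 y x → bySource (X≉0⇒left X≉0) (mixed′ y x)) (λ X≉0 y x → bySource (X≉0⇒left X≉0) (mixed x y))
    injˡ : ∀ {x x′} → x ≢ x′ → x ↑ˡ n ≢ x′ ↑ˡ n
    injˡ x≢x′ eq = x≢x′ (↑ˡ-injective n _ _ eq)
    injʳ : ∀ {y y′} → y ≢ y′ → m ↑ʳ y ≢ m ↑ʳ y′
    injʳ y≢y′ eq = y≢y′ (↑ʳ-injective m _ _ eq)
    FG : sum (uFG x̂) ≈ sum (λ x → uFG x ŷ)
    FG = rowSum≈columnSum uFG (λ _ _ → idempotent _ _) (λ _ y≢ → row-orthogonal _ (injʳ y≢))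
      (λ _ x≢ → column-orthogonal _ (injˡ x≢)) FG-rows FG-columns x̂ ŷ
    GF : sum (uGF ŷ) ≈ sum (λ y → uGF y x̂)
    GF = rowSum≈columnSum uGF (λ _ _ → idempotent _ _) (λ _ x≢ → row-orthogonal _ (injˡ x≢))
      (λ _ y≢ → column-orthogonal _ (injʳ y≢)) GF-rows GF-columns ŷ x̂
    -- The two off-diagonal blocks meet only through `uFF`: its row sum and column sum at `x̂`
    -- agree, and both off-diagonal sums are their complements in 1.
    FF : sum (uFG x̂) ≈ sum (λ y → uGF y x̂)
    FF = +-cancelˡ (sum (uFF x̂)) _ _ (begin
      sum (uFF x̂) + sum (uFG x̂)                      ≈⟨ rowTotal (x̂ ↑ˡ n) ⟩
      1#                                               ≈⟨ columnTotal (x̂ ↑ˡ n) ⟨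
      sum (λ z → uFF z x̂) + sum (λ y → uGF y x̂)      ≈⟨ +-congʳ (rowSum≈columnSum uFF (λ _ _ → idempotent _ _)
                                                            (λ _ x≢ → row-orthogonal _ (injˡ x≢)) (λ _ x≢ → column-orthogonal _ (injˡ x≢))
                                                            FF-rows FF-columns x̂ x̂) ⟨
      sum (uFF x̂) + sum (λ y → uGF y x̂)              ∎)

  -- Common copies of `p` cancel, and a remaining positive multiple of `p` cannot vanish because
  -- complex scalars can divide by it.
  ⨉-injective : ∀ {p} → ¬ p ≈ 0# → ∀ k l → k ⨉ p ≈ l ⨉ p → k ≡ l
  ⨉-injective p≉0 zero    zero    _  = ≡.refl
  ⨉-injective p≉0 zero    (suc l) eq = ⊥-elim (p≉0 (⨉≈0⇒≈0 l _ (sym eq)))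
  ⨉-injective p≉0 (suc k) zero    eq = ⊥-elim (p≉0 (⨉≈0⇒≈0 k _ eq))
  ⨉-injective p≉0 (suc k) (suc l) eq = ≡.cong suc (⨉-injective p≉0 k l (+-cancelˡ _ _ _ eq))

  module _ {p} (uniform : UniformBlocks p) where
    open UniformBlocks uniform

    absorbs-uFG : ∀ x y → p * uFG x y ≈ uFG x y
    absorbs-uFG x y = begin
      p * uFG x y                        ≈⟨ *-congʳ (rowFG x) ⟨
      sum (uFG x) * uFG x y              ≈⟨ *-distribʳ-sum (uFG x y) (uFG x) ⟩
      sum (λ y′ → uFG x y′ * uFG x y)    ≈⟨ sum-only {f = λ y′ → uFG x y′ * uFG x y} y
                                              (λ y≢ → row-orthogonal _ λ eq → y≢ (≡.sym (↑ʳ-injective m _ _ eq))) ⟩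
      uFG x y * uFG x y                  ≈⟨ idempotent _ _ ⟩
      uFG x y                            ∎

    -- This removes the lower right block in p A, so that tuples meeting the right half contribute
    -- nothing to rows indexed by the right half.
    annihilates-uGG : ∀ y y′ → p * uGG y y′ ≈ 0#
    annihilates-uGG y y′ = begin
      p * uGG y y′                       ≈⟨ *-congʳ (rowGF y) ⟨
      sum (uGF y) * uGG y y′             ≈⟨ *-distribʳ-sum (uGG y y′) (uGF y) ⟩
      sum (λ x → uGF y x * uGG y y′)     ≈⟨ sum-0 {f = λ x → uGF y x * uGG y y′} (λ x → row-orthogonal _ left≢right) ⟩
      0#                                 ∎

    sum-⋆ : ∀ {k} (f : Fin k → Carrier) → (∀ i → f i ⋆ ≈ f i) → sum f ⋆ ≈ sum f
    sum-⋆ {zero}  f f⋆ = +-cancelˡ (0# ⋆) _ _ (trans (sym (⋆-+-homo 0# 0#)) (trans (⋆-cong (+-identityʳ 0#)) (sym (+-identityʳ (0# ⋆)))))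
    sum-⋆ {suc k} f f⋆ = trans (⋆-+-homo (f zero) _) (+-cong (f⋆ zero) (sum-⋆ (f ∘ suc) (f⋆ ∘ suc)))

    block-projection : Fin m → IsProjection p
    block-projection x = idem , trans (⋆-cong (sym (rowFG x))) (trans (sum-⋆ (uFG x) λ y → selfAdjoint _ _) (rowFG x))
      where
      idem : p * p ≈ p
      idem = begin
        p * p                      ≈⟨ *-congˡ (rowFG x) ⟨
        p * sum (uFG x)            ≈⟨ *-distribˡ-sum p (uFG x) ⟩
        sum (λ y → p * uFG x y)    ≈⟨ sum-cong-≋ (absorbs-uFG x) ⟩
        sum (uFG x)                ≈⟨ rowFG x ⟩
        p                          ∎

    sum-commutes : ∀ {k} (f : Fin k → Carrier) {a} → sum f ≈ p → (∀ i → f i * a ≈ a * f i) → p * a ≈ a * p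
    sum-commutes f {a} Σf≈p comm = begin
      p * a                   ≈⟨ *-congʳ Σf≈p ⟨
      sum f * a               ≈⟨ *-distribʳ-sum a f ⟩
      sum (λ i → f i * a)     ≈⟨ sum-cong-≋ comm ⟩
      sum (λ i → a * f i)     ≈⟨ *-distribˡ-sum a f ⟨
      a * sum f               ≈⟨ *-congˡ Σf≈p ⟩
      a * p                   ∎

    -- Every row contains a block whose entries sum to `p`. Taking the one in row `a` reduces the
    -- claim to commutation of entries within a single row.
    block-commutes : ∀ a b → p * u a b ≈ u a b * p
    block-commutes a b with splitAt m a | join-splitAt m n a
    ... | inj₁ x | ≡.refl = sum-commutes (uFG x) (rowFG x) λ y → row-commute _ _ _
    ... | inj₂ y | ≡.refl = sum-commutes (uGF y) (rowGF y) λ x → row-commute _ _ _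

    -- Double counting: the sum of all entries of `uFG` is m p by rows and n p by columns.
    equinumerous : ¬ p ≈ 0# → m ≡ n
    equinumerous p≉0 = ⨉-injective p≉0 m n (begin
      m ⨉ p                                ≈⟨ sum-replicate m ⟨
      sum {m} (λ _ → p)                    ≈⟨ sum-cong-≋ rowFG ⟨
      sum (λ x → sum (uFG x))              ≈⟨ ∑-comm uFG ⟩
      sum (λ y → sum (λ x → uFG x y))      ≈⟨ sum-cong-≋ columnFG ⟩
      sum {n} (λ _ → p)                    ≈⟨ sum-replicate n ⟩
      n ⨉ p                                ∎)

-- From an automorphism of the direct sum to an isomorphism of the summands

module Restriction {c ℓ} (A : C*Algebra c ℓ) {m n} (u : Fin (m ℕ.+ n) → Fin (m ℕ.+ n) → C*Algebra.Carrier A)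
  (uGG≈0 : ∀ y y′ → C*Algebra._≈_ A (u (m ↑ʳ y) (m ↑ʳ y′)) (C*Algebra.0# A)) where
  open C*Algebra A hiding (zero)
  open SetoidReasoning setoid
  open import Algebra.Properties.Semiring.Sum semiring
  open TupleSum +-commutativeMonoid

  uGF : Fin n → Fin m → Carrier
  uGF y x = u (m ↑ʳ y) (x ↑ˡ n)

  tensorPower-vanishes : ∀ {k} (y : Vec (Fin n) k) {z} → Any (Right m n) z → tensorPower A u (Vec.map (m ↑ʳ_) y) z ≈ 0#
  tensorPower-vanishes (y ∷ ys) (here (y′ , ≡.refl)) = trans (*-congʳ (uGG≈0 y y′)) (zeroˡ _)
  tensorPower-vanishes (y ∷ ys) (there any)          = trans (*-congˡ (tensorPower-vanishes ys any)) (zeroʳ _)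

  tensorPower-uGF : ∀ {k} (y : Vec (Fin n) k) x → tensorPower A u (Vec.map (m ↑ʳ_) y) (Vec.map (_↑ˡ n) x) ≡ tensorPower A uGF y x
  tensorPower-uGF []       []       = ≡.refl
  tensorPower-uGF (y ∷ ys) (x ∷ xs) = ≡.cong (uGF y x *_) (tensorPower-uGF ys xs)

  -- The fixing equation is read at a tuple from the right half, where its right side is `G`. On the
  -- left side only tuples wholly in the left half survive, with values of `F`. Arity at least 1
  -- makes the row tuple unambiguously a right one.
  restrict-blockSum : ∀ {k} (F : Constraint m (suc k)) (G : Constraint n (suc k)) →
    Transports A u (blockSum F G) (blockSum F G) → Transports A uGF F G
  restrict-blockSum {k} F G fix y@(y₀ ∷ _) = begin
    tupleSum +-commutativeMonoid (suc k) (λ x → tensorPower A uGF y x * (F x · 1#))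
      ≈⟨ tupleSum-cong (suc k) (λ x → reflexive (≡.cong₂ (λ t α → t * (α · 1#)) (tensorPower-uGF y x) (blockSum-left F G x))) ⟨
    tupleSum +-commutativeMonoid (suc k) (λ x → tensorPower A u (Vec.map (m ↑ʳ_) y) (Vec.map (_↑ˡ n) x) * (blockSum F G (Vec.map (_↑ˡ n) x) · 1#))
      ≈⟨ tupleSum-left +-commutativeMonoid (suc k) (λ z → tensorPower A u (Vec.map (m ↑ʳ_) y) z * (blockSum F G z · 1#))
           (λ any → trans (*-congʳ (tensorPower-vanishes y any)) (zeroˡ _)) ⟨
    tupleSum +-commutativeMonoid (suc k) (λ z → tensorPower A u (Vec.map (m ↑ʳ_) y) z * (blockSum F G z · 1#))
      ≈⟨ fix (Vec.map (m ↑ʳ_) y) ⟩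
    blockSum F G (Vec.map (m ↑ʳ_) y) · 1#
      ≡⟨ ≡.cong (_· 1#) (blockSum-right F G {y} (here (y₀ , ≡.refl))) ⟩
    G y · 1# ∎

  -- In arity 1 the direct sum is the block sum of diagonal matrices. Evaluating at the doubled
  -- index (y, y), only diagonal terms remain, and idempotence merges the repeated entry into one.
  restrict-⊕ : (∀ y x → uGF y x * uGF y x ≈ uGF y x) → ∀ {k} → k ≥ 1 → (F : Constraint m k) (G : Constraint n k) →
    Transports A u (F ⊕ G) (F ⊕ G) → Transports A uGF F G
  restrict-⊕ idem {suc (suc k)} _ F G fix = restrict-blockSum F G fix
  restrict-⊕ idem {suc zero}    _ F G fix (y ∷ []) = begin
    sum (λ x → (uGF y x * 1#) * (F (x ∷ []) · 1#))
      ≈⟨ sum-cong-≋ diagonal-term ⟨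
    sum (λ x → sum (λ x′ → term x x′))
      ≈⟨ restrict-blockSum (diagonal F) (diagonal G) fix (y ∷ y ∷ []) ⟩
    diagonal G (y ∷ y ∷ []) · 1#
      ≡⟨ ≡.cong (_· 1#) (diagonal-≡ G y) ⟩
    G (y ∷ []) · 1# ∎
    where
    open IsLeftModule isLeftModule using (*ₗ-zeroˡ)
    term : Fin m → Fin m → Carrier
    term x x′ = (uGF y x * (uGF y x′ * 1#)) * (diagonal F (x ∷ x′ ∷ []) · 1#)
    diagonal-≡ : ∀ {m} (F : Constraint m 1) x → diagonal F (x ∷ x ∷ []) ≡ F (x ∷ [])
    diagonal-≡ F x rewrite dec-true (x ≟ x) ≡.refl = ≡.refl
    diagonal-≢ : ∀ {m} (F : Constraint m 1) {x x′} → x ≢ x′ → diagonal F (x ∷ x′ ∷ []) ≡ 0ᶜ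
    diagonal-≢ F {x} {x′} x≢x′ rewrite dec-false (x ≟ x′) x≢x′ = ≡.refl
    diagonal-term : ∀ x → sum (term x) ≈ (uGF y x * 1#) * (F (x ∷ []) · 1#)
    diagonal-term x = trans
      (sum-only {f = term x} x λ {x′} x≢x′ → trans
        (*-congˡ (trans (reflexive (≡.cong (_· 1#) (diagonal-≢ F x≢x′))) (*ₗ-zeroˡ 1#))) (zeroʳ _))
      (*-cong (trans (sym (*-assoc _ _ _)) (*-congʳ (idem y x))) (reflexive (≡.cong (_· 1#) (diagonal-≡ F x))))

module _ {c ℓ} (A : C*Algebra c ℓ) {p : C*Algebra.Carrier A} (p-proj : CStar.IsProjection A p)
  (central : ∀ a → C*Algebra._≈_ A (C*Algebra._*_ A p a) (C*Algebra._*_ A a p)) where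
  open C*Algebra A hiding (zero)
  open Quotient A p-proj central
  open import Algebra.Properties.Semiring.Sum semiring
  open TupleSum +-commutativeMonoid

  -- The quotient has the same operations, but the recursion is stuck on a variable tuple, so the
  -- agreement takes an induction.
  tensorPower-quotient : ∀ {n m k} (u : Fin n → Fin m → Carrier) (x : Vec (Fin n) k) y →
    tensorPower quotient u x y ≡ tensorPower A u x y
  tensorPower-quotient u []       []       = ≡.refl
  tensorPower-quotient u (x ∷ xs) (y ∷ ys) = ≡.cong (u x y *_) (tensorPower-quotient u xs ys)

  tupleSum-quotient : ∀ {m} k (f : Vec (Fin m) k → Carrier) →
    tupleSum (C*Algebra.+-commutativeMonoid quotient) k f ≡ tupleSum +-commutativeMonoid k f
  tupleSum-quotient zero    f = ≡.refl
  tupleSum-quotient (suc k) f = sum-cong-≗ λ i → tupleSum-quotient k λ x → f (i ∷ x)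

  Transports-quotient : ∀ {n m k} {u : Fin n → Fin m → Carrier} {f : Constraint m k} {g : Constraint n k} →
    Transports A u f g → Transports quotient u f g
  Transports-quotient {k = k} {u} {f} fg x = ≈⇒~ (trans (reflexive (tupleSum-quotient k _))
    (trans (tupleSum-cong k λ y → reflexive (≡.cong (_* (f y · 1#)) (tensorPower-quotient u x y))) (fg x)))

lemma13 : ∀ {c ℓ} {m n s : ℕ} {arity : Fin s → ℕ} → (∀ i → arity i ≥ 1) →
    (F : Family m arity) (G : Family n arity) →
    ConjugateClosed F → ConjugateClosed G →
    (∃ λ i → ProjectivelyConnected (F i) × ProjectivelyConnected (G i)) →
    (Q : Qut c ℓ (F ⊕ᶠ G)) →
    (∃₂ λ (x̂ : Fin m) (ŷ : Fin n) → Qut.SameOrbit Q (x̂ ↑ˡ n) (m ↑ʳ ŷ)) →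
    QuantumIsomorphic c ℓ F G
lemma13 {m = m} {n} arity≥1 F G _ _ (i , Fᵢ-conn , Gᵢ-conn) Q (x̂ , ŷ , u≉0) =
  m≡n , quotient , uGF , magic , λ i → restrict-⊕ (λ y x → ≈⇒~ (idempotent _ _)) (arity≥1 i) (F i) (G i)
    (Transports-quotient A p-proj central {f = (F ⊕ᶠ G) i} (fixes i))
  where
  open Qut Q using (relations) renaming (algebra to A; u to U)
  open QutRelations relations
  open IsQuantumPermutation isQuantumPermutation
  open C*Algebra A hiding (zero)
  open Blocks A {m} {n} isQuantumPermutation hiding (uGF)
  uniform = uniformBlocks Fᵢ-conn Gᵢ-conn (fixes i) x̂ ŷ
  p = proj₁ uniform
  open UniformBlocks (proj₂ uniform)
  p-proj = block-projection (proj₂ uniform) x̂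
  central = commutes-with-generators⇒central Q p-proj (block-commutes (proj₂ uniform))
  open Quotient A p-proj central
  open Restriction quotient {m} {n} U (λ y y′ → trans (annihilates-uGG (proj₂ uniform) y y′) (sym (zeroʳ p)))
  p≉0 : ¬ p ≈ 0#
  -- `p` absorbs every entry of the upper right block, including the one assumed nonzero.
  p≉0 p≈0 = u≉0 (trans (sym (absorbs-uFG (proj₂ uniform) x̂ ŷ)) (trans (*-congʳ p≈0) (zeroˡ _)))
  m≡n = equinumerous (proj₂ uniform) p≉0
  -- This is what p = 1 unfolds to in the quotient: `p` is its unit.
  pp≈p1 : p * p ≈ p * 1#
  pp≈p1 = trans (CStar.IsProjection.idem p-proj) (sym (*-identityʳ p))
  magic : IsQuantumPermutation quotient uGF
  magic = record
    { square      = ≡.sym m≡n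
    ; nontrivial  = λ p1≈p0 → p≉0 (trans (sym (*-identityʳ p)) (trans p1≈p0 (zeroʳ p)))
    ; idempotent  = λ y x → ≈⇒~ (idempotent _ _)
    ; selfAdjoint = λ y x → ≈⇒~ (selfAdjoint _ _)
    ; rowSum      = λ y → trans (≈⇒~ (rowGF y)) pp≈p1
    ; columnSum   = λ x → trans (≈⇒~ (columnGF x)) pp≈p1
    }
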